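{- Let $K$ be a number field and suppose $\beta\in K$ is not $0$ or a root of unity. Then there is a constant $B$ such that for every integer $n\ge 1$ the number of Galois orbits for $z^n-\beta$ is at most $B$; that is, the number of Galois orbits for $z^n-\beta$ is bounded by a constant independent of $n$.
   Context: The Galois orbits for $z^n-\beta$ are the orbits of $\mathrm{Gal}(\overline{K}/K)$ acting on the set of roots of $z^n-\beta$ in $\overline{K}$. -}

module Defs where

open import Level using (Level; _⊔_; suc)
open import Algebra.Apartness.Bundles using (HeytingField)
open import Algebra.Bundles using (Group; CommutativeRing)
open import Algebra.Morphism.Bundles using (RingHomomorphism)
open import Algebra.Morphism.Structures using (module RingMorphisms)
import Algebra.Morphism.Construct.Composition as Composition
import Algebra.Morphism.Construct.Identity as Identity
import Algebra.Properties.Semiring.Exp as Exp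
import Algebra.Properties.Monoid.Sum as Sum
open import Data.Empty.Polymorphic using (⊥)
open import Data.Fin.Base using (Fin)
open import Data.List.Base using (List; []; _∷_; foldr; map)
open import Data.List.Relation.Unary.Any using (Any)
open import Data.Nat.Base as ℕ using (ℕ)
open import Data.Product.Base using (Σ; ∃; _×_; _,_; proj₁; proj₂)
open import Data.Rational.Base using (ℚ; 0ℚ)
import Data.Rational.Properties as ℚ
open import Data.Vec.Functional using (Vector)
open import Function.Bundles using (Inverse)
open import Relation.Binary.Bundles using (Setoid)
open import Relation.Binary.PropositionalEquality.Core using (_≡_)
import Relation.Binary.PropositionalEquality.Properties as ≡

private
  variable
    a ℓ₁ ℓ₂ b m₁ m₂ : Level

-- A field is the library's HeytingField.  It is nontrivial, because 1 - 0 is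
-- invertible (so 0# # 1#) and # is irreflexive.  Elements required to be nonzero
-- as part of a definition satisfy _# 0#, that is, they are invertible;
-- classically this is the negation of _≈ 0#.

module FieldOps (F : HeytingField a ℓ₁ ℓ₂) where

  open HeytingField F public
    using (Carrier; _≈_; _#_; _+_; _*_; -_; _-_; 0#; 1#)

  open HeytingField F using (isCommutativeRing)

  commutativeRing : CommutativeRing a ℓ₁
  commutativeRing = record { isCommutativeRing = isCommutativeRing }

  open CommutativeRing commutativeRing public
    using (rawRing; ring; semiring; setoid; +-monoid)

  open Exp semiring public using (_^_)
  open Sum +-monoid public using (sum)

  IsRootOfUnity : Carrier → Set ℓ₁
  IsRootOfUnity x = ∃ λ m → 1 ℕ.≤ m × x ^ m ≈ 1#

  -- A polynomial is its list of coefficients, constant term first; trailing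
  -- zeros are allowed.
  Poly : Set a
  Poly = List Carrier

  eval : Poly → Carrier → Carrier
  eval p x = foldr (λ c r → c + x * r) 0# p

  NonZero : Poly → Set (a ⊔ ℓ₂)
  NonZero p = Any (_# 0#) p

  NonConstant : Poly → Set (a ⊔ ℓ₂)
  NonConstant []      = ⊥
  NonConstant (_ ∷ p) = NonZero p

FieldHom : HeytingField a ℓ₁ ℓ₂ → HeytingField b m₁ m₂ → Set (a ⊔ ℓ₁ ⊔ b ⊔ m₁)
FieldHom F E = RingHomomorphism (FieldOps.rawRing F) (FieldOps.rawRing E)

-- A field with a finite basis over ℚ.  The homomorphism from ℚ forces
-- characteristic zero and is unique up to _≈_.
record NumberField a ℓ₁ ℓ₂ : Set (suc (a ⊔ ℓ₁ ⊔ ℓ₂)) where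
  field
    heytingField : HeytingField a ℓ₁ ℓ₂

  open FieldOps heytingField public

  field
    fromℚ  : FieldHom ℚ.heytingField heytingField
    degree : ℕ
    basis  : Vector Carrier degree

  combination : Vector ℚ degree → Carrier
  combination q = sum (λ i → RingHomomorphism.⟦_⟧ fromℚ (q i) * basis i)

  field
    spanning    : ∀ x → ∃ λ q → x ≈ combination q
    independent : ∀ q → combination q ≈ 0# → ∀ i → q i ≡ 0ℚ

record AlgebraicClosure (F : HeytingField a ℓ₁ ℓ₂) b m₁ m₂
                        : Set (a ⊔ ℓ₁ ⊔ ℓ₂ ⊔ suc (b ⊔ m₁ ⊔ m₂)) where
  private
    module F = FieldOps F
  field
    heytingField : HeytingField b m₁ m₂
    embedding    : FieldHom F heytingField

  open FieldOps heytingField public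

  ι : F.Carrier → Carrier
  ι = RingHomomorphism.⟦_⟧ embedding

  field
    algebraic : ∀ y → ∃ λ p → F.NonZero p × eval (map ι p) y ≈ 0#
    closed    : ∀ p → NonConstant p → ∃ λ y → eval p y ≈ 0#

module Galois {F : HeytingField a ℓ₁ ℓ₂} (F̄ : AlgebraicClosure F b m₁ m₂) where

  private
    module F = FieldOps F
  open AlgebraicClosure F̄
  open Setoid setoid using (refl; sym; trans)
  open RingMorphisms rawRing rawRing using (IsRingIsomorphism)

  record Automorphism : Set (a ⊔ b ⊔ m₁) where
    field
      ⟦_⟧               : Carrier → Carrier
      isRingIsomorphism : IsRingIsomorphism ⟦_⟧
      fixes             : ∀ x → ⟦ ι x ⟧ ≈ ι x

    open IsRingIsomorphism isRingIsomorphism public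

  open Automorphism using (⟦_⟧)

  identity : Automorphism
  identity = record
    { ⟦_⟧               = λ y → y
    ; isRingIsomorphism = Identity.isRingIsomorphism rawRing refl
    ; fixes             = λ _ → refl
    }

  compose : Automorphism → Automorphism → Automorphism
  compose σ τ = record
    { ⟦_⟧               = λ y → ⟦ σ ⟧ (⟦ τ ⟧ y)
    ; isRingIsomorphism = Composition.isRingIsomorphism trans
                            τ.isRingIsomorphism σ.isRingIsomorphism
    ; fixes             = λ x → trans (σ.⟦⟧-cong (τ.fixes x)) (σ.fixes x)
    }
    where
    module σ = Automorphism σ
    module τ = Automorphism τ

  module _ (σ : Automorphism) where
    private
      module σ = Automorphism σ

    preimage : Carrier → Carrier
    preimage y = proj₁ (σ.surjective y)

    apply-preimage : ∀ y → ⟦ σ ⟧ (preimage y) ≈ y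
    apply-preimage y = proj₂ (σ.surjective y) refl

    preimage-unique : ∀ {x y} → ⟦ σ ⟧ x ≈ y → preimage y ≈ x
    preimage-unique {x} {y} eq = σ.injective (trans (apply-preimage y) (sym eq))

    preimage-cong : ∀ {x y} → x ≈ y → preimage x ≈ preimage y
    preimage-cong {x} {y} x≈y =
      preimage-unique (trans (apply-preimage y) (sym x≈y))

    inverse : Automorphism
    inverse = record
      { ⟦_⟧ = preimage
      ; isRingIsomorphism = record
        { isRingMonomorphism = record
          { isRingHomomorphism = record
            { isSemiringHomomorphism = record
              { isNearSemiringHomomorphism = record
                { +-isMonoidHomomorphism = record
                  { isMagmaHomomorphism = record
                    { isRelHomomorphism = record { cong = preimage-cong }
                    ; homo = λ x y → preimage-unique
                        (trans (σ.+-homo _ _) (+-cong (apply-preimage x) (apply-preimage y)))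
                    }
                  ; ε-homo = preimage-unique σ.0#-homo
                  }
                ; *-homo = λ x y → preimage-unique
                    (trans (σ.*-homo _ _) (*-cong (apply-preimage x) (apply-preimage y)))
                }
              ; 1#-homo = preimage-unique σ.1#-homo
              }
            ; -‿homo = λ x → preimage-unique
                (trans (σ.-‿homo _) (-‿cong (apply-preimage x)))
            }
          ; injective = λ {x} {y} eq →
              trans (sym (apply-preimage x)) (trans (σ.⟦⟧-cong eq) (apply-preimage y))
          }
        ; surjective = λ y → ⟦ σ ⟧ y , λ eq → preimage-unique (sym eq)
        }
      ; fixes = λ x → preimage-unique (σ.fixes x)
      }
      where
      open CommutativeRing commutativeRing using (+-cong; *-cong; -‿cong)

  GaloisGroup : Group (a ⊔ b ⊔ m₁) (b ⊔ m₁)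
  GaloisGroup = record
    { Carrier = Automorphism
    ; _≈_     = λ σ τ → ∀ y → ⟦ σ ⟧ y ≈ ⟦ τ ⟧ y
    ; _∙_     = compose
    ; ε       = identity
    ; _⁻¹     = inverse
    ; isGroup = record
      { isMonoid = record
        { isSemigroup = record
          { isMagma = record
            { isEquivalence = record
              { refl  = λ _ → refl
              ; sym   = λ σ≈τ y → sym (σ≈τ y)
              ; trans = λ σ≈τ τ≈υ y → trans (σ≈τ y) (τ≈υ y)
              }
            ; ∙-cong = λ {σ} {σ′} {τ} {τ′} σ≈σ′ τ≈τ′ y →
                trans (Automorphism.⟦⟧-cong σ (τ≈τ′ y)) (σ≈σ′ (⟦ τ′ ⟧ y))
            }
          ; assoc = λ _ _ _ _ → refl
          }
        ; identity = (λ _ _ → refl) , (λ _ _ → refl)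
        }
      ; inverse = (λ σ _ → preimage-unique σ refl) , (λ σ y → apply-preimage σ y)
      ; ⁻¹-cong = λ {σ} {τ} σ≈τ y → preimage-unique σ
          (trans (σ≈τ (preimage τ y)) (apply-preimage τ y))
      }
    }

  -- The polynomial z ^ n - β, for β in the base field.
  module _ (n : ℕ) (β : F.Carrier) where

    Root : Set (b ⊔ m₁)
    Root = Σ Carrier λ α → α ^ n - ι β ≈ 0#

    private
      ^-homo : ∀ σ y k → ⟦ σ ⟧ (y ^ k) ≈ ⟦ σ ⟧ y ^ k
      ^-homo σ y ℕ.zero    = Automorphism.1#-homo σ
      ^-homo σ y (ℕ.suc k) = trans (Automorphism.*-homo σ _ _) (*-cong refl (^-homo σ y k))
        where open CommutativeRing commutativeRing using (*-cong)

    infixr 7 _•_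
    _•_ : Group.Carrier GaloisGroup → Root → Root
    σ • (α , root) = ⟦ σ ⟧ α , trans (sym image) (trans (σ.⟦⟧-cong root) σ.0#-homo)
      where
      module σ = Automorphism σ
      open CommutativeRing commutativeRing using (+-cong; -‿cong)
      image : ⟦ σ ⟧ (α ^ n - ι β) ≈ ⟦ σ ⟧ α ^ n - ι β
      image = trans (σ.+-homo _ _)
        (+-cong (^-homo σ α n) (trans (σ.-‿homo _) (-‿cong (σ.fixes β))))

    -- The quotient of the roots by the Galois action: two roots are equal
    -- in this setoid when they lie in the same orbit.
    GaloisOrbits : Setoid (b ⊔ m₁) (a ⊔ b ⊔ m₁)
    GaloisOrbits = record
      { Carrier       = Root
      ; _≈_           = λ r s → ∃ λ σ → proj₁ (σ • r) ≈ proj₁ s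
      ; isEquivalence = record
        { refl  = identity , refl
        ; sym   = λ (σ , eq) → inverse σ , preimage-unique σ eq
        ; trans = λ (σ , eq) (τ , eq′) →
            compose τ σ , trans (Automorphism.⟦⟧-cong τ eq) eq′
        }
      }

    NumberOfGaloisOrbits : ℕ → Set (a ⊔ b ⊔ m₁)
    NumberOfGaloisOrbits k = Inverse (≡.setoid (Fin k)) GaloisOrbits

{-# OPTIONS --safe #-}

-- Let α be a root of z ^ n - β, of degree d over K, and let γ ∈ K be the product
-- of its conjugates.  Then γ ^ n = β ^ d.  For every j the element
-- x = γ ^ j β ^ -⌊jd/n⌋ of K satisfies x ^ n = β ^ r with r = jd mod n < n, so the
-- denominators and the archimedean size of x and of all its conjugates over ℚ
-- are bounded in terms of K and β alone; hence x lies in a finite set, of size C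
-- say.  By the pigeonhole principle two of x₀, …, x_C agree, and as β is not a
-- root of unity their exponents r agree as well, so n divides (j - i) d for some
-- i < j ≤ C.  Thus d ≥ n / C: every orbit has at least n / C elements, and there
-- are at most C orbits.  (Using γ ² in place of γ avoids signs at the cost of a
-- factor 2.)
--
-- There is no absolute value to work with.  Instead, a rational number c is
-- shown to be an integer of size at most R by bounding the denominators and
-- numerators of the coordinates of all its powers by C R ^ k, with an arbitrary
-- constant C.  Applied to the coefficients of the minimal polynomial of x, whose
-- roots lie in a fixed number field, this gives the finite set of candidates.
--
-- All of this is effective.  Elements of K, and hence of K̄, satisfy monic
-- equations over ℚ by linear algebra, so equality is decidable and K̄ can be
-- enumerated.  Membership in ℚ is decided by a rational root test, and membership
-- in k(y) from membership in k by interpolation at the conjugates of y.  Minimal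
-- polynomials are found by searching through products of linear factors, and
-- automorphisms of K̄ are built by extending along the enumeration.

module Submission where

open import Algebra.Apartness.Bundles using (HeytingField)
import Algebra.Apartness.Properties.HeytingCommutativeRing
open import Algebra.Bundles using (CommutativeRing)
open import Algebra.Bundles.Raw using (RawRing)
open import Algebra.Morphism.Bundles using (RingHomomorphism)
import Algebra.Morphism.Construct.Composition as Composition
import Algebra.Solver.Ring
open import Algebra.Solver.Ring.AlmostCommutativeRing using (_-Raw-AlmostCommutative⟶_; fromCommutativeRing)
open import Data.Empty using (⊥-elim)
import Data.Empty.Polymorphic as P
open import Data.Fin.Base as Fin using (Fin)
import Data.Fin.Properties as Fin
open import Data.Integer.Base as ℤ using (+[1+_]; +_; -[1+_]; ℤ; ∣_∣)
import Data.Integer.Properties as ℤ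
open import Data.List.Base as List using (List; []; _++_; _∷_; length)
open import Data.List.Membership.Propositional as Membership using (lose)
open import Data.List.Membership.Propositional.Properties as Membership using (∈-lookup)
import Data.List.Properties as List
open import Data.List.Relation.Binary.Pointwise as LPointwise using ([]; _∷_)
open import Data.List.Relation.Unary.All as LAll using ([]; _∷_)
import Data.List.Relation.Unary.All.Properties as LAll
open import Data.List.Relation.Unary.AllPairs as LAllPairs using ([]; _∷_)
import Data.List.Relation.Unary.AllPairs.Properties as LAllPairs
open import Data.List.Relation.Unary.Any as LAny using (here; there)
import Data.List.Relation.Unary.Any.Properties as LAny
open import Data.Maybe.Base using (Maybe; just; nothing)
open import Data.Nat.Base as ℕ using (_<_; _≤_; suc; s≤s; zero; z≤n; ℕ)
open import Data.Nat.Coprimality as Coprimality using (Coprime)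
open import Data.Nat.DivMod using (_%_; _/_; m%n<n; m≡m%n+[m/n]*n)
open import Data.Nat.Divisibility using (_∣_; divides; ∣-trans; ∣1⇒≡1; ∣⇒≤)
open import Data.Nat.Induction using (<-rec)
import Data.Nat.Properties as ℕ
open import Data.Nat.Tactic.RingSolver using (solve-∀)
open import Data.Product.Base using (_,_; _×_; proj₁; proj₂; ∃)
open import Data.Rational.Base as ℚ using (0ℚ; 1ℚ; ℚ; ↥_; ↧_)
open import Data.Rational.Literals using (fromℤ)
import Data.Rational.Properties as ℚ
import Data.Rational.Unnormalised.Base as ℚᵘ
import Data.Rational.Unnormalised.Properties as ℚᵘ
open import Data.Sum.Base using (_⊎_; inj₁; inj₂)
open import Data.Vec.Base as Vec using (Vec; []; _∷_; _∷ʳ_; map; replicate; toList; zipWith)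
import Data.Vec.Properties as Vec
open import Data.Vec.Relation.Binary.Pointwise.Inductive as Pointwise using (Pointwise; []; _∷_)
open import Data.Vec.Relation.Unary.All as All using (All; []; _∷_)
import Data.Vec.Relation.Unary.All.Properties as All
open import Data.Vec.Relation.Unary.AllPairs using (AllPairs; []; _∷_)
open import Defs
open import Function.Base using (id)
open import Level using (Level; Lift; _⊔_; lift; lower)
open import Relation.Binary.Definitions using (tri<; tri>; tri≈)
open import Relation.Binary.PropositionalEquality as ≡ using (_≡_)
open import Relation.Nullary.Decidable using (Dec; True; _×-dec_; fromWitness; map′; no; toWitness; yes)
open import Relation.Nullary.Negation using (¬_)
open import Relation.Unary using (Decidable)

-- The bounds have to be uniform in n, and the only uniform datum is a rate of growth. An equation y
-- ^ n = A ^ n β ^ r says nothing about y, ..., y ^ (n - 1), whose denominators may be arbitrary;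
-- but if A clears the denominators of all conjugates of β and r ≤ n, then multiplication by y ^ n
-- costs at most R ^ n, with R depending on K and β alone. So the powers y ^ k are bounded by C R ^
-- k, where C depends on y and n and must be removed afterwards. The removal works for rational
-- numbers only, hence for the coefficients of the minimal polynomial of y and not for y itself. The
-- rate therefore has to pass from the conjugates to their symmetric functions, and to powers of
-- these, without multiplying up the constants. For this reason a number is measured by its effect
-- on all monomials in the conjugates: the measure then behaves like an operator norm, and the
-- constants enter only once, in the element on which the operators act.

ℚ-ring : RawRing _ _
ℚ-ring = CommutativeRing.rawRing ℚ.+-*-commutativeRing

fromℤ-+ : ∀ i j → fromℤ (i ℤ.+ j) ≡ fromℤ i ℚ.+ fromℤ j
fromℤ-+ i j = ℚ.toℚᵘ-injective (ℚᵘ.≃-trans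
  (ℚᵘ.*≡* (≡.cong (ℤ._* + 1) (≡.sym (≡.cong₂ ℤ._+_ (ℤ.*-identityʳ i) (ℤ.*-identityʳ j)))))
  (ℚᵘ.≃-sym (ℚ.toℚᵘ-homo-+ (fromℤ i) (fromℤ j))))

fromℤ-* : ∀ i j → fromℤ (i ℤ.* j) ≡ fromℤ i ℚ.* fromℤ j
fromℤ-* i j = ℚ.toℚᵘ-injective (ℚᵘ.≃-trans
  (ℚᵘ.*≡* ≡.refl)
  (ℚᵘ.≃-sym (ℚ.toℚᵘ-homo-* (fromℤ i) (fromℤ j))))

fromℤ-neg : ∀ i → fromℤ (ℤ.- i) ≡ ℚ.- fromℤ i
fromℤ-neg i = ℚ.toℚᵘ-injective (ℚᵘ.≃-sym (ℚ.toℚᵘ-homo‿- (fromℤ i)))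

-- Algebras over ℚ.

module ℚAlgebra {a ℓ} (R : CommutativeRing a ℓ)
  (φ : RingHomomorphism ℚ-ring (CommutativeRing.rawRing R)) where

  open CommutativeRing R
  module φ = RingHomomorphism φ
  open φ using () renaming (⟦_⟧ to rat) public

  int : ℤ → Carrier
  int i = rat (fromℤ i)

  nat : ℕ → Carrier
  nat n = int (+ n)

  rat-cong : ∀ {p q} → p ≡ q → rat p ≈ rat q
  rat-cong p≡q = φ.⟦⟧-cong p≡q

  int-+ : ∀ i j → int (i ℤ.+ j) ≈ int i + int j
  int-+ i j = trans (rat-cong (fromℤ-+ i j)) (φ.+-homo _ _)

  int-* : ∀ i j → int (i ℤ.* j) ≈ int i * int j
  int-* i j = trans (rat-cong (fromℤ-* i j)) (φ.*-homo _ _)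

  int-neg : ∀ i → int (ℤ.- i) ≈ - int i
  int-neg i = trans (rat-cong (fromℤ-neg i)) (φ.-‿homo _)

  private
    -- Sends 0 and 1 to 0# and 1# definitionally, so that solver
    -- constants match those literals.
    coeff : ℤ → Carrier
    coeff (+ 0)           = 0#
    coeff (+ 1)           = 1#
    coeff i@(+[1+ suc _ ]) = int i
    coeff i@(-[1+ _ ])    = int i

    coeff≈int : ∀ i → coeff i ≈ int i
    coeff≈int (+ 0)           = sym φ.0#-homo
    coeff≈int (+ 1)           = sym φ.1#-homo
    coeff≈int +[1+ suc _ ]    = refl
    coeff≈int -[1+ _ ]        = refl

    morphism : CommutativeRing.rawRing ℤ.+-*-commutativeRing -Raw-AlmostCommutative⟶ fromCommutativeRing R
    morphism = record
      { ⟦_⟧    = coeff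
      ; +-homo = λ i j → trans (coeff≈int (i ℤ.+ j)) (trans (int-+ i j)
                   (+-cong (sym (coeff≈int i)) (sym (coeff≈int j))))
      ; *-homo = λ i j → trans (coeff≈int (i ℤ.* j)) (trans (int-* i j)
                   (*-cong (sym (coeff≈int i)) (sym (coeff≈int j))))
      ; -‿homo = λ i → trans (coeff≈int (ℤ.- i)) (trans (int-neg i)
                   (-‿cong (sym (coeff≈int i))))
      ; 0-homo = refl
      ; 1-homo = refl
      }

    coeff-≟ : ∀ i j → Maybe (coeff i ≈ coeff j)
    coeff-≟ i j with i ℤ.≟ j
    ... | yes ≡.refl = just refl
    ... | no _       = nothing

  open Algebra.Solver.Ring _ _ morphism coeff-≟ public
    using (solve; _:=_; _:+_; _:*_; _:-_; :-_; con)

-- Polynomials, and linear algebra over ℚ.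

module Polynomial {a ℓ} (R : CommutativeRing a ℓ)
  (φ : RingHomomorphism ℚ-ring (CommutativeRing.rawRing R)) where

  open ℚAlgebra R φ
  open CommutativeRing R

  -- The value at x of the polynomial with low coefficients p, constant term
  -- first, and leading coefficient t.
  ev : ∀ {n} → Carrier → Vec Carrier n → Carrier → Carrier
  ev t []      x = t
  ev t (c ∷ p) x = c + x * ev t p x

  ev-cong : ∀ {n s t x y} {p q : Vec Carrier n} → s ≈ t → Pointwise _≈_ p q → x ≈ y → ev s p x ≈ ev t q y
  ev-cong s≈t []         x≈y = s≈t
  ev-cong s≈t (c≈d ∷ ps) x≈y = +-cong c≈d (*-cong x≈y (ev-cong s≈t ps x≈y))

  ≋-refl : ∀ {n} {p : Vec Carrier n} → Pointwise _≈_ p p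
  ≋-refl = Pointwise.refl refl

  ev-cong₁ : ∀ {n s t x} (p : Vec Carrier n) → s ≈ t → ev s p x ≈ ev t p x
  ev-cong₁ p s≈t = ev-cong s≈t (≋-refl {p = p}) refl

  ev-cong₃ : ∀ {n t x y} (p : Vec Carrier n) → x ≈ y → ev t p x ≈ ev t p y
  ev-cong₃ p x≈y = ev-cong refl (≋-refl {p = p}) x≈y

  ev-+ : ∀ {n} s t (p q : Vec Carrier n) x → ev (s + t) (zipWith _+_ p q) x ≈ ev s p x + ev t q x
  ev-+ s t []      []      x = refl
  ev-+ s t (c ∷ p) (d ∷ q) x = trans (+-congˡ (*-congˡ (ev-+ s t p q x)))
    (solve 5 (λ c d x u v → c :+ d :+ x :* (u :+ v) := c :+ x :* u :+ (d :+ x :* v)) refl c d x _ _)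

  ev-* : ∀ {n} c t (p : Vec Carrier n) x → ev (c * t) (map (c *_) p) x ≈ c * ev t p x
  ev-* c t []      x = refl
  ev-* c t (d ∷ p) x = trans (+-congˡ (*-congˡ (ev-* c t p x)))
    (solve 4 (λ c d x u → c :* d :+ x :* (c :* u) := c :* (d :+ x :* u)) refl c d x _)

  ev₀-+ : ∀ {n} (p q : Vec Carrier n) x → ev 0# (zipWith _+_ p q) x ≈ ev 0# p x + ev 0# q x
  ev₀-+ p q x = trans (ev-cong₁ (zipWith _+_ p q) (sym (+-identityˡ 0#))) (ev-+ 0# 0# p q x)

  ev₀-* : ∀ {n} c (p : Vec Carrier n) x → ev 0# (map (c *_) p) x ≈ c * ev 0# p x
  ev₀-* c p x = trans (ev-cong₁ (map (c *_) p) (sym (zeroʳ c))) (ev-* c 0# p x)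

  ev-∷ʳ : ∀ {n} (p : Vec Carrier n) t x → ev 0# (p ∷ʳ t) x ≈ ev t p x
  ev-∷ʳ []      t x = solve 2 (λ t x → t :+ x :* con (+ 0) := t) refl t x
  ev-∷ʳ (c ∷ p) t x = +-congˡ (*-congˡ (ev-∷ʳ p t x))

  ev-zero : ∀ {n} {p : Vec Carrier n} x → All (_≈ 0#) p → ev 0# p x ≈ 0#
  ev-zero x []         = refl
  ev-zero x (c≈0 ∷ ps) = trans (+-cong c≈0 (*-congˡ (ev-zero x ps)))
    (solve 1 (λ x → con (+ 0) :+ x :* con (+ 0) := con (+ 0)) refl x)

  Algebraic : Carrier → Set ℓ
  Algebraic y = ∃ λ n → ∃ λ (p : Vec ℚ n) → ev 1# (map rat p) y ≈ 0#

  open import Algebra.Properties.Semiring.Exp semiring public using (_^_)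

  ev-lead : ∀ {n} t (p : Vec Carrier n) x → ev t p x ≈ ev 0# p x + t * x ^ n
  ev-lead t []      x = solve 1 (λ t → t := con (+ 0) :+ t :* con (+ 1)) refl t
  ev-lead {suc n} t (c ∷ p) x = trans (+-congˡ (*-congˡ (ev-lead t p x)))
    (solve 5 (λ c x u t w → c :+ x :* (u :+ t :* w) := c :+ x :* u :+ t :* (x :* w)) refl c x _ t _)

  -- The recursion exposes the coefficient of the head, which elimination compares with `0ℚ`.
  Span : List Carrier → Carrier → Set ℓ
  Span []       z = z ≈ 0#
  Span (v ∷ vs) z = ∃ λ q → Span vs (z - rat q * v)

  span-cong : ∀ vs {z z′} → z ≈ z′ → Span vs z → Span vs z′
  span-cong []       z≈z′ s       = trans (sym z≈z′) s
  span-cong (v ∷ vs) z≈z′ (q , s) = q , span-cong vs (+-congʳ z≈z′) s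

  span-0 : ∀ vs → Span vs 0#
  span-0 []       = refl
  span-0 (v ∷ vs) = 0ℚ , span-cong vs
    (sym (trans (+-congˡ (-‿cong (*-congʳ φ.0#-homo)))
      (solve 1 (λ v → con (+ 0) :- con (+ 0) :* v := con (+ 0)) refl v)))
    (span-0 vs)

  span-+ : ∀ vs {y z} → Span vs y → Span vs z → Span vs (y + z)
  span-+ []       s s′ = trans (+-cong s s′) (+-identityˡ 0#)
  span-+ (v ∷ vs) {y} {z} (q , s) (q′ , s′) = q ℚ.+ q′ , span-cong vs
    (trans
      (solve 5 (λ y z q r v → (y :- q :* v) :+ (z :- r :* v) := y :+ z :- (q :+ r) :* v) refl y z _ _ v)
      (+-congˡ (-‿cong (*-congʳ (sym (φ.+-homo q q′))))))
    (span-+ vs s s′)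

  span-* : ∀ vs r {z} → Span vs z → Span vs (rat r * z)
  span-* []       r s = trans (*-congˡ s) (zeroʳ _)
  span-* (v ∷ vs) r {z} (q , s) = r ℚ.* q , span-cong vs
    (trans
      (solve 4 (λ r z q v → r :* (z :- q :* v) := r :* z :- (r :* q) :* v) refl _ z _ v)
      (+-congˡ (-‿cong (*-congʳ (sym (φ.*-homo r q))))))
    (span-* vs r s)

  span-weaken : ∀ v vs {z} → Span vs z → Span (v ∷ vs) z
  span-weaken v vs {z} s = 0ℚ , span-cong vs
    (sym (trans (+-congˡ (-‿cong (*-congʳ φ.0#-homo)))
      (solve 2 (λ z v → z :- con (+ 0) :* v := z) refl z v)))
    s

  span-head : ∀ v vs → Span (v ∷ vs) v
  span-head v vs = 1ℚ , span-cong vs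
    (sym (trans (+-congˡ (-‿cong (*-congʳ φ.1#-homo)))
      (solve 1 (λ v → v :- con (+ 1) :* v := con (+ 0)) refl v)))
    (span-0 vs)

  span-all : ∀ vs → LAll.All (Span vs) vs
  span-all []       = []
  span-all (v ∷ vs) = span-head v vs ∷ LAll.map (span-weaken v vs) (span-all vs)

  span-trans : ∀ vs ws {z} → LAll.All (Span ws) vs → Span vs z → Span ws z
  span-trans []       ws []         s       = span-cong ws (sym s) (span-0 ws)
  span-trans (v ∷ vs) ws {z} (t ∷ ts) (q , s) = span-cong ws
    (solve 3 (λ z q v → (z :- q :* v) :+ q :* v := z) refl z _ v)
    (span-+ ws (span-trans vs ws ts s) (span-* ws q t))

  -- Dependence singles out an entry in the span of the entries after it. On a descending list of
  -- powers this is a monic relation, with no leading coefficient to divide by.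
  Dependent : List Carrier → Set ℓ
  Dependent []       = P.⊥
  Dependent (w ∷ ws) = Span ws w ⊎ Dependent ws

  private
    Reduces : Carrier → Carrier → Carrier → Set ℓ
    Reduces w x y = ∃ λ q → x ≈ y + rat q * w

    span-reduced : ∀ {w} {xs ys} zs → LPointwise.Pointwise (Reduces w) xs ys →
                   LAll.All (Span (xs ++ w ∷ zs)) (ys ++ zs)
    span-reduced {w} zs [] = LAll.tail (span-all (w ∷ zs))
    span-reduced {w} {x ∷ xs} {y ∷ ys} zs ((q , x≈) ∷ rs) =
      span-cong V (trans (+-cong x≈ (*-congʳ (φ.-‿homo q)))
          (solve 3 (λ y q w → y :+ q :* w :+ (:- q) :* w := y) refl y _ w))
        (span-+ V (span-head x (xs ++ w ∷ zs))
           (span-* V (ℚ.- q) (span-weaken x (xs ++ w ∷ zs) (LAll.head (LAll.++⁻ʳ xs (span-all (xs ++ w ∷ zs)))))))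
      ∷ LAll.map (span-weaken x (xs ++ w ∷ zs)) (span-reduced zs rs)
      where V = x ∷ xs ++ w ∷ zs

    -- The entries before `w` change only by multiples of `w`, which comes after them in the list,
    -- so an expression of one of them by later entries survives.
    dependent-reduced : ∀ {w} {xs ys} zs → LPointwise.Pointwise (Reduces w) xs ys →
                        Dependent (ys ++ zs) → Dependent (xs ++ w ∷ zs)
    dependent-reduced zs [] d = inj₂ d
    dependent-reduced {w} {x ∷ xs} {y ∷ ys} zs ((q , x≈) ∷ rs) (inj₁ s) = inj₁
      (span-cong V (sym x≈) (span-+ V
        (span-trans (ys ++ zs) V (span-reduced zs rs) s)
        (span-* V q (LAll.head (LAll.++⁻ʳ xs (span-all V))))))
      where V = xs ++ w ∷ zs
    dependent-reduced zs (_ ∷ rs) (inj₂ d) = inj₂ (dependent-reduced zs rs d)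

    -- The pivot found below is the last entry with nonzero `v`-coefficient. The entries after it
    -- already avoid `v`, and those before it can be corrected by multiples of it without disturbing
    -- the order to which `Dependent` refers.
    data Pivot (v : Carrier) (vs : List Carrier) : List Carrier → Set (a ⊔ ℓ) where
      none : ∀ {ws} → LAll.All (Span vs) ws → Pivot v vs ws
      some : ∀ xs {w zs} → LAll.All (Span (v ∷ vs)) xs →
             ∀ q → ¬ q ≡ 0ℚ → Span vs (w - rat q * v) →
             LAll.All (Span vs) zs → Pivot v vs (xs ++ w ∷ zs)

    pivot : ∀ v vs {ws} → LAll.All (Span (v ∷ vs)) ws → Pivot v vs ws
    pivot v vs [] = none []
    pivot v vs {w ∷ ws} ((q , s) ∷ ss) with pivot v vs ss
    ... | some xs ps q′ q′≢0 s′ ps′ = some (w ∷ xs) ((q , s) ∷ ps) q′ q′≢0 s′ ps′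
    ... | none ps with q ℚ.≟ 0ℚ
    ...   | no q≢0     = some [] [] q q≢0 s ps
    ...   | yes ≡.refl = none (span-cong vs
            (trans (+-congˡ (-‿cong (*-congʳ φ.0#-homo)))
              (solve 2 (λ z v → z :- con (+ 0) :* v := z) refl w v)) s ∷ ps)

    rat-inverse : ∀ q → ¬ q ≡ 0ℚ → ∃ λ r → rat r * rat q ≈ 1#
    rat-inverse q q≢0 = ℚ.1/ q , trans (sym (φ.*-homo _ q)) (trans (rat-cong (ℚ.*-inverseˡ q)) φ.1#-homo)
      where instance _ = ℚ.≢-nonZero q≢0

    reduce : ∀ v vs {w} q → ¬ q ≡ 0ℚ → Span vs (w - rat q * v) →
             ∀ {xs} → LAll.All (Span (v ∷ vs)) xs →
             ∃ λ ys → LPointwise.Pointwise (Reduces w) xs ys × LAll.All (Span vs) ys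
    reduce v vs q q≢0 s [] = [] , [] , []
    reduce v vs {w} q q≢0 s {x ∷ xs} ((p , t) ∷ ts) with reduce v vs q q≢0 s ts | rat-inverse q q≢0
    ... | ys , rs , us | r , rq≈1 = x - rat c * w ∷ ys
      , (c , solve 3 (λ x c w → x := x :- c :* w :+ c :* w) refl x _ w) ∷ rs
      , span-cong vs step (span-+ vs t (span-* vs (ℚ.- c) s)) ∷ us
      where
      -- The quotient p / q: this multiple of the pivot cancels the `v`-coefficient of `x`.
      c = p ℚ.* r
      step : x - rat p * v + rat (ℚ.- c) * (w - rat q * v) ≈ x - rat c * w
      step = trans (+-congˡ (*-congʳ (φ.-‿homo c)))
        (trans (solve 6 (λ x p v c w q → x :- p :* v :+ (:- c) :* (w :- q :* v)
                  := x :- c :* w :+ (c :* q :- p) :* v) refl x (rat p) v (rat c) w (rat q))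
        (trans (+-congˡ (*-congʳ (trans (+-congʳ (trans (*-congʳ (φ.*-homo p r))
                  (trans (*-assoc _ _ _) (trans (*-congˡ rq≈1) (*-identityʳ _))))) (-‿inverseʳ _))))
          (solve 2 (λ y v → y :+ con (+ 0) :* v := y) refl _ v)))

  -- Gaussian elimination: either no entry involves `v`, or the pivot is spent on removing it, which
  -- shortens both lists by one.
  span-dependent : ∀ vs {ws} → length vs < length ws → LAll.All (Span vs) ws → Dependent ws
  span-dependent []       {_ ∷ ws} (s≤s _) (s ∷ _) = inj₁ (span-cong ws (sym s) (span-0 ws))
  span-dependent (v ∷ vs) lt      ss with pivot v vs ss
  ... | none ps = span-dependent vs (ℕ.<-trans (ℕ.n<1+n _) lt) ps
  ... | some xs {w} {zs} ps q q≢0 s ps′ with reduce v vs q q≢0 s ps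
  ...   | ys , rs , us = dependent-reduced zs rs
          (span-dependent vs lt′ (LAll.++⁺ us ps′))
    where
    len : length (xs ++ w ∷ zs) ≡ suc (length (ys ++ zs))
    len = ≡.trans (List.length-++ xs) (≡.trans (ℕ.+-suc _ _) (≡.cong suc
      (≡.trans (≡.cong (ℕ._+ length zs) (LPointwise.Pointwise-length rs)) (≡.sym (List.length-++ ys)))))
    lt′ : length vs < length (ys ++ zs)
    lt′ = ℕ.s≤s⁻¹ (≡.subst (suc (length vs) <_) len lt)

  private
    powers : Carrier → ℕ → List Carrier
    powers x zero    = []
    powers x (suc n) = x ^ n ∷ powers x n

    length-powers : ∀ x n → length (powers x n) ≡ n
    length-powers x zero    = ≡.refl
    length-powers x (suc n) = ≡.cong suc (length-powers x n)

    span-powers : ∀ x n {z} → Span (powers x n) z → ∃ λ (h : Vec ℚ n) → z ≈ ev 0# (map rat h) x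
    span-powers x zero    s = [] , s
    span-powers x (suc n) {z} (q , s) with span-powers x n s
    ... | h , eq = h ∷ʳ q , trans
      (trans (solve 3 (λ z q w → z := z :- q :* w :+ q :* w) refl z _ _) (+-congʳ eq))
      (trans (sym (ev-lead (rat q) (map rat h) x)) (trans (sym (ev-∷ʳ (map rat h) (rat q) x))
        (reflexive (≡.cong (λ p → ev 0# p x) (≡.sym (map-∷ʳ h q))))))
      where
      map-∷ʳ : ∀ {n} (h : Vec ℚ n) q → map rat (h ∷ʳ q) ≡ map rat h ∷ʳ rat q
      map-∷ʳ []      q = ≡.refl
      map-∷ʳ (x ∷ h) q = ≡.cong (rat x ∷_) (map-∷ʳ h q)

    dependent-powers : ∀ x n → Dependent (powers x n) → ∃ λ m → m < n × Span (powers x m) (x ^ m)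
    dependent-powers x (suc n) (inj₁ s) = n , ℕ.≤-refl , s
    dependent-powers x (suc n) (inj₂ d) with dependent-powers x n d
    ... | m , m<n , s = m , ℕ.m<n⇒m<1+n m<n , s

  -- By linear dependence of the powers of x.
  finite⇒algebraic : ∀ vs x → (∀ n → Span vs (x ^ n)) →
    ∃ λ n → n ≤ length vs × ∃ λ (p : Vec ℚ n) → ev 1# (map rat p) x ≈ 0#
  finite⇒algebraic vs x ss = n , ℕ.s≤s⁻¹ n≤ , map (ℚ.-_) h , eq
    where
    N = suc (length vs)
    all : ∀ n → LAll.All (Span vs) (powers x n)
    all zero    = []
    all (suc n) = ss n ∷ all n
    dep = dependent-powers x N
      (span-dependent vs (≡.subst (length vs <_) (≡.sym (length-powers x N)) ℕ.≤-refl) (all N))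
    n  = proj₁ dep
    n≤ = proj₁ (proj₂ dep)
    h  = proj₁ (span-powers x n (proj₂ (proj₂ dep)))
    xⁿ≈ = proj₂ (span-powers x n (proj₂ (proj₂ dep)))
    neg : ∀ {n} (h : Vec ℚ n) → ev 0# (map rat (map (ℚ.-_) h)) x ≈ - ev 0# (map rat h) x
    neg []      = sym (solve 0 (:- con (+ 0) := con (+ 0)) refl)
    neg (c ∷ h) = trans (+-cong (φ.-‿homo c) (*-congˡ (neg h)))
      (solve 3 (λ c x u → :- c :+ x :* (:- u) := :- (c :+ x :* u)) refl _ x _)
    eq : ev 1# (map rat (map (ℚ.-_) h)) x ≈ 0#
    eq = trans (ev-lead 1# (map rat (map (ℚ.-_) h)) x)
      (trans (+-cong (neg h) (trans (*-identityˡ _) xⁿ≈)) (-‿inverseˡ _))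

-- Algebraically closed fields over ℚ, and decidable equality of algebraic elements.

record ClosedField a ℓ : Set (Level.suc (a ⊔ ℓ)) where
  field
    commutativeRing : CommutativeRing a ℓ
    φ               : RingHomomorphism ℚ-ring (CommutativeRing.rawRing commutativeRing)

  open CommutativeRing commutativeRing public
  open ℚAlgebra commutativeRing φ public
  open Polynomial commutativeRing φ public

  field
    _≟_       : ∀ x y → Dec (x ≈ y)
    inv       : Carrier → Carrier
    inverse   : ∀ x → ¬ x ≈ 0# → x * inv x ≈ 1#
    1≉0       : ¬ 1# ≈ 0#
    root      : ∀ {n} (p : Vec Carrier (ℕ.suc n)) → ∃ λ y → ev 1# p y ≈ 0#
    algebraic : ∀ y → Algebraic y

module HeytingAlgebra {a ℓ₁ ℓ₂} (F : HeytingField a ℓ₁ ℓ₂)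
  (φ : RingHomomorphism ℚ-ring (FieldOps.rawRing F)) where

  open HeytingField F using (_#_; heytingCommutativeRing; #-cotrans; #⇒invertible; tight; #-irrefl)
  open CommutativeRing (FieldOps.commutativeRing F)
  open ℚAlgebra (FieldOps.commutativeRing F) φ public
  open Polynomial (FieldOps.commutativeRing F) φ public
  open Algebra.Apartness.Properties.HeytingCommutativeRing heytingCommutativeRing public
    using (1#0; x#0y#0→xy#0; invertibleʳ⇒#)

  right-inverse : ∀ {x} → x # 0# → ∃ λ y → x * y ≈ 1#
  right-inverse {x} x#0 with #⇒invertible x#0
  ... | y , _ , eq = y , trans (*-congʳ (solve 1 (λ x → x := x :- con (+ 0)) refl x)) eq

  invertible⇒#0 : ∀ {x y} → x * y ≈ 1# → x # 0#
  invertible⇒#0 {x} {y} eq = invertibleʳ⇒# (y , trans (*-congʳ (solve 1 (λ x → x :- con (+ 0) := x) refl x)) eq)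

  #0⇒≉0 : ∀ {x} → x # 0# → ¬ x ≈ 0#
  #0⇒≉0 x#0 x≈0 = #-irrefl x≈0 x#0

  Decided : Carrier → Set (ℓ₁ ⊔ ℓ₂)
  Decided x = x ≈ 0# ⊎ x # 0#

  rat-decided : ∀ q → Decided (rat q)
  rat-decided q with q ℚ.≟ 0ℚ
  ... | yes ≡.refl = inj₁ φ.0#-homo
  ... | no q≢0     = inj₂ (invertible⇒#0 (trans (sym (φ.*-homo q (ℚ.1/ q)))
          (trans (rat-cong (ℚ.*-inverseʳ q)) φ.1#-homo)))
    where instance _ = ℚ.≢-nonZero q≢0

  private
    ^#0 : ∀ {x} k → x # 0# → x ^ k # 0#
    ^#0 zero    x#0 = 1#0
    ^#0 (suc k) x#0 = x#0y#0→xy#0 x#0 (^#0 k x#0)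

    product#0 : ∀ {x y} → x * y # 0# → x # 0#
    product#0 xy#0 with right-inverse xy#0
    ... | z , eq = invertible⇒#0 (trans (sym (*-assoc _ _ z)) eq)

    -- Cotransitivity at the lowest nonzero coefficient.
    factor : ∀ {n} (p : Vec Carrier n) y → All Decided p →
             y # 0# ⊎ ∃ λ k → ∃ λ w → ev 1# p y ≈ y ^ k * w × w # 0#
    factor []      y []             = inj₂ (0 , 1# , sym (*-identityˡ 1#) , 1#0)
    factor (c ∷ p) y (inj₁ c≈0 ∷ ds) with factor p y ds
    ... | inj₁ y#0                = inj₁ y#0
    ... | inj₂ (k , w , eq , w#0) = inj₂ (suc k , w ,
          trans (+-cong c≈0 (*-congˡ eq))
            (solve 3 (λ y u w → con (+ 0) :+ y :* (u :* w) := y :* u :* w) refl y _ w) , w#0)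
    factor (c ∷ p) y (inj₂ c#0 ∷ ds) with #-cotrans c#0 (ev 1# (c ∷ p) y)
    ... | inj₂ e#0 = inj₂ (0 , _ , sym (*-identityˡ _) , e#0)
    ... | inj₁ c#e with #⇒invertible c#e
    ...   | z , _ , eq = inj₁ (product#0 {y = - (ev 1# p y * z)} (invertible⇒#0 {y = 1#}
            (trans (solve 4 (λ c y u z → y :* (:- (u :* z)) :* con (+ 1) := (c :- (c :+ y :* u)) :* z) refl c y _ z) eq)))

  -- In the second case of `factor`, `y # 0#` would make the value `y ^ k * w` apart from zero, so
  -- tightness yields `y ≈ 0#`.
  root-decided : ∀ {n} (p : Vec Carrier n) y → All Decided p → ev 1# p y ≈ 0# → Decided y
  root-decided p y ds eq with factor p y ds
  ... | inj₁ y#0 = inj₂ y#0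
  ... | inj₂ (k , w , eq′ , w#0) = inj₁ (proj₁ (tight y 0#) λ y#0 →
          #0⇒≉0 (x#0y#0→xy#0 (^#0 k y#0) w#0) (trans (sym eq′) eq))

  algebraic-decided : ∀ y → Algebraic y → Decided y
  algebraic-decided y (n , p , eq) = root-decided (map rat p) y (All.map⁺ (All.universal rat-decided p)) eq

-- The number field and its algebraic closure.

module NumberFieldProperties {a ℓ₁ ℓ₂} (K : NumberField a ℓ₁ ℓ₂) where

  open NumberField K using (heytingField; fromℚ; degree; basis; combination; spanning; commutativeRing)
  open CommutativeRing commutativeRing
  open HeytingAlgebra heytingField fromℚ public

  span-sum : ∀ {D} (q : Fin D → ℚ) (f : Fin D → Carrier) →
             Span (List.tabulate f) (NumberField.sum K (λ i → rat (q i) * f i))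
  span-sum {zero}  q f = refl
  span-sum {suc D} q f = q Fin.zero , span-cong (List.tabulate (λ i → f (Fin.suc i)))
    (solve 2 (λ u v → v := u :+ v :- u) refl _ _) (span-sum (λ i → q (Fin.suc i)) (λ i → f (Fin.suc i)))

  span-basis : ∀ x → Span (List.tabulate basis) x
  span-basis x with spanning x
  ... | q , x≈ = span-cong (List.tabulate basis) (sym x≈) (span-sum q basis)

  algebraic≤ : ∀ x → ∃ λ n → n ≤ degree × ∃ λ (p : Vec ℚ n) → ev 1# (map rat p) x ≈ 0#
  algebraic≤ x with finite⇒algebraic (List.tabulate basis) x (λ n → span-basis (x ^ n))
  ... | n , n≤ , p , eq = n , ≡.subst (n ≤_) (List.length-tabulate basis) n≤ , p , eq

  decided : ∀ x → Decided x
  decided x with algebraic≤ x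
  ... | n , _ , p , eq = algebraic-decided x (n , p , eq)

module Closure {a ℓ₁ ℓ₂ b m₁ m₂} (K : NumberField a ℓ₁ ℓ₂)
  (K̄ : AlgebraicClosure (NumberField.heytingField K) b m₁ m₂) where

  private
    module K where
      open NumberFieldProperties K public
      open NumberField K public using (Carrier; _#_; basis; commutativeRing)
      open CommutativeRing commutativeRing public hiding (Carrier)

  open AlgebraicClosure K̄ using (heytingField; embedding; ι; algebraic; closed; eval; commutativeRing)
  open HeytingField heytingField using (_#_)
  module ι = RingHomomorphism embedding

  embedℚ : RingHomomorphism ℚ-ring (CommutativeRing.rawRing commutativeRing)
  embedℚ = record { isRingHomomorphism =
    Composition.isRingHomomorphism (CommutativeRing.trans commutativeRing) K.φ.isRingHomomorphism ι.isRingHomomorphism }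

  private
    module Ω = HeytingAlgebra heytingField embedℚ
  open CommutativeRing commutativeRing
  open Ω

  ι-# : ∀ {x} → x K.# K.0# → ι x # 0#
  ι-# {x} x#0 with K.right-inverse x#0
  ... | y , eq = invertible⇒#0 (trans (sym (ι.*-homo x y)) (trans (ι.⟦⟧-cong eq) ι.1#-homo))

  ι-decided : ∀ x → Decided (ι x)
  ι-decided x with K.decided x
  ... | inj₁ x≈0 = inj₁ (trans (ι.⟦⟧-cong x≈0) ι.0#-homo)
  ... | inj₂ x#0 = inj₂ (ι-# x#0)

  private
    -- A `Poly` may end in zeros, so its leading coefficient has to be located by deciding equality
    -- in K before the polynomial can be made monic.
    Leading : List K.Carrier → Set _
    Leading p = LAll.All (K._≈ K.0#) p ⊎ ∃ λ n → ∃ λ t → ∃ λ (q : Vec K.Carrier n) →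
      t K.# K.0# × (∀ y → eval (List.map ι p) y ≈ ev (ι t) (map ι q) y)

    eval-zero : ∀ {p} y → LAll.All (K._≈ K.0#) p → eval (List.map ι p) y ≈ 0#
    eval-zero y []         = refl
    eval-zero y (c≈0 ∷ cs) = trans (+-cong (trans (ι.⟦⟧-cong c≈0) ι.0#-homo) (*-congˡ (eval-zero y cs)))
      (solve 1 (λ y → con (+ 0) :+ y :* con (+ 0) := con (+ 0)) refl y)

    leading : ∀ p → Leading p
    leading []      = inj₁ []
    leading (c ∷ p) with leading p
    ... | inj₂ (n , t , q , t#0 , eq) = inj₂ (suc n , t , c ∷ q , t#0 , λ y → +-congˡ (*-congˡ (eq y)))
    ... | inj₁ zs with K.decided c
    ...   | inj₁ c≈0 = inj₁ (c≈0 ∷ zs)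
    ...   | inj₂ c#0 = inj₂ (0 , c , [] , c#0 , λ y → trans (+-congˡ (*-congˡ (eval-zero y zs)))
            (solve 2 (λ c y → c :+ y :* con (+ 0) := c) refl _ y))

  monic : ∀ y → ∃ λ n → ∃ λ (q : Vec K.Carrier n) → ev 1# (map ι q) y ≈ 0#
  monic y with algebraic y
  ... | p , nonzero , eq with leading p
  ...   | inj₁ zs = ⊥-elim (impossible nonzero zs)
    where
    impossible : ∀ {p} → LAny.Any (K._# K.0#) p → LAll.All (K._≈ K.0#) p → _
    impossible (here c#0) (c≈0 ∷ _)  = K.#0⇒≉0 c#0 c≈0
    impossible (there c∈) (_ ∷ zs)   = impossible c∈ zs
  ...   | inj₂ (n , t , q , t#0 , eq′) with K.right-inverse t#0
  ...     | s , ts≈1 = n , map (s K.*_) q , trans (ev-cong one (scaled q) refl)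
              (trans (ev-* (ι s) (ι t) (map ι q) y) (trans (*-congˡ (trans (sym (eq′ y)) eq)) (zeroʳ _)))
    where
    one : 1# ≈ ι s * ι t
    one = trans (sym ι.1#-homo) (trans (ι.⟦⟧-cong (K.trans (K.sym ts≈1) (K.*-comm t s))) (ι.*-homo s t))
    scaled : ∀ {n} (q : Vec K.Carrier n) → Pointwise _≈_ (map ι (map (s K.*_) q)) (map (ι s *_) (map ι q))
    scaled []      = []
    scaled (c ∷ q) = ι.*-homo s c ∷ scaled q

  decided : ∀ y → Decided y
  decided y with monic y
  ... | n , q , eq = root-decided (map ι q) y (All.map⁺ (All.universal ι-decided q)) eq

  private
    span-map : ∀ y vs {z} → Span vs z → Span (List.map (y *_) vs) (y * z)
    span-map y []       s       = trans (*-congˡ s) (zeroʳ y)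
    span-map y (v ∷ vs) {z} (q , s) = q , span-cong (List.map (y *_) vs)
      (solve 4 (λ y z q v → y :* (z :- q :* v) := y :* z :- q :* (y :* v)) refl y z _ v) (span-map y vs s)

    span-++ˡ : ∀ vs ws {z} → Span vs z → Span (vs ++ ws) z
    span-++ˡ vs ws = span-trans vs (vs ++ ws) (LAll.++⁻ˡ vs (span-all (vs ++ ws)))

    span-++ʳ : ∀ vs ws {z} → Span ws z → Span (vs ++ ws) z
    span-++ʳ vs ws = span-trans ws (vs ++ ws) (LAll.++⁻ʳ vs (span-all (vs ++ ws)))

  module _ (y : Carrier) where
    private
      block : ℕ → List Carrier
      block i = List.tabulate (λ j → ι (K.basis j) * y ^ i)

      V : ℕ → List Carrier
      V zero    = []
      V (suc n) = block n ++ V n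

      ι-span : ∀ {D} (f : Fin D → K.Carrier) x → K.Span (List.tabulate f) x → ∀ w →
               Span (List.tabulate (λ j → ι (f j) * w)) (ι x * w)
      ι-span {zero} f x s w = trans (*-congʳ (trans (ι.⟦⟧-cong s) ι.0#-homo)) (zeroˡ w)
      ι-span {suc D} f x (q , s) w = q , span-cong vs
        (trans (*-congʳ (trans (ι.+-homo _ _) (+-congˡ (trans (ι.-‿homo _) (-‿cong (ι.*-homo _ _))))))
          (solve 4 (λ x q b w → (x :- q :* b) :* w := x :* w :- q :* (b :* w)) refl _ _ _ w))
        (ι-span (λ j → f (Fin.suc j)) _ s w)
        where vs = List.tabulate (λ j → ι (f (Fin.suc j)) * w)

      span-V : ∀ {i n} → i < n → ∀ x → Span (V n) (ι x * y ^ i)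
      span-V {i} {suc n} i<n x with ℕ.m<1+n⇒m<n∨m≡n i<n
      ... | inj₁ i<n′   = span-++ʳ (block n) (V n) (span-V i<n′ x)
      ... | inj₂ ≡.refl = span-++ˡ (block n) (V n) (ι-span K.basis x (K.span-basis x) (y ^ n))

      Term : ℕ → Carrier → Set _
      Term n v = ∃ λ x → ∃ λ i → i < n × v ≈ ι x * y ^ i

      terms : ∀ n → LAll.All (Term n) (V n)
      terms zero    = []
      terms (suc n) = LAll.++⁺ (LAll.tabulate⁺ (λ j → K.basis j , n , ℕ.≤-refl , refl))
        (LAll.map (λ (x , i , i<n , eq) → x , i , ℕ.m<n⇒m<1+n i<n , eq) (terms n))

    -- If `y` satisfies a monic equation of degree `N` over K, the products of the basis of K with
    -- the powers `y ^ i` for i < N span a ℚ-space that is stable under multiplication by `y`. It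
    -- contains 1, hence all powers of `y`.
    algebraic-over-ℚ : Algebraic y
    algebraic-over-ℚ with monic y
    ... | zero , [] , eq  = ⊥-elim (#0⇒≉0 1#0 eq)
    ... | N@(suc _) , q , eq = proj₁ res , proj₂ (proj₂ res)
      where
      span-ev : ∀ {n} (r : Vec K.Carrier n) k x → k ℕ.+ n ≤ N → Span (V N) (ι x * (y ^ k * ev 0# (map ι r) y))
      span-ev []      k x le = span-cong (V N) (solve 2 (λ x u → con (+ 0) := x :* (u :* con (+ 0))) refl _ _) (span-0 (V N))
      span-ev {suc n} (c ∷ r) k x le = span-cong (V N)
        (trans (+-congʳ (*-congʳ (ι.*-homo x c)))
        (solve 5 (λ x c y u v → x :* c :* u :+ x :* ((y :* u) :* v) := x :* (u :* (c :+ y :* v))) refl _ _ y _ _))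
        (span-+ (V N) (span-V (ℕ.≤-trans (ℕ.m<m+n k (s≤s z≤n)) le) (x K.* c))
          (span-ev r (suc k) x (≡.subst (_≤ N) (ℕ.+-suc k n) le)))

      span-top : ∀ x → Span (V N) (ι x * y ^ N)
      span-top x = span-cong (V N)
        (trans (*-congʳ (ι.-‿homo x))
        (trans (solve 4 (λ x v w z → :- x :* (con (+ 1) :* v) := x :* w :- x :* (v :+ con (+ 1) :* w)) refl _ _ _ (ι x))
        (trans (+-congˡ (-‿cong (*-congˡ (trans (sym (ev-lead 1# (map ι q) y)) eq))))
          (solve 2 (λ x w → x :* w :- x :* con (+ 0) := x :* w) refl _ _))))
        (span-ev q 0 (K.- x) ℕ.≤-refl)

      span-next : ∀ {i} → i < N → ∀ x → Span (V N) (ι x * (y * y ^ i))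
      span-next {i} i<N x with ℕ.m<1+n⇒m<n∨m≡n (s≤s i<N)
      ... | inj₁ i+1<N  = span-V i+1<N x
      ... | inj₂ ≡.refl = span-top x

      span-y : ∀ {z} → Span (V N) z → Span (V N) (y * z)
      span-y s = span-trans (List.map (y *_) (V N)) (V N)
        (LAll.map⁺ (LAll.map (λ (x , i , i<N , v≈) → span-cong (V N)
          (trans (solve 3 (λ x y u → x :* (y :* u) := y :* (x :* u)) refl _ y _) (*-congˡ (sym v≈))) (span-next {i} i<N x)) (terms N)))
        (span-map y (V N) s)

      spans : ∀ n → Span (V N) (y ^ n)
      spans zero    = span-cong (V N) (trans (*-congʳ ι.1#-homo) (*-identityˡ 1#)) (span-V {0} {N} (s≤s z≤n) K.1#)
      spans (suc n) = span-y (spans n)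

      res = finite⇒algebraic (V N) y spans

  private
    coefficients : ∀ {n} → Carrier → Vec Carrier n → List Carrier
    coefficients t []      = t ∷ []
    coefficients t (c ∷ p) = c ∷ coefficients t p

    eval-coefficients : ∀ {n} t (p : Vec Carrier n) y → eval (coefficients t p) y ≈ ev t p y
    eval-coefficients t []      y = solve 2 (λ t y → t :+ y :* con (+ 0) := t) refl t y
    eval-coefficients t (c ∷ p) y = +-congˡ (*-congˡ (eval-coefficients t p y))

    coefficients-nonzero : ∀ {n} t (p : Vec Carrier n) → t # 0# → LAny.Any (_# 0#) (coefficients t p)
    coefficients-nonzero t []      t#0 = here t#0
    coefficients-nonzero t (c ∷ p) t#0 = there (coefficients-nonzero t p t#0)

    invert : ∀ {y} → Decided y → Carrier
    invert (inj₁ _)   = 0#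
    invert (inj₂ y#0) = proj₁ (right-inverse y#0)

    invert-correct : ∀ {y} (d : Decided y) → ¬ y ≈ 0# → y * invert d ≈ 1#
    invert-correct (inj₁ y≈0) y≉0 = ⊥-elim (y≉0 y≈0)
    invert-correct (inj₂ y#0) y≉0 = proj₂ (right-inverse y#0)

    decide : ∀ {x y} → Decided (x - y) → Dec (x ≈ y)
    decide {x} {y} (inj₁ eq)  = yes (trans (solve 2 (λ x y → x := x :- y :+ y) refl x y) (trans (+-congʳ eq) (+-identityˡ y)))
    decide {x} {y} (inj₂ x#y) = no λ eq → #0⇒≉0 x#y (trans (+-congʳ eq) (-‿inverseʳ y))

  closedField : ClosedField b m₁
  closedField = record
    { commutativeRing = commutativeRing
    ; φ         = embedℚ
    ; _≟_       = λ x y → decide (decided (x - y))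
    ; inv       = λ y → invert (decided y)
    ; inverse   = λ y → invert-correct (decided y)
    ; 1≉0       = #0⇒≉0 1#0
    ; root      = λ where (c ∷ p) → let y , eq = closed (c ∷ coefficients 1# p) (coefficients-nonzero 1# p 1#0)
                                   in y , trans (sym (eval-coefficients 1# (c ∷ p) y)) eq
    ; algebraic = algebraic-over-ℚ
    }

  ι-injective : ∀ {x y} → ι x ≈ ι y → x K.≈ y
  ι-injective {x} {y} eq with K.decided (x K.- y)
  ... | inj₁ d≈0 = K.trans (K.solve 2 (λ x y → x K.:= x K.:- y K.:+ y) K.refl x y) (K.trans (K.+-congʳ d≈0) (K.+-identityˡ y))
  ... | inj₂ d#0 = ⊥-elim (#0⇒≉0 (ι-# d#0) (trans (ι.+-homo _ _) (trans (+-cong eq (ι.-‿homo y)) (-‿inverseʳ _))))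

-- Roots, linear factors, interpolation and division with remainder.

AllPairs-lookup : ∀ {a r} {A : Set a} {R : A → A → Set r} {xs} → LAllPairs.AllPairs R xs →
                  ∀ i j → i Fin.< j → R (List.lookup xs i) (List.lookup xs j)
AllPairs-lookup (p ∷ ps) Fin.zero    (Fin.suc j) lt = LAll.lookup p (∈-lookup j)
AllPairs-lookup (p ∷ ps) (Fin.suc i) (Fin.suc j) lt = AllPairs-lookup ps i j (ℕ.s≤s⁻¹ lt)

module Roots {a ℓ} (Ω : ClosedField a ℓ) where
  open ClosedField Ω

  infix 4 _∈ᴸ_
  _∈ᴸ_ : Carrier → List Carrier → Set (a ⊔ ℓ)
  x ∈ᴸ xs = LAny.Any (x ≈_) xs

  x-y≈0⇒x≈y : ∀ {x y} → x - y ≈ 0# → x ≈ y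
  x-y≈0⇒x≈y {x} {y} eq = trans (solve 2 (λ x y → x := x :- y :+ y) refl x y) (trans (+-congʳ eq) (+-identityˡ y))

  x≈y⇒x-y≈0 : ∀ {x y} → x ≈ y → x - y ≈ 0#
  x≈y⇒x-y≈0 eq = trans (+-congʳ eq) (-‿inverseʳ _)

  *-cancelˡ : ∀ {x y z} → x ≉ 0# → x * y ≈ x * z → y ≈ z
  *-cancelˡ {x} {y} {z} x≉0 eq = trans (lem y) (trans (*-congˡ eq) (sym (lem z)))
    where
    lem : ∀ w → w ≈ inv x * (x * w)
    lem w = trans (sym (*-identityˡ w)) (trans (*-congʳ (sym (inverse x x≉0)))
      (solve 3 (λ x i w → x :* i :* w := i :* (x :* w)) refl x (inv x) w))

  *-zero : ∀ x y → x * y ≈ 0# → x ≈ 0# ⊎ y ≈ 0#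
  *-zero x y eq with x ≟ 0#
  ... | yes x≈0 = inj₁ x≈0
  ... | no x≉0  = inj₂ (*-cancelˡ x≉0 (trans eq (sym (zeroʳ x))))

  *-≉0 : ∀ {x y} → x ≉ 0# → y ≉ 0# → x * y ≉ 0#
  *-≉0 x≉0 y≉0 eq with *-zero _ _ eq
  ... | inj₁ x≈0 = x≉0 x≈0
  ... | inj₂ y≈0 = y≉0 y≈0

  ^-≉0 : ∀ {x} n → x ≉ 0# → x ^ n ≉ 0#
  ^-≉0 zero    x≉0 = 1≉0
  ^-≉0 (suc n) x≉0 = *-≉0 x≉0 (^-≉0 n x≉0)

  rat-≉0 : ∀ {q} → ¬ q ≡ 0ℚ → rat q ≉ 0#
  rat-≉0 {q} q≢0 eq = 1≉0 (trans (sym φ.1#-homo) (trans (rat-cong (≡.sym (ℚ.*-inverseʳ q)))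
    (trans (φ.*-homo q (ℚ.1/ q)) (trans (*-congʳ eq) (zeroˡ _)))))
    where instance _ = ℚ.≢-nonZero q≢0

  nat-≉0 : ∀ n .{{_ : ℕ.NonZero n}} → nat n ≉ 0#
  nat-≉0 (suc n) = rat-≉0 λ ()

  same-index⇒≈ : ∀ {x y zs} (p : x ∈ᴸ zs) (q : y ∈ᴸ zs) → LAny.index p ≡ LAny.index q → x ≈ y
  same-index⇒≈ {zs = zs} p q eq = trans (LAny.lookup-index p)
    (trans (reflexive (≡.cong (List.lookup zs) eq)) (sym (LAny.lookup-index q)))

  pigeonhole : ∀ {zs ys} → LAllPairs.AllPairs _≉_ zs → LAll.All (_∈ᴸ ys) zs → length zs ≤ length ys
  pigeonhole {zs} {ys} distinct members with length zs ℕ.≤? length ys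
  ... | yes le = le
  ... | no nle =
    let i , j , i<j , eq = Fin.pigeonhole (ℕ.≰⇒> nle) (λ i → LAny.index (member members i))
    in ⊥-elim (AllPairs-lookup distinct i j i<j (same-index⇒≈ (member members i) (member members j) eq))
    where
    member : ∀ {zs} → LAll.All (_∈ᴸ ys) zs → ∀ i → List.lookup zs i ∈ᴸ ys
    member (m ∷ ms) Fin.zero    = m
    member (m ∷ ms) (Fin.suc i) = member ms i

  infix 4 _≋_
  _≋_ : ∀ {n} → Vec Carrier n → Vec Carrier n → Set (a ⊔ ℓ)
  _≋_ = Pointwise _≈_

  ≋-sym : ∀ {n} {p q : Vec Carrier n} → p ≋ q → q ≋ p
  ≋-sym = Pointwise.sym sym

  ≋-trans : ∀ {n} {p q r : Vec Carrier n} → p ≋ q → q ≋ r → p ≋ r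
  ≋-trans = Pointwise.trans trans

  addHead : ∀ {n} → Carrier → Vec Carrier (suc n) → Vec Carrier (suc n)
  addHead c (d ∷ p) = c + d ∷ p

  mulLinear : ∀ {n} → Carrier → Vec Carrier n → Vec Carrier (suc n)
  mulLinear r []      = - r ∷ []
  mulLinear r (c ∷ p) = - (r * c) ∷ addHead c (mulLinear r p)

  ev-addHead : ∀ {n} t c (p : Vec Carrier (suc n)) x → ev t (addHead c p) x ≈ c + ev t p x
  ev-addHead t c (d ∷ p) x = +-assoc c d _

  ev-mulLinear : ∀ {n} r (p : Vec Carrier n) x → ev 1# (mulLinear r p) x ≈ (x - r) * ev 1# p x
  ev-mulLinear r []      x = solve 2 (λ r x → :- r :+ x :* con (+ 1) := (x :- r) :* con (+ 1)) refl r x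
  ev-mulLinear r (c ∷ p) x = trans (+-congˡ (*-congˡ (trans (ev-addHead 1# c (mulLinear r p) x) (+-congˡ (ev-mulLinear r p x)))))
    (solve 4 (λ r c x u → :- (r :* c) :+ x :* (c :+ (x :- r) :* u) := (x :- r) :* (c :+ x :* u)) refl r c x _)

  mulLinear-cong : ∀ {n r s} {p q : Vec Carrier n} → r ≈ s → p ≋ q → mulLinear r p ≋ mulLinear s q
  mulLinear-cong r≈s []         = -‿cong r≈s ∷ []
  mulLinear-cong r≈s (c≈d ∷ ps) = -‿cong (*-cong r≈s c≈d) ∷ addHead-cong c≈d (mulLinear-cong r≈s ps)
    where
    addHead-cong : ∀ {n c d} {p q : Vec Carrier (suc n)} → c ≈ d → p ≋ q → addHead c p ≋ addHead d q
    addHead-cong c≈d (e ∷ es) = +-cong c≈d e ∷ es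

  fromRoots : ∀ {n} → Vec Carrier n → Vec Carrier n
  fromRoots []       = []
  fromRoots (r ∷ rs) = mulLinear r (fromRoots rs)

  fromRoots-cong : ∀ {n} {rs ss : Vec Carrier n} → rs ≋ ss → fromRoots rs ≋ fromRoots ss
  fromRoots-cong []         = []
  fromRoots-cong (eq ∷ eqs) = mulLinear-cong eq (fromRoots-cong eqs)

  fromRoots-root : ∀ {n} (rs : Vec Carrier n) {x} → x ∈ᴸ toList rs → ev 1# (fromRoots rs) x ≈ 0#
  fromRoots-root (r ∷ rs) {x} (here x≈r) = trans (ev-mulLinear r (fromRoots rs) x)
    (trans (*-congʳ (x≈y⇒x-y≈0 x≈r)) (zeroˡ _))
  fromRoots-root (r ∷ rs) {x} (there x∈) = trans (ev-mulLinear r (fromRoots rs) x)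
    (trans (*-congˡ (fromRoots-root rs x∈)) (zeroʳ _))

  root-fromRoots : ∀ {n} (rs : Vec Carrier n) {x} → ev 1# (fromRoots rs) x ≈ 0# → x ∈ᴸ toList rs
  root-fromRoots []       eq = ⊥-elim (1≉0 eq)
  root-fromRoots (r ∷ rs) {x} eq with *-zero _ _ (trans (sym (ev-mulLinear r (fromRoots rs) x)) eq)
  ... | inj₁ x-r≈0 = here (x-y≈0⇒x≈y x-r≈0)
  ... | inj₂ eq′   = there (root-fromRoots rs eq′)

  -- Synthetic division by T - r: the coefficients of the quotient are the Horner values at `r` of
  -- the tails.
  quot : ∀ {n} → Carrier → Carrier → Vec Carrier (suc n) → Vec Carrier n
  quot t r (c ∷ [])    = []
  quot t r (c ∷ d ∷ p) = ev t (d ∷ p) r ∷ quot t r (d ∷ p)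

  ev-quot : ∀ {n} t r (p : Vec Carrier (suc n)) x → ev t p x ≈ (x - r) * ev t (quot t r p) x + ev t p r
  ev-quot t r (c ∷ [])    x = solve 4 (λ t r c x → c :+ x :* t := (x :- r) :* t :+ (c :+ r :* t)) refl t r c x
  ev-quot t r (c ∷ d ∷ p) x = trans (+-congˡ (*-congˡ (ev-quot t r (d ∷ p) x)))
    (solve 5 (λ r c x u v → c :+ x :* ((x :- r) :* v :+ u) := (x :- r) :* (u :+ x :* v) :+ (c :+ r :* u)) refl r c x _ _)

  mulLinear-quot : ∀ {n} r (p : Vec Carrier (suc n)) → addHead (ev 1# p r) (mulLinear r (quot 1# r p)) ≋ p
  mulLinear-quot r (c ∷ [])    = solve 2 (λ r c → c :+ r :* con (+ 1) :+ :- r := c) refl r c ∷ []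
  mulLinear-quot r (c ∷ d ∷ p) = solve 3 (λ r c u → c :+ r :* u :+ :- (r :* u) := c) refl r c _ ∷ mulLinear-quot r (d ∷ p)

  split : ∀ {n} (p : Vec Carrier n) → ∃ λ rs → p ≋ fromRoots rs
  split []            = [] , []
  split p@(_ ∷ _) with root p
  ... | r , eq with split (quot 1# r p)
  ...   | rs , eqs = r ∷ rs , ≋-trans (factored p eq) (mulLinear-cong refl eqs)
    where
    addHead-0 : ∀ {n c} (q : Vec Carrier (suc n)) → c ≈ 0# → addHead c q ≋ q
    addHead-0 (d ∷ q) c≈0 = trans (+-congʳ c≈0) (+-identityˡ d) ∷ ≋-refl
    factored : ∀ {n} (p : Vec Carrier (suc n)) → ev 1# p r ≈ 0# → p ≋ mulLinear r (quot 1# r p)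
    factored p eq = ≋-trans (≋-sym (mulLinear-quot r p)) (addHead-0 _ eq)

  roots : ∀ {n} → Vec Carrier n → Vec Carrier n
  roots p = proj₁ (split p)

  roots-sound : ∀ {n} (p : Vec Carrier n) {x} → x ∈ᴸ toList (roots p) → ev 1# p x ≈ 0#
  roots-sound p x∈ = trans (ev-cong refl (proj₂ (split p)) refl) (fromRoots-root (roots p) x∈)

  roots-complete : ∀ {n} (p : Vec Carrier n) {x} → ev 1# p x ≈ 0# → x ∈ᴸ toList (roots p)
  roots-complete p eq = root-fromRoots (roots p) (trans (sym (ev-cong refl (proj₂ (split p)) refl)) eq)

  vanishing : ∀ {n} (f : Vec Carrier n) {xs : Vec Carrier n} → AllPairs _≉_ xs →
              All (λ x → ev 0# f x ≈ 0#) xs → All (_≈ 0#) f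
  vanishing []          []              []         = []
  vanishing {suc n} f {x ∷ xs} (apart ∷ distinct) (eq ∷ eqs) = zero-quot f eq
    (vanishing (quot 0# x f) distinct (quotients apart eqs))
    where
    quotients : ∀ {m} {ys : Vec Carrier m} → All (x ≉_) ys → All (λ y → ev 0# f y ≈ 0#) ys → All (λ y → ev 0# (quot 0# x f) y ≈ 0#) ys
    quotients []         []         = []
    quotients (ne ∷ nes) (e ∷ es) with *-zero _ _ (trans (sym (trans (ev-quot 0# x f _) (trans (+-congˡ eq) (+-identityʳ _)))) e)
    ... | inj₁ y-x≈0 = ⊥-elim (ne (sym (x-y≈0⇒x≈y y-x≈0)))
    ... | inj₂ e′    = e′ ∷ quotients nes es
    zero-quot : ∀ {n} (f : Vec Carrier (suc n)) → ev 0# f x ≈ 0# → All (_≈ 0#) (quot 0# x f) → All (_≈ 0#) f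
    zero-quot (c ∷ [])    eq []       = trans (solve 2 (λ c x → c := c :+ x :* con (+ 0)) refl c x) eq ∷ []
    zero-quot (c ∷ d ∷ f) eq (z ∷ zs) = trans (trans (solve 2 (λ c x → c := c :+ x :* con (+ 0)) refl c x) (+-congˡ (*-congˡ (sym z)))) eq
      ∷ zero-quot (d ∷ f) z zs

  derivative : ∀ {n} → Vec Carrier n → Carrier → Carrier
  derivative []      x = 0#
  derivative (c ∷ p) x = ev 1# p x + x * derivative p x

  derivative-cong : ∀ {n x y} {p q : Vec Carrier n} → p ≋ q → x ≈ y → derivative p x ≈ derivative q y
  derivative-cong []        x≈y = refl
  derivative-cong (_ ∷ eqs) x≈y = +-cong (ev-cong refl eqs x≈y) (*-cong x≈y (derivative-cong eqs x≈y))

  derivative-mulLinear : ∀ {n} r (p : Vec Carrier n) x → derivative (mulLinear r p) x ≈ ev 1# p x + (x - r) * derivative p x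
  derivative-mulLinear r []      x = solve 2 (λ r x → con (+ 1) :+ x :* con (+ 0) := con (+ 1) :+ (x :- r) :* con (+ 0)) refl r x
  derivative-mulLinear r (c ∷ p) x = trans (+-cong (trans (ev-addHead 1# c (mulLinear r p) x) (+-congˡ (ev-mulLinear r p x)))
      (*-congˡ (trans (derivative-addHead (mulLinear r p)) (derivative-mulLinear r p x))))
    (solve 5 (λ r c x u v → (c :+ (x :- r) :* u) :+ x :* (u :+ (x :- r) :* v) := (c :+ x :* u) :+ (x :- r) :* (u :+ x :* v)) refl r c x _ _)
    where
    derivative-addHead : ∀ {n} (q : Vec Carrier (suc n)) → derivative (addHead c q) x ≈ derivative q x
    derivative-addHead (d ∷ q) = refl

  -- Only the low coefficients; the leading one is `nat (suc n)`. The recursion is the product rule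
  -- for c + T p.
  derive : ∀ {n} → Vec Carrier (suc n) → Vec Carrier n
  derive (c ∷ [])    = []
  derive (c ∷ d ∷ p) = zipWith _+_ (d ∷ p) (0# ∷ derive (d ∷ p))

  ev-derive : ∀ {n} (p : Vec Carrier (suc n)) x → ev (nat (suc n)) (derive p) x ≈ derivative p x
  ev-derive (c ∷ [])    x = trans φ.1#-homo (solve 1 (λ x → con (+ 1) := con (+ 1) :+ x :* con (+ 0)) refl x)
  ev-derive {suc n} (c ∷ d ∷ p) x = trans
    (ev-cong₁ (derive (c ∷ d ∷ p)) (trans (int-+ (+ 1) (+ suc n)) (+-congʳ φ.1#-homo)))
    (trans (ev-+ 1# (nat (suc n)) (d ∷ p) (0# ∷ derive (d ∷ p)) x)
      (+-congˡ (trans (+-identityˡ _) (*-congˡ (ev-derive (d ∷ p) x)))))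

  -- If `r` occurs again among `rs`, both terms of the product rule for (T - r) p vanish at `r`.
  simple⇒distinct : ∀ {n} (rs : Vec Carrier n) →
    (∀ {x} → x ∈ᴸ toList rs → derivative (fromRoots rs) x ≉ 0#) → AllPairs _≉_ rs
  simple⇒distinct []       simple = []
  simple⇒distinct (r ∷ rs) simple =
    All.toList⁻ (apart (toList rs) λ r∈ → simple (here refl)
      (trans (derivative-mulLinear r (fromRoots rs) r)
        (trans (+-cong (fromRoots-root rs r∈) (trans (*-congʳ (-‿inverseʳ r)) (zeroˡ _))) (+-identityˡ 0#))))
    ∷ simple⇒distinct rs λ {x} x∈ eq → simple (there x∈)
        (trans (derivative-mulLinear r (fromRoots rs) x)
          (trans (+-cong (fromRoots-root rs x∈) (trans (*-congˡ eq) (zeroʳ _))) (+-identityˡ 0#)))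
    where
    apart : ∀ xs → ¬ r ∈ᴸ xs → LAll.All (r ≉_) xs
    apart xs r∉ = LAll.¬Any⇒All¬ xs r∉

  -- Newton interpolation.
  interpolate : ∀ {n} → Vec Carrier n → Vec Carrier n → Vec Carrier n
  interpolate []       []       = []
  interpolate (x ∷ xs) (w ∷ ws) =
    zipWith _+_ (h ∷ʳ 0#) (map ((w - ev 0# h x) * inv (ev 1# (fromRoots xs) x) *_) (fromRoots xs ∷ʳ 1#))
    where h = interpolate xs ws

  interpolate-correct : ∀ {n} {xs : Vec Carrier n} (ws : Vec Carrier n) → AllPairs _≉_ xs →
                        Pointwise (λ x w → ev 0# (interpolate xs ws) x ≈ w) xs ws
  interpolate-correct []       []          = []
  interpolate-correct {xs = x ∷ xs} (w ∷ ws) (apart ∷ distinct) =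
    trans (value x) (trans (solve 4 (λ h w i e → h :+ (w :- h) :* i :* e := h :+ (w :- h) :* (e :* i)) refl (ev 0# h x) w _ _)
      (trans (+-congˡ (*-congˡ (inverse (ev 1# (fromRoots xs) x) λ e≈0 →
          all-any (All.toList⁺ apart) (root-fromRoots xs e≈0))))
        (solve 2 (λ h w → h :+ (w :- h) :* con (+ 1) := w) refl (ev 0# h x) w)))
    ∷ rest (λ {y} y∈ → fromRoots-root xs y∈) (interpolate-correct ws distinct)
    where
    h = interpolate xs ws
    c = (w - ev 0# h x) * inv (ev 1# (fromRoots xs) x)
    value : ∀ y → ev 0# (interpolate (x ∷ xs) (w ∷ ws)) y ≈ ev 0# h y + c * ev 1# (fromRoots xs) y
    value y = trans (ev₀-+ (h ∷ʳ 0#) _ y)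
      (+-cong (ev-∷ʳ h 0# y) (trans (ev₀-* c (fromRoots xs ∷ʳ 1#) y) (*-congˡ (ev-∷ʳ (fromRoots xs) 1# y))))
    all-any : ∀ {zs} → LAll.All (x ≉_) zs → ¬ x ∈ᴸ zs
    all-any ps x∈ = LAll.All¬⇒¬Any ps x∈
    rest : ∀ {m} {ys vs : Vec Carrier m} → (∀ {y} → y ∈ᴸ toList ys → ev 1# (fromRoots xs) y ≈ 0#) →
           Pointwise (λ y v → ev 0# h y ≈ v) ys vs →
           Pointwise (λ y v → ev 0# (interpolate (x ∷ xs) (w ∷ ws)) y ≈ v) ys vs
    rest zeros []         = []
    rest zeros (eq ∷ eqs) = trans (value _) (trans (+-cong eq (trans (*-congˡ (zeros (here refl))) (zeroʳ c))) (+-identityʳ _))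
      ∷ rest (λ y∈ → zeros (there y∈)) eqs

  interpolate-unique : ∀ {n} {xs : Vec Carrier n} → AllPairs _≉_ xs → (h ws : Vec Carrier n) →
                       map (ev 0# h) xs ≋ ws → h ≋ interpolate xs ws
  interpolate-unique {xs = xs} distinct h ws values = equal h g
    (vanishing (zipWith _+_ h (map (- 1# *_) g)) distinct (vanish values (interpolate-correct ws distinct)))
    where
    g = interpolate xs ws
    vanish : ∀ {m} {xs vs : Vec Carrier m} → map (ev 0# h) xs ≋ vs → Pointwise (λ x w → ev 0# g x ≈ w) xs vs →
             All (λ x → ev 0# (zipWith _+_ h (map (- 1# *_) g)) x ≈ 0#) xs
    vanish {xs = []}     []       []       = []
    vanish {xs = x ∷ xs} (e ∷ es) (d ∷ ds) = trans (ev₀-+ h (map (- 1# *_) g) x)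
      (trans (+-cong e (trans (ev₀-* (- 1#) g x) (*-congˡ d)))
        (solve 1 (λ w → w :+ :- con (+ 1) :* w := con (+ 0)) refl _)) ∷ vanish es ds
    equal : ∀ {m} (p q : Vec Carrier m) → All (_≈ 0#) (zipWith _+_ p (map (- 1# *_) q)) → p ≋ q
    equal []      []      []       = []
    equal (c ∷ p) (d ∷ q) (z ∷ zs) = x-y≈0⇒x≈y (trans (solve 2 (λ c d → c :- d := c :+ :- con (+ 1) :* d) refl c d) z) ∷ equal p q zs

  tuples : ∀ n → List Carrier → List (Vec Carrier n)
  tuples zero    us = [] ∷ []
  tuples (suc n) us = List.cartesianProductWith _∷_ us (tuples n us)

  tuples-complete : ∀ {n us} {vs : Vec Carrier n} → All (_∈ᴸ us) vs → LAny.Any (vs ≋_) (tuples n us)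
  tuples-complete []       = here []
  tuples-complete (v∈ ∷ vs∈) = LAny.cartesianProductWith⁺ _∷_ _∷_ v∈ (tuples-complete vs∈)

  -- The monic polynomial whose roots are multiplied by `c`. With `c` a common denominator of the
  -- coefficients it exhibits a multiple of a root as integral.
  scaleRoots : ∀ {n} → Carrier → Vec Carrier n → Vec Carrier n
  scaleRoots         c []      = []
  scaleRoots {suc n} c (d ∷ p) = c ^ suc n * d ∷ scaleRoots c p

  ev-scaleRoots : ∀ {n} c t (p : Vec Carrier n) x → ev t (scaleRoots c p) (c * x) ≈ c ^ n * ev t p x
  ev-scaleRoots c t []      x = sym (*-identityˡ t)
  ev-scaleRoots c t (d ∷ p) x = trans (+-congˡ (*-congˡ (ev-scaleRoots c t p x)))
    (solve 5 (λ c d x u v → c :* u :* d :+ c :* x :* (u :* v) := c :* u :* (d :+ x :* v)) refl c d x _ _)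

  -- Together with `overflow` this splits c + T h into its low coefficients and its top one, so that
  -- the length remains that of the modulus.
  shift : ∀ {n} → Carrier → Vec Carrier n → Vec Carrier n
  shift c []      = []
  shift c (x ∷ h) = c ∷ shift x h

  overflow : ∀ {n} → Carrier → Vec Carrier n → Carrier
  overflow c []      = c
  overflow c (x ∷ h) = overflow x h

  ev-shift : ∀ {n} c (h : Vec Carrier n) y → ev (overflow c h) (shift c h) y ≈ c + y * ev 0# h y
  ev-shift c []      y = solve 2 (λ c y → c := c :+ y :* con (+ 0)) refl c y
  ev-shift c (x ∷ h) y = +-congˡ (*-congˡ (ev-shift x h y))

  -- The remainder of c + T h modulo the monic polynomial p.
  remainderStep : ∀ {n} → Vec Carrier n → Carrier → Vec Carrier n → Vec Carrier n
  remainderStep p c h = zipWith _+_ (shift c h) (map (- overflow c h *_) p)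

  ev-remainderStep : ∀ {n} (p : Vec Carrier n) c h {y} → ev 1# p y ≈ 0# →
                     ev 0# (remainderStep p c h) y ≈ c + y * ev 0# h y
  ev-remainderStep p c h {y} root = trans
    (ev-cong₁ (remainderStep p c h) (solve 1 (λ t → con (+ 0) := t :+ :- t :* con (+ 1)) refl t))
    (trans (ev-+ t (- t * 1#) (shift c h) (map (- t *_) p) y)
    (trans (+-cong (ev-shift c h y) (trans (ev-* (- t) 1# p y) (trans (*-congˡ root) (zeroʳ _)))) (+-identityʳ _)))
    where t = overflow c h

  zeros : ∀ n → All (_≈ 0#) (replicate n 0#)
  zeros zero    = []
  zeros (suc n) = refl ∷ zeros n

  remainder : ∀ {m n} → Vec Carrier n → Carrier → Vec Carrier m → Vec Carrier n
  remainder p t []      = remainderStep p t (replicate _ 0#)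
  remainder p t (c ∷ f) = remainderStep p c (remainder p t f)

  ev-remainder : ∀ {m n} (p : Vec Carrier n) t (f : Vec Carrier m) {y} → ev 1# p y ≈ 0# →
                 ev 0# (remainder p t f) y ≈ ev t f y
  ev-remainder {n = n} p t []      {y} root = trans (ev-remainderStep p t (replicate n 0#) root)
    (trans (+-congˡ (*-congˡ (ev-zero y (zeros n)))) (solve 2 (λ t y → t :+ y :* con (+ 0) := t) refl t y))
  ev-remainder p t (c ∷ f) root = trans (ev-remainderStep p c (remainder p t f) root)
    (+-congˡ (*-congˡ (ev-remainder p t f root)))

-- Decidable subfields, minimal polynomials and extension of homomorphisms.

Least : ∀ {p} → (ℕ → Set p) → Set p
Least P = ∃ λ m → P m × (∀ {i} → i < m → ¬ P i)

least : ∀ {p} {P : ℕ → Set p} → Decidable P → ∀ n → P n → Least P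
least {P = P} P? = <-rec (λ n → P n → Least P) λ n rec pn → case rec pn (ℕ.anyUpTo? P? n)
  where
  case : ∀ {n} → (∀ {m} → m < n → P m → Least P) → P n → Dec (∃ λ m → m < n × P m) → Least P
  case rec pn (yes (m , m<n , pm)) = rec m<n pm
  case rec pn (no none)            = _ , pn , λ i<n pi → none (_ , i<n , pi)

module Subfields {a ℓ} (Ω : ClosedField a ℓ) where
  open ClosedField Ω
  open Roots Ω

  -- `Mem` is a small type, realised below as `True` of a decision, so that ℚ and all iterated
  -- adjunctions share one universe level.
  record Subfield : Set (Level.suc Level.zero ⊔ a ⊔ ℓ) where
    field
      Mem  : Carrier → Set
      mem? : Decidable Mem
      resp : ∀ {x y} → x ≈ y → Mem x → Mem y
      rat∈ : ∀ q → Mem (rat q)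
      +∈   : ∀ {x y} → Mem x → Mem y → Mem (x + y)
      *∈   : ∀ {x y} → Mem x → Mem y → Mem (x * y)
      inv∈ : ∀ {x y} → Mem x → x * y ≈ 1# → Mem y

    0∈ : Mem 0#
    0∈ = resp φ.0#-homo (rat∈ 0ℚ)

    1∈ : Mem 1#
    1∈ = resp φ.1#-homo (rat∈ 1ℚ)

    -1≈ : rat (ℚ.- 1ℚ) ≈ - 1#
    -1≈ = trans (φ.-‿homo 1ℚ) (-‿cong φ.1#-homo)

    -∈ : ∀ {x} → Mem x → Mem (- x)
    -∈ {x} x∈ = resp (trans (*-congʳ -1≈) (solve 1 (λ x → :- con (+ 1) :* x := :- x) refl x)) (*∈ (rat∈ (ℚ.- 1ℚ)) x∈)

    minus∈ : ∀ {x y} → Mem x → Mem y → Mem (x - y)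
    minus∈ x∈ y∈ = +∈ x∈ (-∈ y∈)

    ^∈ : ∀ {x} n → Mem x → Mem (x ^ n)
    ^∈ zero    x∈ = 1∈
    ^∈ (suc n) x∈ = *∈ x∈ (^∈ n x∈)

    ev∈ : ∀ {n t x} {f : Vec Carrier n} → Mem t → All Mem f → Mem x → Mem (ev t f x)
    ev∈ t∈ []        x∈ = t∈
    ev∈ t∈ (c∈ ∷ f∈) x∈ = +∈ c∈ (*∈ x∈ (ev∈ t∈ f∈ x∈))

    resp-All : ∀ {n} {p q : Vec Carrier n} → p ≋ q → All Mem p → All Mem q
    resp-All []         []        = []
    resp-All (eq ∷ eqs) (m ∷ ms)  = resp eq m ∷ resp-All eqs ms

    zipWith-+∈ : ∀ {n} {p q : Vec Carrier n} → All Mem p → All Mem q → All Mem (zipWith _+_ p q)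
    zipWith-+∈ []       []       = []
    zipWith-+∈ (x ∷ xs) (y ∷ ys) = +∈ x y ∷ zipWith-+∈ xs ys

    map-*∈ : ∀ {n c} {p : Vec Carrier n} → Mem c → All Mem p → All Mem (map (c *_) p)
    map-*∈ c∈ p∈ = All.map⁺ (All.map (*∈ c∈) p∈)

    zeros∈ : ∀ n → All Mem (replicate n 0#)
    zeros∈ zero    = []
    zeros∈ (suc n) = 0∈ ∷ zeros∈ n

    shift∈ : ∀ {n c} {h : Vec Carrier n} → Mem c → All Mem h → All Mem (shift c h)
    shift∈ c∈ []        = []
    shift∈ c∈ (x∈ ∷ h∈) = c∈ ∷ shift∈ x∈ h∈

    overflow∈ : ∀ {n c} {h : Vec Carrier n} → Mem c → All Mem h → Mem (overflow c h)
    overflow∈ c∈ []        = c∈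
    overflow∈ c∈ (x∈ ∷ h∈) = overflow∈ x∈ h∈

    remainderStep∈ : ∀ {n c} {p h : Vec Carrier n} → All Mem p → Mem c → All Mem h → All Mem (remainderStep p c h)
    remainderStep∈ p∈ c∈ h∈ = zipWith-+∈ (shift∈ c∈ h∈) (map-*∈ (-∈ (overflow∈ c∈ h∈)) p∈)

    remainder∈ : ∀ {m n t} {p : Vec Carrier n} {f : Vec Carrier m} → All Mem p → Mem t → All Mem f → All Mem (remainder p t f)
    remainder∈ p∈ t∈ []        = remainderStep∈ p∈ t∈ (zeros∈ _)
    remainder∈ p∈ t∈ (c∈ ∷ f∈) = remainderStep∈ p∈ c∈ (remainder∈ p∈ t∈ f∈)

    derive∈ : ∀ {n} {p : Vec Carrier (suc n)} → All Mem p → All Mem (derive p)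
    derive∈ (c∈ ∷ [])       = []
    derive∈ (c∈ ∷ d∈ ∷ p∈)  = zipWith-+∈ (d∈ ∷ p∈) (0∈ ∷ derive∈ (d∈ ∷ p∈))

    rats∈ : ∀ {n} (p : Vec ℚ n) → All Mem (map rat p)
    rats∈ p = All.map⁺ (All.universal rat∈ p)

  -- Separate from `MinPoly` because its consequences are already applied, inside the search for a
  -- minimal polynomial, to a hypothetical competitor.
  record Minimal (k : Subfield) (y : Carrier) {n} (p : Vec Carrier n) : Set (a ⊔ ℓ) where
    open Subfield k
    field
      poly∈   : All Mem p
      isRoot  : ev 1# p y ≈ 0#
      minimal : ∀ {m} (q : Vec Carrier m) → All Mem q → m < n → ev 1# q y ≉ 0#

    lead-zero : ∀ {m t} (h : Vec Carrier m) → All Mem h → Mem t → m < n → ev t h y ≈ 0# → t ≈ 0#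
    lead-zero {t = t} h h∈ t∈ m<n eq with t ≟ 0#
    ... | yes t≈0 = t≈0
    ... | no t≉0  = ⊥-elim (minimal (map (inv t *_) h) (map-*∈ (inv∈ t∈ (inverse t t≉0)) h∈) m<n
            (trans (ev-cong₁ (map (inv t *_) h) (trans (sym (inverse t t≉0)) (*-comm t (inv t))))
              (trans (ev-* (inv t) t h y) (trans (*-congˡ eq) (zeroʳ _)))))

    all-zero : ∀ {m} (h : Vec Carrier m) → All Mem h → m ≤ n → ev 0# h y ≈ 0# → All (_≈ 0#) h
    all-zero {zero}  []  []  m≤n eq = []
    all-zero {suc m} h   h∈  m≤n eq with Vec.initLast h
    ... | g , t , ≡.refl = snoc (all-zero g g∈ (ℕ.<⇒≤ m≤n) (trans (ev-cong₁ g (sym t≈0)) eq′)) t≈0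
      where
      unsnoc : ∀ {m} (g : Vec Carrier m) → All Mem (g ∷ʳ t) → All Mem g × Mem t
      unsnoc []      (t∈ ∷ [])  = [] , t∈
      unsnoc (c ∷ g) (c∈ ∷ gs)  = let g∈ , t∈ = unsnoc g gs in c∈ ∷ g∈ , t∈
      snoc : ∀ {m} {g : Vec Carrier m} → All (_≈ 0#) g → t ≈ 0# → All (_≈ 0#) (g ∷ʳ t)
      snoc []       z = z ∷ []
      snoc (x ∷ xs) z = x ∷ snoc xs z
      g∈  = proj₁ (unsnoc g h∈)
      eq′ : ev t g y ≈ 0#
      eq′ = trans (sym (ev-∷ʳ g t y)) eq
      t≈0 = lead-zero g g∈ (proj₂ (unsnoc g h∈)) m≤n eq′

    -- The remainder of `f` modulo `p` also vanishes at `y`, so it is zero by minimality, and `p`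
    -- divides `f`.
    transfer : ∀ {m t} (f : Vec Carrier m) → All Mem f → Mem t → ev t f y ≈ 0# →
               ∀ {x} → ev 1# p x ≈ 0# → ev t f x ≈ 0#
    transfer {t = t} f f∈ t∈ eq {x} px≈0 = trans (sym (ev-remainder p t f px≈0))
      (ev-zero x (all-zero (remainder p t f) (remainder∈ poly∈ t∈ f∈) ℕ.≤-refl (trans (ev-remainder p t f isRoot) eq)))

  record MinPoly (k : Subfield) (y : Carrier) : Set (a ⊔ ℓ) where
    field
      {n}       : ℕ
      poly      : Vec Carrier (suc n)
      isMinimal : Minimal k y poly
    open Minimal isMinimal public

  module _ (k : Subfield) where
    open Subfield k

    minPoly-of : ∀ {y N} (P : Vec Carrier N) → All Mem P → ev 1# P y ≈ 0# → MinPoly k y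
    minPoly-of {y} {N} P P∈ Py≈0 = build (least candidate? N start)
      where
      us = toList (roots P)
      Good : ∀ {e} → Vec Carrier e → Set (a ⊔ ℓ)
      Good rs = All Mem (fromRoots rs) × ev 1# (fromRoots rs) y ≈ 0#
      Candidate : ℕ → Set (a ⊔ ℓ)
      Candidate e = LAny.Any Good (tuples e us)
      candidate? : Decidable Candidate
      candidate? e = LAny.any? (λ rs → All.all? mem? (fromRoots rs) ×-dec (ev 1# (fromRoots rs) y ≟ 0#)) (tuples e us)

      candidate : ∀ {e} (q : Vec Carrier e) → All Mem q → ev 1# q y ≈ 0# →
                  (∀ {x} → x ∈ᴸ toList (roots q) → x ∈ᴸ us) → Candidate e
      candidate q q∈ eq sub = LAny.map
        (λ rs≋ → let eqs = ≋-trans (proj₂ (split q)) (fromRoots-cong rs≋) in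
           resp-All eqs q∈ , trans (ev-cong refl (≋-sym eqs) refl) eq)
        (tuples-complete (All.toList⁻ (LAll.tabulateₛ setoid sub)))

      start : Candidate N
      start = candidate P P∈ Py≈0 id

      build : (∃ λ e → Candidate e × (∀ {i} → i < e → ¬ Candidate i)) → MinPoly k y
      build (e , cand , below) with LAny.satisfied cand
      ... | rs , rs∈ , eq = nonconstant e rs rs∈ eq noSmaller
        where
        noSmaller : ∀ {m} (q : Vec Carrier m) → All Mem q → m < e → ev 1# q y ≉ 0#
        -- The degree `e` is least among candidates only, that is, among products of linear factors
        -- at roots of `P`. For an arbitrary smaller `q`, the induction hypothesis says that `q` is
        -- itself minimal; hence it divides `P`, its roots are roots of `P`, and it is a candidate
        -- after all.
        noSmaller {m} = <-rec (λ m → (q : Vec Carrier m) → All Mem q → m < e → ev 1# q y ≉ 0#)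
          (λ m rec q q∈ m<e qy≈0 → below m<e (candidate q q∈ qy≈0 λ x∈ → roots-complete P
            (Minimal.transfer {k = k} (record { poly∈ = q∈ ; isRoot = qy≈0 ; minimal = λ q′ q′∈ i<m → rec i<m q′ q′∈ (ℕ.<-trans i<m m<e) })
              P P∈ 1∈ Py≈0 (roots-sound q x∈)))) m
        nonconstant : ∀ e (rs : Vec Carrier e) → All Mem (fromRoots rs) → ev 1# (fromRoots rs) y ≈ 0# →
          (∀ {m} (q : Vec Carrier m) → All Mem q → m < e → ev 1# q y ≉ 0#) → MinPoly k y
        nonconstant zero    [] _   eq _  = ⊥-elim (1≉0 eq)
        nonconstant (suc e) rs rs∈ eq ns = record { poly = fromRoots rs ; isMinimal = record { poly∈ = rs∈ ; isRoot = eq ; minimal = ns } }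

    abstract
      minPoly : ∀ y → MinPoly k y
      minPoly y with algebraic y
      ... | n , P , eq = minPoly-of (map rat P) (rats∈ P) eq

  -- A homomorphism on k; the values of ⟦_⟧ outside k are junk.
  record Hom (k : Subfield) : Set (a ⊔ ℓ) where
    open Subfield k
    field
      ⟦_⟧    : Carrier → Carrier
      cong   : ∀ {x y} → Mem x → x ≈ y → ⟦ x ⟧ ≈ ⟦ y ⟧
      homo-+ : ∀ {x y} → Mem x → Mem y → ⟦ x + y ⟧ ≈ ⟦ x ⟧ + ⟦ y ⟧
      homo-* : ∀ {x y} → Mem x → Mem y → ⟦ x * y ⟧ ≈ ⟦ x ⟧ * ⟦ y ⟧
      homo-rat : ∀ q → ⟦ rat q ⟧ ≈ rat q

    homo-0 : ⟦ 0# ⟧ ≈ 0#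
    homo-0 = trans (cong 0∈ (sym φ.0#-homo)) (trans (homo-rat 0ℚ) φ.0#-homo)

    homo-1 : ⟦ 1# ⟧ ≈ 1#
    homo-1 = trans (cong 1∈ (sym φ.1#-homo)) (trans (homo-rat 1ℚ) φ.1#-homo)

    homo-neg : ∀ {x} → Mem x → ⟦ - x ⟧ ≈ - ⟦ x ⟧
    homo-neg {x} x∈ = trans (solve 2 (λ u v → u := v :+ u :- v) refl ⟦ - x ⟧ ⟦ x ⟧)
      (trans (+-congʳ (trans (sym (homo-+ x∈ (-∈ x∈))) (trans (cong (+∈ x∈ (-∈ x∈)) (-‿inverseʳ x)) homo-0)))
        (+-identityˡ _))

    map-zipWith-+ : ∀ {n} {p q : Vec Carrier n} → All Mem p → All Mem q →
                    map ⟦_⟧ (zipWith _+_ p q) ≋ zipWith _+_ (map ⟦_⟧ p) (map ⟦_⟧ q)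
    map-zipWith-+ []       []       = []
    map-zipWith-+ (x ∷ xs) (y ∷ ys) = homo-+ x y ∷ map-zipWith-+ xs ys

    map-map-* : ∀ {n c} {p : Vec Carrier n} → Mem c → All Mem p →
                map ⟦_⟧ (map (c *_) p) ≋ map (⟦ c ⟧ *_) (map ⟦_⟧ p)
    map-map-* c∈ []       = []
    map-map-* c∈ (x ∷ xs) = homo-* c∈ x ∷ map-map-* c∈ xs

    map-remainderStep : ∀ {n c} {p h : Vec Carrier n} → All Mem p → Mem c → All Mem h →
      map ⟦_⟧ (remainderStep p c h) ≋ remainderStep (map ⟦_⟧ p) ⟦ c ⟧ (map ⟦_⟧ h)
    map-remainderStep {c = c} {p} {h} p∈ c∈ h∈ = ≋-trans
      (map-zipWith-+ (shift∈ c∈ h∈) (map-*∈ (-∈ (overflow∈ c∈ h∈)) p∈))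
      (zip (≡.subst (map ⟦_⟧ (shift c h) ≋_) (map-shift c h) ≋-refl)
        (≋-trans (map-map-* (-∈ (overflow∈ c∈ h∈)) p∈)
          (scale (trans (homo-neg (overflow∈ c∈ h∈)) (-‿cong (reflexive (map-overflow c h)))) (map ⟦_⟧ p))))
      where
      map-shift : ∀ {n} c (h : Vec Carrier n) → map ⟦_⟧ (shift c h) ≡ shift ⟦ c ⟧ (map ⟦_⟧ h)
      map-shift c []      = ≡.refl
      map-shift c (x ∷ h) = ≡.cong (⟦ c ⟧ ∷_) (map-shift x h)
      map-overflow : ∀ {n} c (h : Vec Carrier n) → ⟦ overflow c h ⟧ ≡ overflow ⟦ c ⟧ (map ⟦_⟧ h)
      map-overflow c []      = ≡.refl
      map-overflow c (x ∷ h) = map-overflow x h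
      zip : ∀ {n} {p p′ q q′ : Vec Carrier n} → p ≋ p′ → q ≋ q′ → zipWith _+_ p q ≋ zipWith _+_ p′ q′
      zip []       []       = []
      zip (x ∷ xs) (y ∷ ys) = +-cong x y ∷ zip xs ys
      scale : ∀ {n c d} → c ≈ d → (p : Vec Carrier n) → map (c *_) p ≋ map (d *_) p
      scale c≈d []      = []
      scale c≈d (x ∷ p) = *-congʳ c≈d ∷ scale c≈d p

  idHom : ∀ k → Hom k
  idHom k = record { ⟦_⟧ = id ; cong = λ _ eq → eq ; homo-+ = λ _ _ → refl ; homo-* = λ _ _ → refl ; homo-rat = λ _ → refl }

  module Extension (k : Subfield) {y : Carrier} (M : MinPoly k y)
    (σ : Hom k) (y′ : Carrier) (root′ : ev 1# (map (Hom.⟦_⟧ σ) (MinPoly.poly M)) y′ ≈ 0#) where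

    open Subfield k
    open MinPoly M
    private module σ = Hom σ
    open σ using (⟦_⟧)

    -- The extension of `σ` that sends `y` to `y′`, taken as a relation so that closure under the
    -- operations requires no choice of representatives. That it is single-valued follows from
    -- minimality, in `graph-zero`.
    Graph : Carrier → Carrier → Set (a ⊔ ℓ)
    Graph z z′ = ∃ λ (h : Vec Carrier (suc n)) → All Mem h × z ≈ ev 0# h y × z′ ≈ ev 0# (map ⟦_⟧ h) y′

    graph-cong : ∀ {z w z′ w′} → z ≈ w → z′ ≈ w′ → Graph z z′ → Graph w w′
    graph-cong eq eq′ (h , h∈ , e , e′) = h , h∈ , trans (sym eq) e , trans (sym eq′) e′

    graph-0 : Graph 0# 0#
    graph-0 = replicate _ 0# , zeros∈ _ , sym (ev-zero y (zeros (suc n))) , sym (ev-zero y′ (map-zeros (suc n)))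
      where
      map-zeros : ∀ n → All (_≈ 0#) (map ⟦_⟧ (replicate n 0#))
      map-zeros zero    = []
      map-zeros (suc n) = σ.homo-0 ∷ map-zeros n

    graph-+ : ∀ {z w z′ w′} → Graph z z′ → Graph w w′ → Graph (z + w) (z′ + w′)
    graph-+ (h , h∈ , e , e′) (g , g∈ , d , d′) = zipWith _+_ h g , zipWith-+∈ h∈ g∈ ,
      trans (+-cong e d) (sym (ev₀-+ h g y)) ,
      trans (+-cong e′ d′) (trans (sym (ev₀-+ (map ⟦_⟧ h) (map ⟦_⟧ g) y′)) (ev-cong refl (≋-sym (σ.map-zipWith-+ h∈ g∈)) refl))

    graph-scale : ∀ {c z z′} → Mem c → Graph z z′ → Graph (c * z) (⟦ c ⟧ * z′)
    graph-scale {c} c∈ (h , h∈ , e , e′) = map (c *_) h , map-*∈ c∈ h∈ ,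
      trans (*-congˡ e) (sym (ev₀-* c h y)) ,
      trans (*-congˡ e′) (trans (sym (ev₀-* ⟦ c ⟧ (map ⟦_⟧ h) y′)) (ev-cong refl (≋-sym (σ.map-map-* c∈ h∈)) refl))

    -- The degree is kept below that of `poly` by reducing modulo `poly` at `y` and modulo its image
    -- under `σ` at `y′`; this is where `root′` enters.
    graph-step : ∀ {c z z′} → Mem c → Graph z z′ → Graph (c + y * z) (⟦ c ⟧ + y′ * z′)
    graph-step {c} c∈ (h , h∈ , e , e′) = remainderStep poly c h , remainderStep∈ poly∈ c∈ h∈ ,
      trans (+-congˡ (*-congˡ e)) (sym (ev-remainderStep poly c h isRoot)) ,
      trans (+-congˡ (*-congˡ e′)) (trans (sym (ev-remainderStep (map ⟦_⟧ poly) ⟦ c ⟧ (map ⟦_⟧ h) root′))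
        (ev-cong refl (≋-sym (σ.map-remainderStep poly∈ c∈ h∈)) refl))

    graph-base : ∀ {c} → Mem c → Graph c ⟦ c ⟧
    graph-base {c} c∈ = graph-cong (lem c y) (lem ⟦ c ⟧ y′) (graph-step c∈ graph-0)
      where
      lem : ∀ c y → c + y * 0# ≈ c
      lem = solve 2 (λ c y → c :+ y :* con (+ 0) := c) refl

    graph-gen : Graph y y′
    graph-gen = graph-cong (lem y) (trans (+-cong σ.homo-0 (*-congˡ σ.homo-1)) (lem y′)) (graph-step 0∈ (graph-base 1∈))
      where
      lem : ∀ y → 0# + y * 1# ≈ y
      lem = solve 1 (λ y → con (+ 0) :+ y :* con (+ 1) := y) refl

    graph-* : ∀ {z w z′ w′} → Graph z z′ → Graph w w′ → Graph (z * w) (z′ * w′)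
    graph-* {w = w} {w′ = w′} (h , h∈ , e , e′) G = graph-cong (*-congʳ (sym e)) (*-congʳ (sym e′)) (go h h∈)
      where
      go : ∀ {m} (h : Vec Carrier m) → All Mem h → Graph (ev 0# h y * w) (ev 0# (map ⟦_⟧ h) y′ * w′)
      go []      []        = graph-cong (sym (zeroˡ w)) (sym (zeroˡ w′)) graph-0
      go (c ∷ h) (c∈ ∷ h∈) = graph-cong
        (solve 4 (λ c w y u → c :* w :+ (con (+ 0) :+ y :* (u :* w)) := (c :+ y :* u) :* w) refl c w y _)
        (trans (+-congˡ (+-congʳ σ.homo-0)) (solve 4 (λ c w y u → c :* w :+ (con (+ 0) :+ y :* (u :* w)) := (c :+ y :* u) :* w) refl _ w′ y′ _))
        (graph-+ (graph-scale c∈ G) (graph-step 0∈ (go h h∈)))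

    graph-ev : ∀ {m t z z′} {f : Vec Carrier m} → Mem t → All Mem f → Graph z z′ → Graph (ev t f z) (ev ⟦ t ⟧ (map ⟦_⟧ f) z′)
    graph-ev t∈ []        G = graph-base t∈
    graph-ev t∈ (c∈ ∷ f∈) G = graph-+ (graph-base c∈) (graph-* G (graph-ev t∈ f∈ G))

    graph-zero : ∀ {z z′} → Graph z z′ → z ≈ 0# → z′ ≈ 0#
    graph-zero (h , h∈ , e , e′) z≈0 = trans e′ (ev-zero y′ (map-zero h∈ (all-zero h h∈ ℕ.≤-refl (trans (sym e) z≈0))))
      where
      map-zero : ∀ {m} {h : Vec Carrier m} → All Mem h → All (_≈ 0#) h → All (_≈ 0#) (map ⟦_⟧ h)
      map-zero []       []       = []
      map-zero (x ∷ xs) (z ∷ zs) = trans (σ.cong x z) σ.homo-0 ∷ map-zero xs zs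

    graph-unique : ∀ {z w z′ w′} → Graph z z′ → Graph w w′ → z ≈ w → z′ ≈ w′
    graph-unique G H z≈w = x-y≈0⇒x≈y (graph-zero
      (graph-cong (+-congˡ (minus _ (-1≈))) (+-congˡ (minus _ (trans (σ.homo-rat _) -1≈)))
        (graph-+ G (graph-scale (rat∈ (ℚ.- 1ℚ)) H))) (x≈y⇒x-y≈0 z≈w))
      where
      minus : ∀ {c} x → c ≈ - 1# → c * x ≈ - x
      minus x c≈ = trans (*-congʳ c≈) (solve 1 (λ x → :- con (+ 1) :* x := :- x) refl x)

-- Adjunction of an element, enumeration of the field, and extension to the whole field.

ints : ℕ → List ℤ
ints H = List.map (λ n → + n) (List.upTo (suc H)) ++ List.map -[1+_] (List.upTo H)

∈-ints : ∀ {H} i → ∣ i ∣ ≤ H → i Membership.∈ ints H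
∈-ints (+ n)    le = Membership.∈-++⁺ˡ (Membership.∈-map⁺ (λ n → + n) (Membership.∈-upTo⁺ (s≤s le)))
∈-ints -[1+ n ] le = Membership.∈-++⁺ʳ _ (Membership.∈-map⁺ -[1+_] (Membership.∈-upTo⁺ le))

module Embeddings {a ℓ} (Ω : ClosedField a ℓ) where
  open ClosedField Ω
  open Roots Ω
  open Subfields Ω

  toList-distinct : ∀ {n} {xs : Vec Carrier n} → AllPairs _≉_ xs → LAllPairs.AllPairs _≉_ (toList xs)
  toList-distinct []       = []
  toList-distinct (p ∷ ps) = All.toList⁺ p ∷ toList-distinct ps

  module Adjoin (k : Subfield) {y : Carrier} (M : MinPoly k y) where
    open Subfield k
    open MinPoly M

    In : Carrier → Set (a ⊔ ℓ)
    In z = ∃ λ (h : Vec Carrier (suc n)) → All Mem h × z ≈ ev 0# h y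

    private
      map-id-root : ∀ {x} → ev 1# poly x ≈ 0# → ev 1# (map id poly) x ≈ 0#
      map-id-root {x} = ≡.subst (λ p → ev 1# p x ≈ 0#) (≡.sym (Vec.map-id poly))

      -- The identity of k, extended by sending `y` to a conjugate `x`. With `x` equal to `y`
      -- itself, the closure of `In` under the operations is a by-product of the closure of the
      -- graph.
      module At {x} (r : ev 1# poly x ≈ 0#) = Extension k M (idHom k) x (map-id-root r)
      module Self = At isRoot

      toGraph : ∀ {z x} (r : ev 1# poly x ≈ 0#) → ((h , _) : In z) → At.Graph r z (ev 0# h x)
      toGraph {x = x} r (h , h∈ , eq) = h , h∈ , eq , reflexive (≡.cong (λ p → ev 0# p x) (≡.sym (Vec.map-id h)))

      self : ∀ {z} → In z → Self.Graph z z
      self i@(h , h∈ , eq) = Self.graph-cong refl (sym eq) (toGraph isRoot i)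

      fromGraph : ∀ {z z′} → Self.Graph z z′ → In z
      fromGraph (h , h∈ , eq , _) = h , h∈ , eq

    in-cong : ∀ {z w} → z ≈ w → In z → In w
    in-cong z≈w (h , h∈ , eq) = h , h∈ , trans (sym z≈w) eq

    in-base : ∀ {x} → Mem x → In x
    in-base x∈ = fromGraph (Self.graph-base x∈)

    in-gen : In y
    in-gen = fromGraph Self.graph-gen

    in-+ : ∀ {z w} → In z → In w → In (z + w)
    in-+ i j = fromGraph (Self.graph-+ (self i) (self j))

    in-* : ∀ {z w} → In z → In w → In (z * w)
    in-* i j = fromGraph (Self.graph-* (self i) (self j))

    -- If c + T m is the minimal polynomial of `z`, then the inverse of `z` is - m(z) / c. Were `c`
    -- zero, `m` would be a smaller polynomial vanishing at `z`.
    in-inv : ∀ {z w} → In z → z * w ≈ 1# → In w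
    in-inv {z} {w} i zw≈1 with minPoly k z
    ... | record { poly = c ∷ m ; isMinimal = record { poly∈ = c∈ ∷ m∈ ; isRoot = eq ; minimal = minimal } } =
      in-cong (*-cancelˡ z≉0 (trans
          (solve 3 (λ z i e → z :* (:- i :* e) := :- i :* (z :* e)) refl z (inv c) _)
          (trans (*-congˡ (x-y≈0⇒x≈y (trans (solve 2 (λ c u → u :- :- c := c :+ u) refl c _) eq)))
          (trans (solve 2 (λ i c → :- i :* :- c := c :* i) refl (inv c) c) (trans (inverse c c≉0) (sym zw≈1))))))
        (fromGraph (Self.graph-scale (-∈ (inv∈ c∈ (inverse c c≉0))) (Self.graph-ev 1∈ m∈ (self i))))
      where
      z≉0 : z ≉ 0#
      z≉0 z≈0 = 1≉0 (trans (sym zw≈1) (trans (*-congʳ z≈0) (zeroˡ w)))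
      c≉0 : c ≉ 0#
      c≉0 c≈0 with *-zero z _ (trans (sym (+-identityˡ _)) (trans (+-congʳ (sym c≈0)) eq))
      ... | inj₁ z≈0 = z≉0 z≈0
      ... | inj₂ e   = minimal m m∈ ℕ.≤-refl e

    -- A unit stays a unit under conjugation, so the derivative, nonzero at y
    -- by minimality, is nonzero at every conjugate.
    separable : ∀ {x} → ev 1# poly x ≈ 0# → derivative poly x ≉ 0#
    separable {x} r d′≈0 = 1≉0 (trans (sym (At.graph-unique r
        (At.graph-* r (At.graph-ev r (rat∈ _) (derive∈ poly∈) (At.graph-gen r)) (toGraph r w∈)) (At.graph-base r 1∈)
        (trans (*-congʳ (ev-derive poly y)) (inverse d d≉0))))
      (trans (*-congʳ (trans (reflexive (≡.cong (λ p → ev (nat (suc n)) p x) (Vec.map-id (derive poly)))) (trans (ev-derive poly x) d′≈0)))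
        (zeroˡ _)))
      where
      d = derivative poly y
      d≉0 : d ≉ 0#
      d≉0 d≈0 = nat-≉0 (suc n) (lead-zero (derive poly) (derive∈ poly∈) (rat∈ _) ℕ.≤-refl (trans (ev-derive poly y) d≈0))
      w∈ : In (inv d)
      w∈ = in-inv (in-cong (ev-derive poly y) (fromGraph (Self.graph-ev (rat∈ _) (derive∈ poly∈) Self.graph-gen))) (inverse d d≉0)

    roots-distinct : AllPairs _≉_ (roots poly)
    roots-distinct = simple⇒distinct (roots poly) λ x∈ eq → separable (roots-sound poly x∈)
      (trans (derivative-cong (proj₂ (split poly)) refl) eq)

    -- An element u = h(y) takes conjugate values h(yᵢ) at the conjugates of y,
    -- so h is one of finitely many interpolation polynomials.
    abstract
      in? : Decidable In
      in? u = map′ sound complete (LAny.any? good? (tuples (suc n) us))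
        where
        N : MinPoly k u
        N = minPoly k u
        us : List Carrier
        us = toList (roots (MinPoly.poly N))
        Good : Vec Carrier (suc n) → Set (a ⊔ ℓ)
        Good ws = All Mem (interpolate (roots poly) ws) × u ≈ ev 0# (interpolate (roots poly) ws) y
        good? : ∀ ws → Dec (Good ws)
        good? ws = All.all? mem? (interpolate (roots poly) ws) ×-dec (u ≟ ev 0# (interpolate (roots poly) ws) y)
        sound : LAny.Any Good (tuples (suc n) us) → In u
        sound any = let ws , h∈ , eq = LAny.satisfied any in interpolate (roots poly) ws , h∈ , eq
        complete : In u → LAny.Any Good (tuples (suc n) us)
        complete i@(h , h∈ , eq) = LAny.map good (tuples-complete (All.toList⁻ (all-values (toList (roots poly)) id)))
          where
          value∈ : ∀ {x} → ev 1# poly x ≈ 0# → ev 0# h x ∈ᴸ us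
          value∈ {x} r = roots-complete (MinPoly.poly N)
            (trans (reflexive (≡.cong (λ p → ev 1# p (ev 0# h x)) (≡.sym (Vec.map-id (MinPoly.poly N)))))
              (At.graph-zero r (At.graph-ev r 1∈ (MinPoly.poly∈ N) (toGraph r i)) (MinPoly.isRoot N)))
          all-values : ∀ xs → (∀ {x} → x ∈ᴸ xs → x ∈ᴸ toList (roots poly)) → LAll.All (_∈ᴸ us) (toList (map (ev 0# h) (roots poly)))
          all-values _ _ = All.toList⁺ (All.map⁺ (All.toList⁻ (LAll.tabulateₛ setoid λ x∈ → value∈ (roots-sound poly x∈))))
          good : ∀ {ws} → map (ev 0# h) (roots poly) ≋ ws → Good ws
          good {ws} vs≋ws = resp-All same h∈ , trans eq (ev-cong refl same refl)
            where
            same : h ≋ interpolate (roots poly) ws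
            same = interpolate-unique roots-distinct h ws vs≋ws

    Member : Carrier → Set
    Member z = True (in? z)

    member⁺ : ∀ {z} → In z → Member z
    member⁺ {z} = fromWitness {a? = in? z}

    member⁻ : ∀ {z} → Member z → In z
    member⁻ {z} = toWitness {a? = in? z}

    adjoin : Subfield
    adjoin = record
      { Mem  = Member
      ; mem? = λ z → map′ member⁺ member⁻ (in? z)
      ; resp = λ eq z∈ → member⁺ (in-cong eq (member⁻ z∈))
      ; rat∈ = λ q → member⁺ (in-base (rat∈ q))
      ; +∈   = λ z∈ w∈ → member⁺ (in-+ (member⁻ z∈) (member⁻ w∈))
      ; *∈   = λ z∈ w∈ → member⁺ (in-* (member⁻ z∈) (member⁻ w∈))
      ; inv∈ = λ z∈ eq → member⁺ (in-inv (member⁻ z∈) eq)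
      }

    base⊆adjoin : ∀ {x} → Mem x → Subfield.Mem adjoin x
    base⊆adjoin x∈ = member⁺ (in-base x∈)

    gen∈adjoin : Subfield.Mem adjoin y
    gen∈adjoin = member⁺ in-gen

    module Extend (σ : Hom k) (y′ : Carrier) (root′ : ev 1# (map (Hom.⟦_⟧ σ) poly) y′ ≈ 0#) where
      open Hom σ using (⟦_⟧; homo-rat)
      open Extension k M σ y′ root′

      private
        coefficients : ∀ {z} → Dec (In z) → Vec Carrier (suc n)
        coefficients (yes (h , _)) = h
        -- A default outside k(y), where `Hom` imposes no condition.
        coefficients (no _)        = replicate _ 0#

        image : ∀ {z} → Dec (In z) → Carrier
        image d = ev 0# (map ⟦_⟧ (coefficients d)) y′

        graph : ∀ {z} (d : Dec (In z)) → True d → Graph z (image d)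
        graph (yes (h , h∈ , eq)) _ = h , h∈ , eq , refl

        graph∈ : ∀ {z} → Subfield.Mem adjoin z → Graph z (image (in? z))
        graph∈ z∈ = graph (in? _) z∈

      extension : Hom adjoin
      extension = record
        { ⟦_⟧      = λ z → image (in? z)
        ; cong     = λ z∈ eq → graph-unique (graph∈ z∈) (graph∈ (Subfield.resp adjoin eq z∈)) eq
        ; homo-+   = λ z∈ w∈ → graph-unique (graph∈ (Subfield.+∈ adjoin z∈ w∈)) (graph-+ (graph∈ z∈) (graph∈ w∈)) refl
        ; homo-*   = λ z∈ w∈ → graph-unique (graph∈ (Subfield.*∈ adjoin z∈ w∈)) (graph-* (graph∈ z∈) (graph∈ w∈)) refl
        ; homo-rat = λ q → trans (graph-unique (graph∈ (Subfield.rat∈ adjoin q)) (graph-base (rat∈ q)) refl) (homo-rat q)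
        }

      extension-base : ∀ {x} → Mem x → Hom.⟦_⟧ extension x ≈ ⟦ x ⟧
      extension-base x∈ = graph-unique (graph∈ (base⊆adjoin x∈)) (graph-base x∈) refl

      extension-gen : Hom.⟦_⟧ extension y ≈ y′
      extension-gen = graph-unique (graph∈ gen∈adjoin) graph-gen refl

  rats : ℕ → List Carrier
  rats s = List.cartesianProductWith (λ i d → rat (i ℚ./ suc d)) (ints s) (List.upTo s)

  rank : ℚ → ℕ
  rank q = ∣ ↥ q ∣ ℕ.+ ℚ.denominatorℕ q

  ∈-rats : ∀ {s} q → rank q ≤ s → rat q ∈ᴸ rats s
  ∈-rats q@(ℚ.mkℚ n d _) le = LAny.cartesianProductWith⁺ (λ i d → rat (i ℚ./ suc d)) (λ where ≡.refl ≡.refl → rat-cong (≡.sym (ℚ.↥p/↧p≡p q)))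
    (∈-ints n (ℕ.≤-trans (ℕ.m≤m+n _ _) le)) (Membership.∈-upTo⁺ (ℕ.≤-trans (ℕ.m≤n+m _ ∣ n ∣) le))

  rootsUpTo : ℕ → List Carrier → List Carrier
  rootsUpTo N cs = List.concatMap (λ n → List.concatMap (λ p → toList (roots p)) (tuples n cs)) (List.upTo N)

  ∈-rootsUpTo : ∀ {N n cs y} (p : Vec Carrier n) → n < N → All (_∈ᴸ cs) p → ev 1# p y ≈ 0# → y ∈ᴸ rootsUpTo N cs
  ∈-rootsUpTo {N} {n} {cs} p n<N p∈ eq =
    LAny.concatMap⁺ (λ n → List.concatMap (λ p → toList (roots p)) (tuples n cs)) (lose (Membership.∈-upTo⁺ n<N)
      (LAny.concatMap⁺ (λ p → toList (roots p)) (LAny.map (λ {q} p≋q → roots-complete q (trans (ev-cong refl (≋-sym p≋q) refl) eq))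
        (tuples-complete p∈))))

  -- One parameter bounds the degree and the ranks of the coefficients alike, so every stage is
  -- finite; it suffices that each element occurs at some stage.
  enumeration : ℕ → List Carrier
  enumeration s = rootsUpTo s (rats s)

  abstract
    enumerated : ∀ y → ∃ λ s → y ∈ᴸ enumeration s
    enumerated y with algebraic y
    ... | n , p , eq = suc (n ℕ.+ total p) ,
        ∈-rootsUpTo (map rat p) (s≤s (ℕ.m≤m+n n _)) (coefficients p (ℕ.m≤n⇒m≤1+n (ℕ.m≤n+m _ n))) eq
      where
      total : ∀ {n} → Vec ℚ n → ℕ
      total p = Vec.sum (map rank p)
      coefficients : ∀ {n s} (p : Vec ℚ n) → total p ≤ s → All (_∈ᴸ rats s) (map rat p)
      coefficients []      le = []
      coefficients (q ∷ p) le = ∈-rats q (ℕ.≤-trans (ℕ.m≤m+n _ _) le) ∷ coefficients p (ℕ.≤-trans (ℕ.m≤n+m _ (rank q)) le)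

  record Embedding (k : Subfield) : Set (a ⊔ ℓ) where
    field
      τ      : Carrier → Carrier
      cong   : ∀ {x y} → x ≈ y → τ x ≈ τ y
      homo-+ : ∀ x y → τ (x + y) ≈ τ x + τ y
      homo-* : ∀ x y → τ (x * y) ≈ τ x * τ y
      fixes  : ∀ {x} → Subfield.Mem k x → τ x ≈ x

    open Subfield k

    homo-neg : ∀ x → τ (- x) ≈ - τ x
    homo-neg x = trans (cong (solve 1 (λ x → :- x := :- con (+ 1) :* x) refl x))
      (trans (homo-* (- 1#) x) (trans (*-congʳ (fixes (-∈ 1∈))) (solve 1 (λ x → :- con (+ 1) :* x := :- x) refl (τ x))))

    homo-^ : ∀ x n → τ (x ^ n) ≈ τ x ^ n
    homo-^ x zero    = fixes 1∈
    homo-^ x (suc n) = trans (homo-* x (x ^ n)) (*-congˡ (homo-^ x n))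

    homo-ev : ∀ {n t} (p : Vec Carrier n) x → Mem t → All Mem p → τ (ev t p x) ≈ ev t p (τ x)
    homo-ev []      x t∈ []        = fixes t∈
    homo-ev (c ∷ p) x t∈ (c∈ ∷ p∈) = trans (homo-+ c _) (+-cong (fixes c∈) (trans (homo-* x _) (*-congˡ (homo-ev p x t∈ p∈))))

    preserves-roots : ∀ {n x} (p : Vec Carrier n) → All Mem p → ev 1# p x ≈ 0# → ev 1# p (τ x) ≈ 0#
    preserves-roots {x = x} p p∈ eq = trans (sym (homo-ev p x 1∈ p∈)) (trans (cong eq) (fixes 0∈))

    injective : ∀ {x y} → τ x ≈ τ y → x ≈ y
    injective {x} {y} eq with (x - y) ≟ 0#
    ... | yes x-y≈0 = x-y≈0⇒x≈y x-y≈0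
    ... | no x-y≉0  = ⊥-elim (1≉0 (trans (sym (trans (cong (inverse (x - y) x-y≉0)) (fixes 1∈)))
            (trans (homo-* (x - y) _) (trans (*-congʳ (trans (homo-+ x (- y)) (trans (+-cong eq (homo-neg y)) (-‿inverseʳ _)))) (zeroˡ _)))))

    -- An injection of the finite set of conjugates of y into itself.
    surjective : ∀ y → ∃ λ x → τ x ≈ y
    surjective y with LAny.any? (y ≟_) (List.map τ ys)
      where ys = toList (roots (MinPoly.poly (minPoly k y)))
    ... | yes y∈ = let x , y≈ = LAny.satisfied (LAny.map⁻ y∈) in x , sym y≈
    ... | no y∉  = ⊥-elim (ℕ.<-irrefl (List.length-map τ ys)
            (pigeonhole {y ∷ List.map τ ys} {ys}
              (LAll.¬Any⇒All¬ _ y∉ ∷ LAllPairs.map⁺ (LAllPairs.map (λ x≉z eq → x≉z (injective eq)) (toList-distinct (Adjoin.roots-distinct k M))))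
              (roots-complete poly isRoot ∷ LAll.map⁺ (LAll.tabulateₛ setoid λ x∈ → roots-complete poly (preserves-roots poly poly∈ (roots-sound poly x∈))))))
      where
      M = minPoly k y
      open MinPoly M
      ys = toList (roots poly)

  private
    record Partial : Set (Level.suc Level.zero ⊔ a ⊔ ℓ) where
      constructor _,_
      field
        field′ : Subfield
        hom    : Hom field′
      open Subfield field′ public using (Mem)
      open Subfield field′ using (mem?)
      open Hom hom public using (⟦_⟧)
    open Partial

    infix 4 _⊑_
    _⊑_ : Partial → Partial → Set (a ⊔ ℓ)
    P ⊑ Q = ∀ {x} → Mem P x → Mem Q x × ⟦ Q ⟧ x ≈ ⟦ P ⟧ x

    ⊑-refl : ∀ {P} → P ⊑ P
    ⊑-refl x∈ = x∈ , refl

    ⊑-trans : ∀ {P Q R} → P ⊑ Q → Q ⊑ R → P ⊑ R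
    ⊑-trans P⊑Q Q⊑R x∈ = let x∈Q , eq = P⊑Q x∈ ; x∈R , eq′ = Q⊑R x∈Q in x∈R , trans eq′ eq

    extend : ∀ P y → ∃ λ Q → P ⊑ Q × Mem Q y
    extend (k , σ) y = (adjoin , extension) , (λ x∈ → base⊆adjoin x∈ , extension-base x∈) , gen∈adjoin
      where
      M = minPoly k y
      -- Any root of the image of the minimal polynomial under `σ` is a legitimate value at `y`.
      conjugate = root (map (Hom.⟦_⟧ σ) (MinPoly.poly M))
      open Adjoin k M
      open Extend σ (proj₁ conjugate) (proj₂ conjugate)

    extends : ∀ P ys → ∃ λ Q → P ⊑ Q × LAll.All (Mem Q) ys
    extends P []       = P , ⊑-refl {P} , []
    extends P (y ∷ ys) = let Q , P⊑Q , y∈ = extend P y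
                             R , Q⊑R , ys∈ = extends Q ys
                         in R , ⊑-trans {P} {Q} {R} P⊑Q Q⊑R , proj₁ (Q⊑R y∈) ∷ ys∈

    module Chain (P : Partial) where
      chain : ℕ → Partial
      chain zero    = P
      chain (suc s) = proj₁ (extends (chain s) (enumeration s))

      chain-mono : ∀ {s t} → s ℕ.≤′ t → chain s ⊑ chain t
      chain-mono {s} ℕ.≤′-refl = ⊑-refl {chain s}
      chain-mono {s} (ℕ.≤′-step {t} le) = ⊑-trans {chain s} {chain t} {chain (suc t)} (chain-mono le)
        (proj₁ (proj₂ (extends (chain t) (enumeration t))))

      stage : Carrier → ℕ
      stage y = suc (proj₁ (enumerated y))

      stage∈ : ∀ y → Mem (chain (stage y)) y
      stage∈ y = let s , y∈ = enumerated y in LAll.lookupₛ setoid (Subfield.resp (field′ (chain (suc s))))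
        (proj₂ (proj₂ (extends (chain s) (enumeration s)))) y∈

      limit : Carrier → Carrier
      limit y = ⟦ chain (stage y) ⟧ y

      -- The limit is read off at a stage of its own for each element; by this agreement every law
      -- can be checked at a common stage.
      limit-at : ∀ {t y} → Mem (chain t) y → limit y ≈ ⟦ chain t ⟧ y
      limit-at {t} {y} y∈ with ℕ.≤-total (stage y) t
      ... | inj₁ le = sym (proj₂ (chain-mono {stage y} {t} (ℕ.≤⇒≤′ le) {y} (stage∈ y)))
      ... | inj₂ ge = proj₂ (chain-mono {t} {stage y} (ℕ.≤⇒≤′ ge) {y} y∈)

      common : ∀ x y → ∃ λ t → Mem (chain t) x × Mem (chain t) y
      common x y = stage x ℕ.⊔ stage y ,
        proj₁ (chain-mono {stage x} {stage x ℕ.⊔ stage y} (ℕ.≤⇒≤′ (ℕ.m≤m⊔n (stage x) (stage y))) {x} (stage∈ x)) ,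
        proj₁ (chain-mono {stage y} {stage x ℕ.⊔ stage y} (ℕ.≤⇒≤′ (ℕ.m≤n⊔m (stage x) (stage y))) {y} (stage∈ y))

      embedding : ∀ {k} → (∀ {x} → Subfield.Mem k x → Mem P x × ⟦ P ⟧ x ≈ x) → Embedding k
      embedding fixed = record
        { τ      = limit
        ; cong   = λ {x} {y} eq → let t , x∈ , y∈ = common x y in
            trans (limit-at {t} x∈) (trans (Hom.cong (hom (chain t)) x∈ eq) (sym (limit-at {t} y∈)))
        ; homo-+ = λ x y → let t , x∈ , y∈ = common x y in
            trans (limit-at {t} (Subfield.+∈ (field′ (chain t)) x∈ y∈)) (trans (Hom.homo-+ (hom (chain t)) x∈ y∈)
              (sym (+-cong (limit-at {t} x∈) (limit-at {t} y∈))))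
        ; homo-* = λ x y → let t , x∈ , y∈ = common x y in
            trans (limit-at {t} (Subfield.*∈ (field′ (chain t)) x∈ y∈)) (trans (Hom.homo-* (hom (chain t)) x∈ y∈)
              (sym (*-cong (limit-at {t} x∈) (limit-at {t} y∈))))
        ; fixes  = λ x∈ → let x∈P , eq = fixed x∈ in trans (limit-at {0} x∈P) eq
        }

  -- The chain starts from k(y), with the identity of k extended by `y` to `y′`, so that the fixed
  -- field and the image of `y` are settled at stage 0.
  conjugation : ∀ k {y} (M : MinPoly k y) {y′} → ev 1# (MinPoly.poly M) y′ ≈ 0# →
                ∃ λ (σ : Embedding k) → Embedding.τ σ y ≈ y′
  conjugation k {y} M {y′} eq = embedding (λ x∈ → base⊆adjoin x∈ , extension-base x∈) ,
    trans (limit-at {0} gen∈adjoin) extension-gen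
    where
    open Adjoin k M
    open Extend (idHom k) y′ (≡.subst (λ p → ev 1# p y′ ≈ 0#) (≡.sym (Vec.map-id (MinPoly.poly M))) eq)
    open Chain (adjoin , extension)

-- Divisibility and growth of powers of natural numbers.

coprime-^ : ∀ {a t} k → Coprime t a → Coprime (t ℕ.^ k) a
coprime-^ zero    c (d∣1 , _)       = ∣1⇒≡1 d∣1
coprime-^ (suc k) c (d∣tᵏ⁺¹ , d∣a) = coprime-^ k c
  (Coprimality.coprime-divisor (λ (e∣d , e∣t) → c (e∣t , ∣-trans e∣d d∣a)) d∣tᵏ⁺¹ , d∣a)

coprime-power-divisor : ∀ {x a A} k → Coprime x a → x ∣ A ℕ.* a ℕ.^ k → x ∣ A
coprime-power-divisor {x} {a} {A} zero    c d = ≡.subst (x ∣_) (ℕ.*-identityʳ A) d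
coprime-power-divisor {x} {a} {A} (suc k) c d = coprime-power-divisor k c
  (Coprimality.coprime-divisor c (≡.subst (x ∣_) (lem A a (a ℕ.^ k)) d))
  where
  lem : ∀ A a b → A ℕ.* (a ℕ.* b) ≡ a ℕ.* (A ℕ.* b)
  lem = solve-∀

n<m^n : ∀ {m} n → 2 ≤ m → n < m ℕ.^ n
n<m^n         zero    2≤m = s≤s z≤n
n<m^n {m} (suc n) 2≤m = ℕ.≤-trans (s≤s (n<m^n n 2≤m)) (ℕ.≤-trans (ℕ.+-monoˡ-≤ (m ℕ.^ n) (ℕ.≤-trans (s≤s z≤n) (n<m^n n 2≤m)))
  (ℕ.≤-trans (ℕ.≤-reflexive (≡.cong (m ℕ.^ n ℕ.+_) (≡.sym (ℕ.+-identityʳ _)))) (ℕ.*-monoˡ-≤ (m ℕ.^ n) 2≤m)))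

-- Since `t` is prime to `a`, every power of `t` divides `A` itself. For t > 1 this fails at
-- exponent `A`, as A < t ^ A.
bounded-denominator⇒1 : ∀ {a t A} → Coprime a t → 1 ≤ t → 1 ≤ A → (∀ k → t ℕ.^ k ∣ A ℕ.* a ℕ.^ k) → t ≡ 1
bounded-denominator⇒1 {a} {t} {A} c 1≤t 1≤A div with ℕ.m≤n⇒m<n∨m≡n 1≤t
... | inj₂ 1≡t = ≡.sym 1≡t
... | inj₁ 1<t = ⊥-elim (ℕ.<⇒≱ (n<m^n A 1<t)
        (∣⇒≤ {{ℕ.>-nonZero 1≤A}} (coprime-power-divisor A (coprime-^ A (Coprimality.sym c)) (div A))))

private
  -- Bernoulli's inequality (1 + 1/R) ^ k ≥ 1 + k/R with denominators cleared.
  bernoulli : ∀ R k → R ℕ.^ k ℕ.* (R ℕ.+ k) ≤ R ℕ.* suc R ℕ.^ k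
  bernoulli R zero    = ℕ.≤-reflexive (lem R)
    where
    lem : ∀ R → 1 ℕ.* (R ℕ.+ 0) ≡ R ℕ.* 1
    lem = solve-∀
  bernoulli R (suc k) = begin
    R ℕ.* P ℕ.* (R ℕ.+ suc k)              ≤⟨ ℕ.m≤m+n _ (k ℕ.* P) ⟩
    R ℕ.* P ℕ.* (R ℕ.+ suc k) ℕ.+ k ℕ.* P  ≡⟨ lem R P k ⟩
    suc R ℕ.* (P ℕ.* (R ℕ.+ k))            ≤⟨ ℕ.*-monoʳ-≤ (suc R) (bernoulli R k) ⟩
    suc R ℕ.* (R ℕ.* suc R ℕ.^ k)          ≡⟨ lem′ R (suc R ℕ.^ k) ⟩
    R ℕ.* (suc R ℕ.* suc R ℕ.^ k)          ∎
    where
    open ℕ.≤-Reasoning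
    P = R ℕ.^ k
    lem : ∀ R P k → R ℕ.* P ℕ.* (R ℕ.+ (1 ℕ.+ k)) ℕ.+ k ℕ.* P ≡ (1 ℕ.+ R) ℕ.* (P ℕ.* (R ℕ.+ k))
    lem = solve-∀
    lem′ : ∀ R Q → (1 ℕ.+ R) ℕ.* (R ℕ.* Q) ≡ R ℕ.* ((1 ℕ.+ R) ℕ.* Q)
    lem′ = solve-∀

exponential-growth : ∀ {a A C R} → 1 ≤ A → 1 ≤ R → (∀ k → A ℕ.* a ℕ.^ k ≤ C ℕ.* R ℕ.^ k) → a ≤ R
exponential-growth {a} {A} {C} {R} 1≤A 1≤R bound with a ℕ.≤? R
... | yes a≤R = a≤R
... | no a≰R  = ⊥-elim (ℕ.<⇒≱ too-big (ℕ.*-cancelˡ-≤ (R ℕ.^ k) {{ℕ.m^n≢0 R k {{ℕ.>-nonZero 1≤R}}}} (begin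
    R ℕ.^ k ℕ.* (R ℕ.+ k)         ≤⟨ bernoulli R k ⟩
    R ℕ.* suc R ℕ.^ k             ≤⟨ ℕ.*-monoʳ-≤ R (ℕ.^-monoˡ-≤ k (ℕ.≰⇒> a≰R)) ⟩
    R ℕ.* a ℕ.^ k                 ≡⟨ ≡.cong (R ℕ.*_) (≡.sym (ℕ.*-identityˡ _)) ⟩
    R ℕ.* (1 ℕ.* a ℕ.^ k)         ≤⟨ ℕ.*-monoʳ-≤ R (ℕ.*-monoˡ-≤ (a ℕ.^ k) 1≤A) ⟩
    R ℕ.* (A ℕ.* a ℕ.^ k)         ≤⟨ ℕ.*-monoʳ-≤ R (bound k) ⟩
    R ℕ.* (C ℕ.* R ℕ.^ k)         ≡⟨ lem R C (R ℕ.^ k) ⟩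
    R ℕ.^ k ℕ.* (R ℕ.* C)         ∎)))
  where
  open ℕ.≤-Reasoning
  -- If a ≥ R + 1, the chain above gives R + k ≤ R C, which this exponent contradicts because R ≥ 1.
  k = R ℕ.* C
  too-big : R ℕ.* C < R ℕ.+ k
  too-big = ℕ.+-monoˡ-≤ k 1≤R
  lem : ∀ R C P → R ℕ.* (C ℕ.* P) ≡ P ℕ.* (R ℕ.* C)
  lem = solve-∀

↧*p≡↥ : ∀ p → fromℤ (↧ p) ℚ.* p ≡ fromℤ (↥ p)
↧*p≡↥ p@(ℚ.mkℚ n d _) = ℚ.toℚᵘ-injective (ℚᵘ.≃-trans (ℚ.toℚᵘ-homo-* (fromℤ (↧ p)) p)
  (ℚᵘ.*≡* (≡.trans (ℤ.*-identityʳ _) (≡.trans (ℤ.*-comm (↧ p) n) (≡.cong (n ℤ.*_) (≡.cong +_ (≡.sym (ℕ.+-identityʳ _))))))))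

-- Bounded coordinates and amplification.

module Bounded {a ℓ} (Ω : ClosedField a ℓ) where
  open ClosedField Ω
  open Roots Ω
  open Subfields Ω
  open Embeddings Ω

  IsRational : Carrier → Set ℓ
  IsRational u = ∃ λ q → u ≈ rat q

  IsInteger : ℕ → Carrier → Set ℓ
  IsInteger H u = ∃ λ i → ∣ i ∣ ≤ H × u ≈ int i

  rat-injective : ∀ {p q} → rat p ≈ rat q → p ≡ q
  rat-injective {p} {q} eq with p ℚ.≟ q
  ... | yes p≡q = p≡q
  ... | no p≢q  = ⊥-elim (rat-≉0 (λ d≡0 → p≢q (p-q≡0⇒p≡q d≡0))
          (trans (φ.+-homo p (ℚ.- q)) (trans (+-congˡ (φ.-‿homo q)) (x≈y⇒x-y≈0 eq))))
    where
    p-q≡0⇒p≡q : p ℚ.- q ≡ 0ℚ → p ≡ q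
    p-q≡0⇒p≡q d≡0 = ≡.trans (≡.sym (ℚ.+-identityʳ p)) (≡.trans (≡.cong (p ℚ.+_) (≡.sym (ℚ.+-inverseˡ q)))
      (≡.trans (≡.sym (ℚ.+-assoc p (ℚ.- q) q)) (≡.trans (≡.cong (ℚ._+ q) d≡0) (ℚ.+-identityˡ q))))

  int-injective : ∀ {i j} → int i ≈ int j → i ≡ j
  int-injective eq = ≡.cong ↥_ (rat-injective eq)

  nat-* : ∀ m n → nat (m ℕ.* n) ≈ nat m * nat n
  nat-* m n = trans (reflexive (≡.cong int (ℤ.pos-* m n))) (int-* (+ m) (+ n))

  nat-suc : ∀ n → nat (suc n) ≈ 1# + nat n
  nat-suc n = trans (int-+ (+ 1) (+ n)) (+-congʳ φ.1#-homo)

  int-^ : ∀ i k → int (i ℤ.^ k) ≈ int i ^ k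
  int-^ i zero    = φ.1#-homo
  int-^ i (suc k) = trans (int-* i (i ℤ.^ k)) (*-congˡ (int-^ i k))

  ^-cong : ∀ {x y} n → x ≈ y → x ^ n ≈ y ^ n
  ^-cong zero    x≈y = refl
  ^-cong (suc n) x≈y = *-cong x≈y (^-cong n x≈y)

  ^-distrib-* : ∀ x y n → (x * y) ^ n ≈ x ^ n * y ^ n
  ^-distrib-* x y zero    = sym (*-identityˡ 1#)
  ^-distrib-* x y (suc n) = trans (*-congˡ (^-distrib-* x y n))
    (solve 4 (λ x y u v → x :* y :* (u :* v) := x :* u :* (y :* v)) refl x y _ _)

  1#-^ : ∀ n → 1# ^ n ≈ 1#
  1#-^ zero    = refl
  1#-^ (suc n) = trans (*-identityˡ _) (1#-^ n)

  abs-^ : ∀ i k → ∣ i ℤ.^ k ∣ ≡ ∣ i ∣ ℕ.^ k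
  abs-^ i zero    = ≡.refl
  abs-^ i (suc k) = ≡.trans (ℤ.abs-* i (i ℤ.^ k)) (≡.cong (∣ i ∣ ℕ.*_) (abs-^ i k))

  -- The powers of a non-integer have unbounded denominators, and those of an
  -- integer of size greater than R outgrow C Rᵏ.
  amplification : ∀ {u A C R} → 1 ≤ A → 1 ≤ R → IsRational u →
    (∀ k → IsInteger (C ℕ.* R ℕ.^ k) (nat A * u ^ k)) → IsInteger R u
  amplification {u} {A} {C} {R} 1≤A 1≤R (q@(ℚ.mkℚ n d-1 c) , u≈q) powers =
    n , exponential-growth {C = C} 1≤A 1≤R growth , trans u≈q (rat-cong q≡n)
    where
    d = suc d-1
    equation : ∀ k → + A ℤ.* n ℤ.^ k ≡ proj₁ (powers k) ℤ.* (+ d) ℤ.^ k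
    equation k = int-injective (trans (int-* (+ A) (n ℤ.^ k)) (trans (*-congˡ (trans (int-^ n k)
        (^-cong k (trans (rat-cong (≡.sym (↧*p≡↥ q))) (trans (φ.*-homo _ q) (*-congˡ (sym u≈q)))))))
      (trans (*-congˡ (^-distrib-* (nat d) u k))
      (trans (solve 3 (λ a d u → a :* (d :* u) := a :* u :* d) refl (nat A) _ _)
      (trans (*-cong (proj₂ (proj₂ (powers k))) (sym (int-^ (+ d) k))) (sym (int-* (proj₁ (powers k)) ((+ d) ℤ.^ k))))))))
    abs-equation : ∀ k → A ℕ.* ∣ n ∣ ℕ.^ k ≡ ∣ proj₁ (powers k) ∣ ℕ.* d ℕ.^ k
    abs-equation k = ≡.trans (≡.sym (≡.trans (ℤ.abs-* (+ A) (n ℤ.^ k)) (≡.cong (A ℕ.*_) (abs-^ n k))))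
      (≡.trans (≡.cong ∣_∣ (equation k)) (≡.trans (ℤ.abs-* (proj₁ (powers k)) ((+ d) ℤ.^ k)) (≡.cong (∣ proj₁ (powers k) ∣ ℕ.*_) (abs-^ (+ d) k))))
    d≡1 : d ≡ 1
    d≡1 = bounded-denominator⇒1 (Coprimality.recompute c) (s≤s z≤n) 1≤A (λ k → divides ∣ proj₁ (powers k) ∣ (abs-equation k))
    q≡n : q ≡ fromℤ n
    q≡n = ≡.trans (≡.sym (ℚ.*-identityˡ q)) (≡.trans (≡.cong (λ d → fromℤ (+ d) ℚ.* q) (≡.sym d≡1)) (↧*p≡↥ q))
    growth : ∀ k → A ℕ.* ∣ n ∣ ℕ.^ k ≤ C ℕ.* R ℕ.^ k
    growth k = ≡.subst (_≤ C ℕ.* R ℕ.^ k) (≡.sym (≡.trans (abs-equation k)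
      (≡.trans (≡.cong (λ d → ∣ proj₁ (powers k) ∣ ℕ.* d ℕ.^ k) d≡1) (≡.trans (≡.cong (∣ proj₁ (powers k) ∣ ℕ.*_) (ℕ.^-zeroˡ k)) (ℕ.*-identityʳ _)))))
      (proj₁ (proj₂ (powers k)))

  -- Bnd H x says that x is an integral combination of the elements of a fixed
  -- basis, with coefficients of size at most H.
  record Bounding {m} (Mem : Carrier → Set m) : Set (m ⊔ Level.suc (a ⊔ ℓ)) where
    field
      Bnd    : ℕ → Carrier → Set (a ⊔ ℓ)
      E      : ℕ
      b-mem  : ∀ {H x} → Bnd H x → Mem x
      b-cong : ∀ {H x y} → x ≈ y → Bnd H x → Bnd H y
      b-mono : ∀ {H H′ x} → H ≤ H′ → Bnd H x → Bnd H′ x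
      b-0    : Bnd 0 0#
      b-+    : ∀ {H H′ x y} → Bnd H x → Bnd H′ y → Bnd (H ℕ.+ H′) (x + y)
      b-neg  : ∀ {H x} → Bnd H x → Bnd H (- x)
      b-*    : ∀ {H H′ x y} → Bnd H x → Bnd H′ y → Bnd (E ℕ.* (H ℕ.* H′)) (x * y)
      b-den  : ∀ {x} → Mem x → ∃ λ M → 1 ≤ M × ∃ λ H → Bnd H (nat M * x)
      b-rat  : ∀ {H x} → IsRational x → Bnd H x → IsInteger H x

    b-nat : ∀ {H x} n → Bnd H x → Bnd (n ℕ.* H) (nat n * x)
    b-nat zero    b = b-cong (sym (trans (*-congʳ φ.0#-homo) (zeroˡ _))) b-0
    b-nat {x = x} (suc n) b = b-cong (sym (trans (*-congʳ (nat-suc n))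
      (solve 2 (λ n x → (con (+ 1) :+ n) :* x := x :+ n :* x) refl (nat n) x))) (b-+ b (b-nat n b))

    b-dens : ∀ {n} {xs : Vec Carrier n} → All Mem xs →
             ∃ λ M → 1 ≤ M × ∃ λ H → All (λ x → Bnd H (nat M * x)) xs
    b-dens [] = 1 , s≤s z≤n , 0 , []
    b-dens {xs = x ∷ xs} (x∈ ∷ xs∈) with b-den x∈ | b-dens xs∈
    ... | M , 1≤M , H , b | M′ , 1≤M′ , H′ , bs = M ℕ.* M′ , ℕ.*-mono-≤ 1≤M 1≤M′ , M′ ℕ.* H ℕ.+ M ℕ.* H′ ,
      b-mono (ℕ.m≤m+n _ _) (b-cong (trans (solve 3 (λ m m′ x → m′ :* (m :* x) := m :* m′ :* x) refl (nat M) (nat M′) x)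
        (*-congʳ (sym (nat-* M M′)))) (b-nat M′ b))
      ∷ All.map (λ {y} b → b-mono (ℕ.m≤n+m _ (M′ ℕ.* H)) (b-cong (trans (sym (*-assoc _ _ y)) (*-congʳ (sym (nat-* M M′)))) (b-nat M b))) bs

    b-zipWith-+ : ∀ {H H′ n} {p q : Vec Carrier n} → All (Bnd H) p → All (Bnd H′) q → All (Bnd (H ℕ.+ H′)) (zipWith _+_ p q)
    b-zipWith-+ []       []       = []
    b-zipWith-+ (x ∷ xs) (y ∷ ys) = b-+ x y ∷ b-zipWith-+ xs ys

    b-map-* : ∀ {H H′ c n} {p : Vec Carrier n} → Bnd H c → All (Bnd H′) p → All (Bnd (E ℕ.* (H ℕ.* H′))) (map (c *_) p)
    b-map-* c ps = All.map⁺ (All.map (b-* c) ps)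

    b-zeros : ∀ n → All (Bnd 0) (replicate n 0#)
    b-zeros zero    = []
    b-zeros (suc n) = b-0 ∷ b-zeros n

  -- Coordinates with respect to the powers of `y`. Because the coefficients of `p` are themselves
  -- integral combinations, reduction modulo `p` introduces no denominators.
  module Quotient {m} {Mem : Carrier → Set m} (B : Bounding Mem) {n H₀ y} (p : Vec Carrier (suc n))
    (p-bnd : All (Bounding.Bnd B H₀) p) (isRoot : ev 1# p y ≈ 0#) where
    open Bounding B

    Bnd′ : ℕ → Carrier → Set (a ⊔ ℓ)
    Bnd′ H z = ∃ λ (h : Vec Carrier (suc n)) → All (Bnd H) h × z ≈ ev 0# h y

    -- The cost of one multiplication by `y`: the shifted coordinates contribute H, and the overflow
    -- times `p` contributes E H H₀.
    ρ : ℕ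
    ρ = 1 ℕ.+ E ℕ.* H₀

    b′-cong : ∀ {H x z} → x ≈ z → Bnd′ H x → Bnd′ H z
    b′-cong eq (h , bs , e) = h , bs , trans (sym eq) e

    b′-mono : ∀ {H H′ x} → H ≤ H′ → Bnd′ H x → Bnd′ H′ x
    b′-mono le (h , bs , e) = h , All.map (b-mono le) bs , e

    b′-0 : Bnd′ 0 0#
    b′-0 = replicate _ 0# , b-zeros _ , sym (ev-zero y (zeros (suc n)))

    b′-base : ∀ {H c} → Bnd H c → Bnd′ H c
    b′-base {c = c} b = c ∷ replicate n 0# , b ∷ All.map (b-mono z≤n) (b-zeros n) ,
      sym (trans (+-congˡ (*-congˡ (ev-zero y (zeros n)))) (solve 2 (λ c y → c :+ y :* con (+ 0) := c) refl c y))

    b′-+ : ∀ {H H′ x z} → Bnd′ H x → Bnd′ H′ z → Bnd′ (H ℕ.+ H′) (x + z)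
    b′-+ (h , bs , e) (g , bs′ , e′) = zipWith _+_ h g , b-zipWith-+ bs bs′ , trans (+-cong e e′) (sym (ev₀-+ h g y))

    b′-neg : ∀ {H x} → Bnd′ H x → Bnd′ H (- x)
    b′-neg (h , bs , e) = map -_ h , All.map⁺ (All.map b-neg bs) , trans (-‿cong e) (sym (ev-neg h))
      where
      ev-neg : ∀ {m} (h : Vec Carrier m) → ev 0# (map -_ h) y ≈ - ev 0# h y
      ev-neg []      = solve 0 (con (+ 0) := :- con (+ 0)) refl
      ev-neg (c ∷ h) = trans (+-congˡ (*-congˡ (ev-neg h))) (solve 3 (λ c y u → :- c :+ y :* :- u := :- (c :+ y :* u)) refl c y _)

    b′-scale : ∀ {H H′ c z} → Bnd H c → Bnd′ H′ z → Bnd′ (E ℕ.* (H ℕ.* H′)) (c * z)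
    b′-scale {c = c} b (h , bs , e) = map (c *_) h , b-map-* b bs , trans (*-congˡ e) (sym (ev₀-* c h y))

    b′-gen : ∀ {H z} → Bnd′ H z → Bnd′ (ρ ℕ.* H) (y * z)
    b′-gen {H} {z} (h , bs , e) = remainderStep p 0# h ,
      All.map (b-mono (ℕ.≤-reflexive (lem H E H₀))) (b-zipWith-+ (b-shift (b-mono z≤n b-0) bs) (b-map-* (b-neg (b-overflow (b-mono z≤n b-0) bs)) p-bnd)) ,
      trans (*-congˡ e) (trans (sym (+-identityˡ _)) (sym (ev-remainderStep p 0# h isRoot)))
      where
      lem : ∀ H E H₀ → H ℕ.+ E ℕ.* (H ℕ.* H₀) ≡ (1 ℕ.+ E ℕ.* H₀) ℕ.* H
      lem = solve-∀
      b-shift : ∀ {m c} {h : Vec Carrier m} → Bnd H c → All (Bnd H) h → All (Bnd H) (shift c h)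
      b-shift b []        = []
      b-shift b (b′ ∷ bs) = b ∷ b-shift b′ bs
      b-overflow : ∀ {m c} {h : Vec Carrier m} → Bnd H c → All (Bnd H) h → Bnd H (overflow c h)
      b-overflow b []        = b
      b-overflow b (b′ ∷ bs) = b-overflow b′ bs

    b′-gen-^ : ∀ {H z} k → Bnd′ H z → Bnd′ (H ℕ.* ρ ℕ.^ k) (y ^ k * z)
    b′-gen-^ {H} {z} zero    b = b′-mono (ℕ.≤-reflexive (≡.sym (ℕ.*-identityʳ H))) (b′-cong (sym (*-identityˡ z)) b)
    b′-gen-^ {H} {z} (suc k) b = b′-mono (ℕ.≤-reflexive (lem ρ H (ρ ℕ.^ k))) (b′-cong (sym (*-assoc y _ z)) (b′-gen (b′-gen-^ k b)))
      where
      lem : ∀ r H P → r ℕ.* (H ℕ.* P) ≡ H ℕ.* (r ℕ.* P)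
      lem = solve-∀

    -- The new structure constant, by Horner's rule: each coefficient costs `E` and each
    -- multiplication by `y` costs `ρ`.
    factor : ℕ → ℕ
    factor zero    = 0
    factor (suc m) = E ℕ.+ ρ ℕ.* factor m

    b′-* : ∀ {H H′ x z} → Bnd′ H x → Bnd′ H′ z → Bnd′ (factor (suc n) ℕ.* (H ℕ.* H′)) (x * z)
    b′-* {H} {H′} {z = z} (h , bs , e) b = b′-cong (*-congʳ (sym e)) (go h bs)
      where
      lem : ∀ E H H′ ρ f → E ℕ.* (H ℕ.* H′) ℕ.+ ρ ℕ.* (f ℕ.* (H ℕ.* H′)) ≡ (E ℕ.+ ρ ℕ.* f) ℕ.* (H ℕ.* H′)
      lem = solve-∀
      go : ∀ {m} (h : Vec Carrier m) → All (Bnd H) h → Bnd′ (factor m ℕ.* (H ℕ.* H′)) (ev 0# h y * z)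
      go []      []       = b′-cong (sym (zeroˡ z)) b′-0
      go {suc m} (c ∷ h) (b″ ∷ bs) = b′-mono (ℕ.≤-reflexive (lem E H H′ ρ (factor m)))
        (b′-cong (solve 4 (λ c y z u → c :* z :+ y :* (u :* z) := (c :+ y :* u) :* z) refl c y z _)
          (b′-+ (b′-scale b″ b) (b′-gen (go h bs))))

-- The rational root test, and towers of fields with bounded coordinates.

module Rationals {a ℓ} (Ω : ClosedField a ℓ) where
  open ClosedField Ω
  open Roots Ω
  open Subfields Ω
  open Embeddings Ω
  open Bounded Ω

  int-mul : ∀ {H H′ x y} → IsInteger H x → IsInteger H′ y → IsInteger (H ℕ.* H′) (x * y)
  int-mul (i , le , eq) (j , le′ , eq′) = i ℤ.* j , ℕ.≤-trans (ℕ.≤-reflexive (ℤ.abs-* i j)) (ℕ.*-mono-≤ le le′) ,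
    trans (*-cong eq eq′) (sym (int-* i j))

  integers : Bounding IsRational
  integers = record
    { Bnd    = λ H x → Lift a (IsInteger H x)
    ; E      = 1
    ; b-mem  = λ (lift (i , _ , eq)) → fromℤ i , eq
    ; b-cong = λ eq (lift (i , le , e)) → lift (i , le , trans (sym eq) e)
    ; b-mono = λ le (lift (i , le′ , e)) → lift (i , ℕ.≤-trans le′ le , e)
    ; b-0    = lift (+ 0 , z≤n , sym φ.0#-homo)
    ; b-+    = λ (lift (i , le , e)) (lift (j , le′ , e′)) → lift (i ℤ.+ j ,
                 ℕ.≤-trans (ℤ.∣i+j∣≤∣i∣+∣j∣ i j) (ℕ.+-mono-≤ le le′) , trans (+-cong e e′) (sym (int-+ i j)))
    ; b-neg  = λ (lift (i , le , e)) → lift (ℤ.- i , ℕ.≤-trans (ℕ.≤-reflexive (ℤ.∣-i∣≡∣i∣ i)) le , trans (-‿cong e) (sym (int-neg i)))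
    ; b-*    = λ {H} {H′} {x} {y} (lift b) (lift b′) → lift (≡.subst (λ n → IsInteger n (x * y)) (≡.sym (ℕ.*-identityˡ (H ℕ.* H′))) (int-mul b b′))
    ; b-den  = λ (q , eq) → ℚ.denominatorℕ q , s≤s z≤n , ∣ ↥ q ∣ , lift (↥ q , ℕ.≤-refl ,
                 trans (*-congˡ eq) (trans (sym (φ.*-homo _ q)) (rat-cong (↧*p≡↥ q))))
    ; b-rat  = λ _ → lower
    }

  nat-^ : ∀ m k → nat (m ℕ.^ k) ≈ nat m ^ k
  nat-^ m zero    = φ.1#-homo
  nat-^ m (suc k) = trans (nat-* m (m ℕ.^ k)) (*-congˡ (nat-^ m k))

  nat≥1-≉0 : ∀ {n} → 1 ≤ n → nat n ≉ 0#
  nat≥1-≉0 {n} 1≤n = nat-≉0 n {{ℕ.>-nonZero 1≤n}}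

  1≤^ : ∀ {m} k → 1 ≤ m → 1 ≤ m ℕ.^ k
  1≤^ {m} k 1≤m = ℕ.m^n>0 m {{ℕ.>-nonZero 1≤m}} k

  module _ {m} {Mem : Carrier → Set m} (B : Bounding Mem) where
    open Bounding B

    b-scaleRoots : ∀ {n H} M {p : Vec Carrier n} →
                   All (λ x → Bnd H (nat M * x)) p → ∃ λ H₀ → All (Bnd H₀) (scaleRoots (nat M) p)
    b-scaleRoots M [] = 0 , []
    b-scaleRoots {suc n} {H} M {d ∷ p} (b ∷ bs) with b-scaleRoots M bs
    ... | H₀ , bs′ = M ℕ.^ n ℕ.* H ℕ.+ H₀ ,
      b-mono (ℕ.m≤m+n _ _) (b-cong (trans (*-congʳ (nat-^ M n)) (solve 3 (λ m u d → u :* (m :* d) := m :* u :* d) refl (nat M) _ d)) (b-nat (M ℕ.^ n) b))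
      ∷ All.map (b-mono (ℕ.m≤n+m _ (M ℕ.^ n ℕ.* H))) bs′

  -- The multiplier and the bound are found before it is known whether `u` is rational; this is what
  -- makes rationality decidable. The multiplier makes y = M u integral, so the coordinates of
  -- `y ^ k` are integers that grow at rate `ρ`. If `y` is rational, evaluating them at `y` costs
  -- one fixed denominator, and `amplification` applies.
  integer-multiple : ∀ u → ∃ λ M → 1 ≤ M × ∃ λ R → IsRational u → IsInteger R (nat M * u)
  integer-multiple u with algebraic u
  ... | zero  , [] , eq = ⊥-elim (1≉0 eq)
  ... | suc n , h  , eq = M , 1≤M , ρ , λ u-rat → integral (fromℤ (+ M) ℚ.* proj₁ u-rat , trans (*-congˡ (proj₂ u-rat)) (sym (φ.*-homo _ _)))
    where
    open Bounding integers
    rationals : ∀ {n} (h : Vec ℚ n) → All IsRational (map rat h)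
    rationals []      = []
    rationals (q ∷ h) = (q , refl) ∷ rationals h
    dens = b-dens (rationals h)
    M = proj₁ dens
    1≤M = proj₁ (proj₂ dens)
    scaled = b-scaleRoots integers M (proj₂ (proj₂ (proj₂ dens)))
    y = nat M * u
    open Quotient integers (scaleRoots (nat M) (map rat h)) (proj₂ scaled)
      (trans (ev-scaleRoots (nat M) 1# (map rat h) u) (trans (*-congˡ eq) (zeroʳ _)))

    integral : IsRational y → IsInteger ρ y
    integral y-rat = amplification {A = D ℕ.^ suc n} {C = C (suc n)} (1≤^ (suc n) 1≤D) (s≤s z≤n) y-rat λ k →
      let g , bs , e = b′-gen-^ k (b′-base {1} (lift (+ 1 , ℕ.≤-refl , sym φ.1#-homo)))
      in lower (b-mono (ℕ.*-monoʳ-≤ (C (suc n)) (ℕ.≤-reflexive (ℕ.*-identityˡ (ρ ℕ.^ k))))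
           (b-cong (*-congˡ (trans (sym e) (*-identityʳ _))) (multiple g bs)))
      where
      den = b-den y-rat
      D = proj₁ den
      1≤D = proj₁ (proj₂ den)
      s = proj₁ (proj₂ (proj₂ den))
      -- Horner with denominators: D ^ (m + 1) (c + y u) = D ^ (m + 1) c + (D y) (D ^ m u), where D
      -- y is an integer of size at most `s`.
      C : ℕ → ℕ
      C zero    = 0
      C (suc m) = D ℕ.^ suc m ℕ.+ s ℕ.* C m
      multiple : ∀ {m H} (g : Vec Carrier m) → All (Bnd H) g → Bnd (C m ℕ.* H) (nat (D ℕ.^ m) * ev 0# g y)
      multiple []      []       = b-cong (sym (zeroʳ _)) b-0
      multiple {suc m} {H} (c ∷ g) (b ∷ bs) = b-mono (ℕ.≤-reflexive (lem (D ℕ.^ suc m) s (C m) H))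
        (b-cong (sym (trans (distribˡ _ c _) (+-congˡ (trans (*-congʳ (nat-* D (D ℕ.^ m)))
            (solve 4 (λ d e y u → d :* e :* (y :* u) := d :* y :* (e :* u)) refl (nat D) _ y _)))))
          (b-+ (b-nat (D ℕ.^ suc m) b) (b-* (proj₂ (proj₂ (proj₂ den))) (multiple g bs))))
        where
        lem : ∀ d s C H → d ℕ.* H ℕ.+ 1 ℕ.* (s ℕ.* (C ℕ.* H)) ≡ (d ℕ.+ s ℕ.* C) ℕ.* H
        lem = solve-∀

  abstract
    rational? : Decidable IsRational
    rational? u with integer-multiple u
    ... | suc m , _ , R , integral = map′ to from (LAny.any? (λ i → (nat (suc m) * u) ≟ int i) (ints R))
      where
      M : ℚ
      M = fromℤ (+ suc m)
      Integer : ℤ → Set ℓ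
      Integer i = nat (suc m) * u ≈ int i
      to : LAny.Any Integer (ints R) → IsRational u
      to any = let i , eq = LAny.satisfied any in ℚ.1/ M ℚ.* fromℤ i ,
        *-cancelˡ (nat-≉0 (suc m)) (trans eq (trans (rat-cong (≡.sym (≡.trans (≡.sym (ℚ.*-assoc M (ℚ.1/ M) (fromℤ i)))
          (≡.trans (≡.cong (ℚ._* fromℤ i) (ℚ.*-inverseʳ M)) (ℚ.*-identityˡ (fromℤ i)))))) (φ.*-homo M _)))
      from : IsRational u → LAny.Any Integer (ints R)
      from u-rat = let i , le , eq = integral u-rat in lose (∈-ints i le) eq

  ℚ-field : Subfield
  ℚ-field = record
    { Mem  = λ u → True (rational? u)
    ; mem? = λ u → map′ fromWitness toWitness (rational? u)
    ; resp = λ eq x∈ → let q , e = toWitness x∈ in fromWitness (q , trans (sym eq) e)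
    ; rat∈ = λ q → fromWitness (q , refl)
    ; +∈   = λ x∈ y∈ → let p , e = toWitness x∈ ; q , e′ = toWitness y∈
                       in fromWitness (p ℚ.+ q , trans (+-cong e e′) (sym (φ.+-homo p q)))
    ; *∈   = λ x∈ y∈ → let p , e = toWitness x∈ ; q , e′ = toWitness y∈
                       in fromWitness (p ℚ.* q , trans (*-cong e e′) (sym (φ.*-homo p q)))
    ; inv∈ = λ x∈ xy≈1 → fromWitness (reciprocal (toWitness x∈) xy≈1)
    }
    where
    reciprocal : ∀ {x y} → IsRational x → x * y ≈ 1# → IsRational y
    reciprocal {x} {y} (q , e) xy≈1 = ℚ.1/ q , *-cancelˡ x≉0
      (trans xy≈1 (sym (trans (*-congʳ e) (trans (sym (φ.*-homo q _)) (trans (rat-cong (ℚ.*-inverseʳ q)) φ.1#-homo)))))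
      where
      x≉0 : x ≉ 0#
      x≉0 x≈0 = 1≉0 (trans (sym xy≈1) (trans (*-congʳ x≈0) (zeroˡ y)))
      instance _ = ℚ.≢-nonZero {q} λ q≡0 → x≉0 (trans e (trans (rat-cong q≡0) φ.0#-homo))

  rational⁻ : ∀ {u} → Subfield.Mem ℚ-field u → IsRational u
  rational⁻ {u} = toWitness {a? = rational? u}

  module _ (k : Subfield) (B : Bounding (Subfield.Mem k)) (y : Carrier) where
    open Subfield k
    open Bounding B

    private
      M₀ : MinPoly k y
      M₀ = minPoly k y
      open MinPoly M₀
      dens = b-dens poly∈
      M = proj₁ dens
      M≉0 : nat M ≉ 0#
      M≉0 = nat≥1-≉0 (proj₁ (proj₂ dens))
      scaled = b-scaleRoots B M (proj₂ (proj₂ (proj₂ dens)))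
      H₀ = proj₁ scaled
      p = scaleRoots (nat M) poly
      y₀ = nat M * y

      scaleRoots∈ : ∀ {m c} {q : Vec Carrier m} → Mem c → All Mem q → All Mem (scaleRoots c q)
      scaleRoots∈ c∈ []                 = []
      scaleRoots∈ {suc m} c∈ (d∈ ∷ q∈) = *∈ (^∈ (suc m) c∈) d∈ ∷ scaleRoots∈ c∈ q∈

      -- `y₀` generates the same field as `y`, and its equation has bounded coefficients, as
      -- `Quotient` requires. Scaling back by the inverse would turn a smaller equation for `y₀`
      -- into one for `y`.
      integral-generator : MinPoly k y₀
      integral-generator = record
        { poly      = p
        ; isMinimal = record
          { poly∈   = scaleRoots∈ (rat∈ _) poly∈
          ; isRoot  = trans (ev-scaleRoots (nat M) 1# poly y) (trans (*-congˡ isRoot) (zeroʳ _))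
          ; minimal = λ q q∈ m<n eq → minimal (scaleRoots (inv (nat M)) q) (scaleRoots∈ (inv∈ (rat∈ _) (inverse _ M≉0)) q∈) m<n
              (trans (ev-cong₃ (scaleRoots (inv (nat M)) q) (sym back))
                (trans (ev-scaleRoots (inv (nat M)) 1# q y₀) (trans (*-congˡ eq) (zeroʳ _))))
          }
        }
        where
        back : inv (nat M) * y₀ ≈ y
        back = trans (solve 3 (λ i m y → i :* (m :* y) := m :* i :* y) refl _ (nat M) y)
          (trans (*-congʳ (inverse _ M≉0)) (*-identityˡ y))

      open Adjoin k integral-generator
      open Quotient B p (proj₂ scaled) (MinPoly.isRoot integral-generator)

    bounded-adjoin : ∃ λ k′ → Bounding (Subfield.Mem k′) × (∀ {x} → Mem x → Subfield.Mem k′ x) × Subfield.Mem k′ y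
    bounded-adjoin = adjoin , bounding , base⊆adjoin , y∈
      where
      y∈ : Subfield.Mem adjoin y
      y∈ = Subfield.resp adjoin (trans (solve 3 (λ i m y → i :* (m :* y) := m :* i :* y) refl _ (nat M) y)
          (trans (*-congʳ (inverse _ M≉0)) (*-identityˡ y)))
        (Subfield.*∈ adjoin (base⊆adjoin (inv∈ (rat∈ _) (inverse _ M≉0))) gen∈adjoin)
      bounding : Bounding (Subfield.Mem adjoin)
      bounding = record
        { Bnd    = Bnd′
        ; E      = factor (suc n)
        ; b-mem  = λ (h , bs , e) → member⁺ (h , All.map b-mem bs , e)
        ; b-cong = b′-cong
        ; b-mono = b′-mono
        ; b-0    = b′-0
        ; b-+    = b′-+
        ; b-neg  = b′-neg
        ; b-*    = b′-*
        ; b-den  = λ x∈ → let h , h∈ , e = member⁻ x∈ ; M , 1≤M , H , bs = b-dens h∈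
                          in M , 1≤M , H , map (nat M *_) h , All.map⁺ bs , trans (*-congˡ e) (sym (ev₀-* (nat M) h y₀))
        ; b-rat  = λ {H} {x} x-rat (h , bs , e) → constant {H} {x} x-rat h bs e
        }
        where
        -- The basis contains 1: all coefficients of (c - x) + T h vanish by minimality, so `x` is
        -- the coefficient `c`, to which `b-rat` of the smaller field applies.
        constant : ∀ {H x} → IsRational x → (h : Vec Carrier (suc n)) → All (Bnd H) h → x ≈ ev 0# h y₀ → IsInteger H x
        constant {x = x} x-rat@(q , x≈q) (c ∷ h) (b ∷ bs) e
          with MinPoly.all-zero integral-generator (c - x ∷ h) (minus∈ (b-mem b) (resp (sym x≈q) (rat∈ q)) ∷ All.map b-mem bs) ℕ.≤-refl
                 (trans (solve 3 (λ c x u → c :- x :+ u := c :+ u :- x) refl c x _) (x≈y⇒x-y≈0 (sym e)))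
        ... | c-x≈0 ∷ _ = b-rat x-rat (b-cong (x-y≈0⇒x≈y c-x≈0) b)

  bounded-tower : ∀ ys → ∃ λ k → Bounding (Subfield.Mem k) × LAll.All (Subfield.Mem k) ys
  bounded-tower [] = ℚ-field , record
    { Bnd    = Bnd
    ; E      = E
    ; b-mem  = λ b → fromWitness (b-mem b)
    ; b-cong = b-cong
    ; b-mono = b-mono
    ; b-0    = b-0
    ; b-+    = b-+
    ; b-neg  = b-neg
    ; b-*    = b-*
    ; b-den  = λ x∈ → b-den (rational⁻ x∈)
    ; b-rat  = b-rat
    } , []
    where open Bounding integers
  bounded-tower (y ∷ ys) with bounded-tower ys
  ... | k , B , ys∈ = let k′ , B′ , k⊆k′ , y∈ = bounded-adjoin k B y in k′ , B′ , y∈ ∷ LAll.map k⊆k′ ys∈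

  module _ {p} (P : Carrier → Set p) (p-cong : ∀ {x y} → x ≈ y → P x → P y) (p-0 : P 0#)
    (p-+ : ∀ {x y} → P x → P y → P (x + y)) (p-* : ∀ {x y} → P x → P y → P (x * y)) where

    private
      p-ev : ∀ {m y} {h : Vec Carrier m} → P y → All P h → P (ev 0# h y)
      p-ev py []       = p-0
      p-ev py (c ∷ cs) = p-+ c (p-* py (p-ev py cs))

    -- The image of a number field comes without a membership test. Adjoining generators one at a
    -- time supplies one, and the elements obtained are polynomials in the generators, so they
    -- remain in `P`.
    generated : ∀ (k : Subfield) ys → (∀ {x} → Subfield.Mem k x → P x) → LAll.All P ys →
      ∃ λ k′ → (∀ {x} → Subfield.Mem k x → Subfield.Mem k′ x) × LAll.All (Subfield.Mem k′) ys × (∀ {x} → Subfield.Mem k′ x → P x)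
    generated k []       base []         = k , (λ x∈ → x∈) , [] , base
    generated k (y ∷ ys) base (py ∷ pys) =
      let k′ , k⊆k′ , ys∈ , k′⊆P = generated adjoin ys (λ x∈ → let h , h∈ , e = member⁻ x∈ in p-cong (sym e) (p-ev py (All.map base h∈))) pys
      in k′ , (λ x∈ → k⊆k′ (base⊆adjoin x∈)) , k⊆k′ gen∈adjoin ∷ ys∈ , k′⊆P
      where open Adjoin k (minPoly k y)

-- Growth rates, the finite set of candidates and the degree bound.

same-remainder⇒≤ : ∀ {n i j d} .{{_ : ℕ.NonZero n}} → 1 ≤ d → i < j → (i ℕ.* d) % n ≡ (j ℕ.* d) % n → n ≤ j ℕ.* d
same-remainder⇒≤ {n} {i} {j} {d} 1≤d i<j same = begin
  n                                                    ≤⟨ ℕ.m≤m+n n (I / n ℕ.* n) ⟩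
  n ℕ.+ I / n ℕ.* n                                    ≤⟨ ℕ.*-monoˡ-≤ n (ℕ.*-cancelʳ-< n (I / n) (J / n) quotients) ⟩
  J / n ℕ.* n                                          ≤⟨ ℕ.m≤n+m (J / n ℕ.* n) (J % n) ⟩
  J % n ℕ.+ J / n ℕ.* n                                ≡⟨ m≡m%n+[m/n]*n J n ⟨
  J                                                    ∎
  where
  open ℕ.≤-Reasoning
  I = i ℕ.* d
  J = j ℕ.* d
  I<J : I < J
  I<J = ℕ.*-monoˡ-< d {{ℕ.>-nonZero 1≤d}} i<j
  -- With equal remainders, the whole difference between `I` and `J` lies in the quotients.
  quotients : I / n ℕ.* n < J / n ℕ.* n
  quotients = ℕ.+-cancelˡ-< (J % n) (I / n ℕ.* n) (J / n ℕ.* n)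
    (≡.subst₂ _<_ (≡.trans (m≡m%n+[m/n]*n I n) (≡.cong (ℕ._+ I / n ℕ.* n) same)) (m≡m%n+[m/n]*n J n) I<J)

module Heights {a ℓ} (Ω : ClosedField a ℓ) where
  open ClosedField Ω
  open Roots Ω
  open Subfields Ω
  open Embeddings Ω
  open Bounded Ω
  open Rationals Ω

  ^-+ : ∀ x m n → x ^ (m ℕ.+ n) ≈ x ^ m * x ^ n
  ^-+ x zero    n = sym (*-identityˡ _)
  ^-+ x (suc m) n = trans (*-congˡ (^-+ x m n)) (sym (*-assoc x _ _))

  ^-* : ∀ x m n → x ^ (n ℕ.* m) ≈ (x ^ m) ^ n
  ^-* x m zero    = refl
  ^-* x m (suc n) = trans (^-+ x m (n ℕ.* m)) (*-congˡ (^-* x m n))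

  module GrowthRate {m} {Mem : Carrier → Set m} (B : Bounding Mem) (R : ℕ) where
    open Bounding B

    -- Only the rate `R` is shared; `M` and `H` may depend on the element.
    Growth : Carrier → Set (a ⊔ ℓ)
    Growth y = ∃ λ M → 1 ≤ M × ∃ λ H → ∀ j → Bnd (H ℕ.* R ℕ.^ j) (nat M * y ^ j)

    -- Bounds on t times all monomials in ys; multiplication by y ∈ ys costs
    -- exactly a factor R, with no constant, so the induced operator norm Op
    -- is submultiplicative.
    T : ∀ {m} → Vec Carrier m → ℕ → Carrier → Set (a ⊔ ℓ)
    T []       H t = Bnd H t
    T (y ∷ ys) H t = ∀ j → T ys (H ℕ.* R ℕ.^ j) (t * y ^ j)

    T-cong : ∀ {m} (ys : Vec Carrier m) {H t u} → t ≈ u → T ys H t → T ys H u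
    T-cong []       eq b = b-cong eq b
    T-cong (y ∷ ys) eq b = λ j → T-cong ys (*-congʳ eq) (b j)

    T-mono : ∀ {m} (ys : Vec Carrier m) {H H′ t} → H ≤ H′ → T ys H t → T ys H′ t
    T-mono []       le b = b-mono le b
    T-mono (y ∷ ys) le b = λ j → T-mono ys (ℕ.*-monoˡ-≤ (R ℕ.^ j) le) (b j)

    T-+ : ∀ {m} (ys : Vec Carrier m) {H H′ t u} → T ys H t → T ys H′ u → T ys (H ℕ.+ H′) (t + u)
    T-+ []       b b′ = b-+ b b′
    T-+ (y ∷ ys) {H} {H′} {t} {u} b b′ = λ j → T-mono ys (ℕ.≤-reflexive (≡.sym (ℕ.*-distribʳ-+ (R ℕ.^ j) H H′)))
      (T-cong ys (sym (distribʳ _ t u)) (T-+ ys (b j) (b′ j)))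

    T-neg : ∀ {m} (ys : Vec Carrier m) {H t} → T ys H t → T ys H (- t)
    T-neg []       b = b-neg b
    T-neg (y ∷ ys) {t = t} b = λ j → T-cong ys (solve 2 (λ t u → :- (t :* u) := :- t :* u) refl t _) (T-neg ys (b j))

    T⇒Bnd : ∀ {m} (ys : Vec Carrier m) {H t} → T ys H t → Bnd H t
    T⇒Bnd []       b = b
    T⇒Bnd (y ∷ ys) {H} b = T⇒Bnd ys (T-mono ys (ℕ.≤-reflexive (ℕ.*-identityʳ H)) (T-cong ys (*-identityʳ _) (b 0)))

    -- The constants in `Growth` are all paid here, on the starting element. The operator bounds
    -- applied to it afterwards carry none.
    T-base : ∀ {m} (ys : Vec Carrier m) → All Growth ys →
             ∃ λ M → 1 ≤ M × ∃ λ C → ∀ {H z} → Bnd H z → T ys (C ℕ.* H) (nat M * z)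
    T-base [] [] = 1 , ℕ.≤-refl , 1 , λ {H} b → b-nat 1 b
    T-base (y ∷ ys) ((M , 1≤M , H , growth) ∷ gs) with T-base ys gs
    ... | M′ , 1≤M′ , C , base = M′ ℕ.* M , ℕ.*-mono-≤ 1≤M′ 1≤M , C ℕ.* (E ℕ.* H) , λ {H′} {z} b j →
      T-mono ys (ℕ.≤-reflexive (lem C E H (R ℕ.^ j) H′))
        (T-cong ys (trans (solve 4 (λ m′ m y z → m′ :* (m :* y :* z) := m′ :* m :* z :* y) refl (nat M′) (nat M) _ z) (*-congʳ (*-congʳ (sym (nat-* M′ M)))))
          (base (b-* (growth j) b)))
      where
      lem : ∀ C E H P H′ → C ℕ.* (E ℕ.* (H ℕ.* P ℕ.* H′)) ≡ C ℕ.* (E ℕ.* H) ℕ.* H′ ℕ.* P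
      lem = solve-∀

    module _ {m} (ys : Vec Carrier m) where

      Op : ℕ → Carrier → Set (a ⊔ ℓ)
      Op ρ z = ∀ {H t} → T ys H t → T ys (ρ ℕ.* H) (z * t)

      op-mono : ∀ {ρ ρ′ z} → ρ ≤ ρ′ → Op ρ z → Op ρ′ z
      op-mono le o {H} b = T-mono ys (ℕ.*-monoˡ-≤ H le) (o b)

      op-1 : Op 1 1#
      op-1 {H} {t} b = T-mono ys (ℕ.≤-reflexive (≡.sym (ℕ.*-identityˡ H))) (T-cong ys (sym (*-identityˡ t)) b)

      op-+ : ∀ {ρ σ z w} → Op ρ z → Op σ w → Op (ρ ℕ.+ σ) (z + w)
      op-+ {ρ} {σ} {z} {w} o o′ {H} {t} b = T-mono ys (ℕ.≤-reflexive (≡.sym (ℕ.*-distribʳ-+ H ρ σ)))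
        (T-cong ys (sym (distribʳ t z w)) (T-+ ys (o b) (o′ b)))

      op-neg : ∀ {ρ z} → Op ρ z → Op ρ (- z)
      op-neg {z = z} o {t = t} b = T-cong ys (solve 2 (λ z t → :- (z :* t) := :- z :* t) refl z t) (T-neg ys (o b))

      op-* : ∀ {ρ σ z w} → Op ρ z → Op σ w → Op (ρ ℕ.* σ) (z * w)
      op-* {ρ} {σ} {z} {w} o o′ {H} {t} b = T-mono ys (ℕ.≤-reflexive (≡.sym (ℕ.*-assoc ρ σ H))) (T-cong ys (sym (*-assoc z w t)) (o (o′ b)))

      op-^ : ∀ {ρ z} k → Op ρ z → Op (ρ ℕ.^ k) (z ^ k)
      op-^ zero    o = op-1
      op-^ {ρ} {z} (suc k) o = op-* {ρ} {ρ ℕ.^ k} {z} {z ^ k} o (op-^ {ρ} {z} k o)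

      -- A coefficient of (T - r) p is one coefficient of `p` minus `r` times the next, which costs
      -- ρ + R ρ. The hypothesis `1 ≤ ρ` accounts for the implicit leading coefficient 1.
      op-mulLinear : ∀ {n ρ r} (p : Vec Carrier n) → 1 ≤ ρ → Op R r → All (Op ρ) p → All (Op (suc R ℕ.* ρ)) (mulLinear r p)
      op-mulLinear {ρ = ρ} {r} p 1≤ρ o os with go p os
        where
        go : ∀ {n} (p : Vec Carrier n) → All (Op ρ) p →
             ∃ λ h → ∃ λ (q : Vec Carrier n) → mulLinear r p ≡ h ∷ q × Op (R ℕ.* ρ) h × All (Op (suc R ℕ.* ρ)) q
        go [] [] = - r , [] , ≡.refl , op-neg {R ℕ.* ρ} {r} (op-mono {R} {R ℕ.* ρ} {r} (ℕ.≤-trans (ℕ.≤-reflexive (≡.sym (ℕ.*-identityʳ R))) (ℕ.*-monoʳ-≤ R 1≤ρ)) o) , []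
        go (c ∷ p) (oc ∷ os) with go p os
        ... | h , q , eq , oh , oq = - (r * c) , c + h ∷ q , ≡.cong (λ v → - (r * c) ∷ addHead c v) eq ,
              op-neg {R ℕ.* ρ} {r * c} (op-* {R} {ρ} {r} {c} o oc) , (λ {H} {t} → op-+ {ρ} {R ℕ.* ρ} {c} {h} oc oh {H} {t}) ∷ oq
      ... | h , q , eq , oh , oq = ≡.subst (All (Op (suc R ℕ.* ρ))) (≡.sym eq)
              ((λ {H} {t} → op-mono {R ℕ.* ρ} {suc R ℕ.* ρ} {h} (ℕ.m≤n+m _ ρ) oh {H} {t}) ∷ oq)

    op-roots : ∀ {m} (ys : Vec Carrier m) → All (Op ys R) ys
    op-roots []       = []
    op-roots (y ∷ ys) =
      (λ {H} {t} b j → T-mono ys (ℕ.≤-reflexive (lem H R (R ℕ.^ j))) (T-cong ys (solve 3 (λ t y u → t :* (y :* u) := y :* t :* u) refl t y _) (b (suc j))))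
      ∷ All.map (λ {w} o {H} {t} b j → T-mono ys (ℕ.≤-reflexive (≡.sym (ℕ.*-assoc R H (R ℕ.^ j)))) (T-cong ys (sym (*-assoc w t _)) (o (b j)))) (op-roots ys)
      where
      lem : ∀ H R P → H ℕ.* (R ℕ.* P) ≡ R ℕ.* H ℕ.* P
      lem = solve-∀

    op-fromRoots : ∀ {m n} (ys : Vec Carrier m) (rs : Vec Carrier n) → All (Op ys R) rs → All (Op ys (suc R ℕ.^ n)) (fromRoots rs)
    op-fromRoots ys []       []       = []
    op-fromRoots {n = suc n} ys (r ∷ rs) (o ∷ os) = op-mulLinear ys {ρ = suc R ℕ.^ n} (fromRoots rs) (1≤^ n (s≤s z≤n)) o (op-fromRoots ys rs os)

    -- A coefficient c of the product has an operator bound ρ, so `c ^ k` applied to a fixed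
    -- multiple of 1 is bounded by a constant times ρ ^ k. For rational c this is the hypothesis of
    -- `amplification`.
    rational-coefficients : ∀ {n} (ys : Vec Carrier n) → Mem 1# → All Growth ys → All IsRational (fromRoots ys) →
                            All (IsInteger (suc R ℕ.^ n)) (fromRoots ys)
    rational-coefficients {n} ys 1∈ growths rationals = All.map (λ (u-rat , o) → bound u-rat o) (All.zip (rationals , op-fromRoots ys ys (op-roots ys)))
      where
      base = T-base ys growths
      M = proj₁ base
      C = proj₁ (proj₂ (proj₂ base))
      den = b-den 1∈
      M₁ = proj₁ den
      H₁ = proj₁ (proj₂ (proj₂ den))
      ρ = suc R ℕ.^ n
      bound : ∀ {c} → IsRational c → Op ys ρ c → IsInteger ρ c
      bound {c} (q , c≈q) o = amplification {A = M ℕ.* M₁} {C = C ℕ.* H₁} (ℕ.*-mono-≤ (proj₁ (proj₂ base)) (proj₁ (proj₂ den))) (1≤^ n (s≤s z≤n)) (q , c≈q) λ k →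
        b-rat (nat-power-rational k)
          (b-mono (ℕ.≤-reflexive (ℕ.*-comm (ρ ℕ.^ k) (C ℕ.* H₁)))
            (b-cong (trans (solve 3 (λ u m n → u :* (m :* (n :* con (+ 1))) := m :* n :* u) refl (c ^ k) (nat M) (nat M₁)) (*-congʳ (sym (nat-* M M₁))))
              (T⇒Bnd ys (op-^ ys {ρ} {c} k o (proj₂ (proj₂ (proj₂ base)) (proj₂ (proj₂ (proj₂ den))))))))
        where
        open Subfield ℚ-field using (*∈; ^∈; rat∈; resp)
        nat-power-rational : ∀ k → IsRational (nat (M ℕ.* M₁) * c ^ k)
        nat-power-rational k = rational⁻ (*∈ (rat∈ _) (^∈ k (resp (sym c≈q) (rat∈ q))))

  module _ (K : Subfield) (bs : List Carrier) (spans : ∀ {x} → Subfield.Mem K x → Span bs x)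
    (D : ℕ) (degree≤ : ∀ {x} → Subfield.Mem K x → ∃ λ n → n ≤ D × ∃ λ (p : Vec ℚ n) → ev 1# (map rat p) x ≈ 0#)
    {β : Carrier} (β∈ : Subfield.Mem K β) where

    private
      annihilator : ∀ y → Vec ℚ (proj₁ (algebraic y))
      annihilator y = proj₁ (proj₂ (algebraic y))

      conjugates : ∀ y → Vec Carrier (proj₁ (algebraic y))
      conjugates y = roots (map rat (annihilator y))

      conjugate∈ : ∀ y (σ : Embedding ℚ-field) → Embedding.τ σ y ∈ᴸ toList (conjugates y)
      conjugate∈ y σ = roots-complete (map rat (annihilator y))
        (Embedding.preserves-roots σ (map rat (annihilator y)) (Subfield.rats∈ ℚ-field (annihilator y)) (proj₂ (proj₂ (algebraic y))))

      abstract
        tower : ∃ λ k → Bounding (Subfield.Mem k) × LAll.All (Subfield.Mem k) (List.concatMap (λ y → toList (conjugates y)) (β ∷ bs))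
        tower = bounded-tower (List.concatMap (λ y → toList (conjugates y)) (β ∷ bs))

      -- It contains every conjugate over ℚ of β and of the spanning elements, hence the image of K
      -- under every embedding; one `Bounding` serves all of these.
      L : Subfield
      L = proj₁ tower

      module L = Subfield L
      open Bounding (proj₁ (proj₂ tower))

      conjugates∈ : LAll.All (λ y → LAll.All L.Mem (toList (conjugates y))) (β ∷ bs)
      conjugates∈ = LAll.map⁻ (LAll.concat⁻ (proj₂ (proj₂ tower)))

      image∈L : ∀ (σ : Embedding ℚ-field) vs {z} → LAll.All (λ y → LAll.All L.Mem (toList (conjugates y))) vs → Span vs z → L.Mem (Embedding.τ σ z)
      image∈L σ [] [] z≈0 = L.resp (sym (trans (Embedding.cong σ z≈0) (Embedding.fixes σ (Subfield.0∈ ℚ-field)))) L.0∈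
      image∈L σ (v ∷ vs) {z} (v∈ ∷ vs∈) (q , s) = L.resp (sym (trans (cong (solve 2 (λ z u → z := z :- u :+ u) refl z _))
          (trans (homo-+ _ _) (+-congˡ (trans (homo-* _ v) (*-congʳ (fixes (Subfield.rat∈ ℚ-field q))))))))
        (L.+∈ (image∈L σ vs vs∈ s) (L.*∈ (L.rat∈ q) (LAll.lookupₛ setoid L.resp v∈ (conjugate∈ v σ))))
        where open Embedding σ

      β-dens = b-dens {xs = conjugates β} (All.toList⁻ (LAll.head conjugates∈))

      A : ℕ
      A = proj₁ β-dens

      1≤A : 1 ≤ A
      1≤A = proj₁ (proj₂ β-dens)

      H₀ : ℕ
      H₀ = proj₁ (proj₂ (proj₂ β-dens))

      -- At least the cost `A` of multiplying by `nat A`, and at least the cost E H₀ of multiplying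
      -- by `nat A * β′` for any conjugate β′ of β.
      R : ℕ
      R = suc (A ℕ.+ E ℕ.* H₀)

      open GrowthRate (proj₁ (proj₂ tower)) R

      scale-A : ∀ {H z} m → Bnd H z → Bnd (H ℕ.* R ℕ.^ m) (nat A ^ m * z)
      scale-A {H} {z} zero    b = b-mono (ℕ.≤-reflexive (≡.sym (ℕ.*-identityʳ H))) (b-cong (sym (*-identityˡ z)) b)
      scale-A {H} {z} (suc m) b = b-mono (ℕ.≤-trans (ℕ.*-monoˡ-≤ (H ℕ.* R ℕ.^ m) {A} {R} (ℕ.m≤n⇒m≤1+n (ℕ.m≤m+n A _))) (ℕ.≤-reflexive (lem R H (R ℕ.^ m))))
          (b-cong (sym (*-assoc (nat A) _ z)) (b-nat A (scale-A m b)))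
        where
        lem : ∀ R H P → R ℕ.* (H ℕ.* P) ≡ H ℕ.* (R ℕ.* P)
        lem = solve-∀

      scale-β : ∀ {β′ H z} m → Bnd H₀ (nat A * β′) → Bnd H z → Bnd (H ℕ.* R ℕ.^ m) ((nat A * β′) ^ m * z)
      scale-β {β′} {H} {z} zero    b₀ b = b-mono (ℕ.≤-reflexive (≡.sym (ℕ.*-identityʳ H))) (b-cong (sym (*-identityˡ z)) b)
      scale-β {β′} {H} {z} (suc m) b₀ b = b-mono (ℕ.≤-trans (ℕ.≤-reflexive (≡.sym (ℕ.*-assoc E H₀ _)))
            (ℕ.≤-trans (ℕ.*-monoˡ-≤ (H ℕ.* R ℕ.^ m) {E ℕ.* H₀} {R} (ℕ.m≤n⇒m≤1+n (ℕ.m≤n+m _ A))) (ℕ.≤-reflexive (lem R H (R ℕ.^ m)))))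
          (b-cong (sym (*-assoc (nat A * β′) _ z)) (b-* b₀ (scale-β m b₀ b)))
        where
        lem : ∀ R H P → R ℕ.* (H ℕ.* P) ≡ H ℕ.* (R ℕ.* P)
        lem = solve-∀

      -- As r ≤ n, the right side is A ^ (n - r) (A β′) ^ r, a product of n factors of which each
      -- costs at most `R`. So passing from y ^ (j - n) to y ^ j costs R ^ n, and the powers below n
      -- are absorbed into `M` and `H`.
      growth-of-root : ∀ {y β′ n r} → L.Mem y → 1 ≤ n → r ≤ n → Bnd H₀ (nat A * β′) → y ^ n ≈ nat A ^ n * β′ ^ r → Growth y
      growth-of-root {y} {β′} {n} {r} y∈ 1≤n r≤n b₀ eq = M , proj₁ (proj₂ dens) , H , <-rec (λ j → Bnd (H ℕ.* R ℕ.^ j) (nat M * y ^ j)) step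
        where
        dens = b-dens {xs = Vec.tabulate {n = n} (λ i → y ^ Fin.toℕ i)} (All.tabulate⁺ (λ i → L.^∈ (Fin.toℕ i) y∈))
        M = proj₁ dens
        H = proj₁ (proj₂ (proj₂ dens))
        initial : ∀ {j} → j < n → Bnd H (nat M * y ^ j)
        initial {j} j<n = ≡.subst (λ i → Bnd H (nat M * y ^ i)) (Fin.toℕ-fromℕ< j<n) (All.tabulate⁻ (proj₂ (proj₂ (proj₂ dens))) (Fin.fromℕ< j<n))
        yⁿ : y ^ n ≈ nat A ^ (n ℕ.∸ r) * (nat A * β′) ^ r
        yⁿ = trans eq (trans (*-congʳ (trans (reflexive (≡.cong (nat A ^_) (≡.sym (ℕ.m∸n+n≡m r≤n)))) (^-+ (nat A) (n ℕ.∸ r) r)))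
          (trans (*-assoc _ _ _) (*-congˡ (sym (^-distrib-* (nat A) β′ r)))))
        step : ∀ j → (∀ {i} → i < j → Bnd (H ℕ.* R ℕ.^ i) (nat M * y ^ i)) → Bnd (H ℕ.* R ℕ.^ j) (nat M * y ^ j)
        step j rec with j ℕ.<? n
        ... | yes j<n = b-mono (ℕ.≤-trans (ℕ.≤-reflexive (≡.sym (ℕ.*-identityʳ H))) (ℕ.*-monoʳ-≤ H (1≤^ j (s≤s z≤n)))) (initial j<n)
        ... | no j≮n  = b-mono (ℕ.≤-reflexive exponent)
          (b-cong (trans (sym (*-assoc _ _ _)) (trans (*-congʳ (sym yⁿ)) (trans (solve 3 (λ u m v → u :* (m :* v) := m :* (u :* v)) refl (y ^ n) (nat M) _)
              (*-congˡ (trans (sym (^-+ y n (j ℕ.∸ n))) (reflexive (≡.cong (y ^_) (ℕ.m+[n∸m]≡n n≤j))))))))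
            (scale-A (n ℕ.∸ r) (scale-β r b₀ (rec (ℕ.∸-monoʳ-< 1≤n n≤j)))))
          where
          n≤j = ℕ.≮⇒≥ j≮n
          exponent : H ℕ.* R ℕ.^ (j ℕ.∸ n) ℕ.* R ℕ.^ r ℕ.* R ℕ.^ (n ℕ.∸ r) ≡ H ℕ.* R ℕ.^ j
          exponent = ≡.trans (lem H (R ℕ.^ (j ℕ.∸ n)) (R ℕ.^ r) (R ℕ.^ (n ℕ.∸ r))) (≡.cong (H ℕ.*_)
            (≡.trans (≡.cong (ℕ._* R ℕ.^ (j ℕ.∸ n)) (≡.trans (≡.sym (ℕ.^-distribˡ-+-* R (n ℕ.∸ r) r)) (≡.cong (R ℕ.^_) (ℕ.m∸n+n≡m r≤n))))
              (≡.trans (≡.sym (ℕ.^-distribˡ-+-* R n (j ℕ.∸ n))) (≡.cong (R ℕ.^_) (ℕ.m+[n∸m]≡n n≤j)))))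
            where
            lem : ∀ H P Q S → H ℕ.* P ℕ.* Q ℕ.* S ≡ H ℕ.* (S ℕ.* Q ℕ.* P)
            lem = solve-∀

      abstract
        -- The degree over ℚ is at most `D`, and the coefficients of the minimal polynomial are
        -- integers of size at most `suc R ^ D`; neither bound involves the exponent n.
        candidates : List Carrier
        candidates = rootsUpTo (suc D) (List.map int (ints (suc R ℕ.^ D)))

        -- Every conjugate over ℚ of y = A x is `τ y` for some embedding τ, and its n-th power is A
        -- ^ n (τ β) ^ r. So all conjugates of `y` grow at the rate `R`, and the coefficients of its
        -- minimal polynomial are bounded.
        candidate : ∀ {x n r} → Subfield.Mem K x → 1 ≤ n → r ≤ n → x ^ n ≈ β ^ r → nat A * x ∈ᴸ candidates
        candidate {x} {n} {r} x∈ 1≤n r≤n eq = ∈-rootsUpTo poly (s≤s degree) (resp-ints (proj₂ (split poly)) coefficients) isRoot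
          where
          y : Carrier
          y = nat A * x
          y∈ : Subfield.Mem K y
          y∈ = Subfield.*∈ K (Subfield.rat∈ K _) x∈
          N : MinPoly ℚ-field y
          N = minPoly ℚ-field y
          open MinPoly N renaming (n to e)
          degree : suc e ≤ D
          degree = let m , m≤D , p , py≈0 = degree≤ y∈ in ℕ.≤-trans (ℕ.≮⇒≥ λ m<e → minimal (map rat p) (Subfield.rats∈ ℚ-field p) m<e py≈0) m≤D
          growth : ∀ {y′} → y′ ∈ᴸ toList (roots poly) → Growth y′
          growth {y′} y′∈ = growth-of-root {β′ = τ β} {n} {r} (L.resp τy≈y′ (image∈L σ bs (LAll.tail conjugates∈) (spans y∈))) 1≤n r≤n
              (let b , β≈ = LAll.lookupAny (All.toList⁺ (proj₂ (proj₂ (proj₂ β-dens)))) (conjugate∈ β σ) in b-cong (*-congˡ (sym β≈)) b)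
              (trans (^-cong n (sym τy≈y′)) (trans (sym (homo-^ y n)) (trans (cong (trans (^-distrib-* (nat A) x n) (*-congˡ eq)))
                (trans (homo-* _ _) (*-cong (trans (homo-^ _ n) (^-cong n (fixes (Subfield.rat∈ ℚ-field _)))) (homo-^ β r))))))
            where
            σ : Embedding ℚ-field
            σ = proj₁ (conjugation ℚ-field N (roots-sound poly y′∈))
            open Embedding σ
            τy≈y′ : τ y ≈ y′
            τy≈y′ = proj₂ (conjugation ℚ-field N (roots-sound poly y′∈))
          coefficients : All (IsInteger (suc R ℕ.^ suc e)) (fromRoots (roots poly))
          coefficients = rational-coefficients (roots poly) L.1∈ (All.toList⁻ (LAll.tabulateₛ setoid growth))
            (All.map rational⁻ (Subfield.resp-All ℚ-field (proj₂ (split poly)) poly∈))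
          resp-ints : ∀ {m} {p q : Vec Carrier m} → p ≋ q → All (IsInteger (suc R ℕ.^ suc e)) q → All (_∈ᴸ List.map int (ints (suc R ℕ.^ D))) p
          resp-ints []         []                   = []
          resp-ints (eq ∷ eqs) ((i , le , q≈) ∷ qs) = LAny.map⁺ (lose (∈-ints i (ℕ.≤-trans le (ℕ.^-monoʳ-≤ (suc R) degree))) (trans eq q≈)) ∷ resp-ints eqs qs

    module _ (β≉0 : β ≉ 0#) (non-torsion : ∀ m → 1 ≤ m → β ^ m ≉ 1#) where

      private
        power-injective-≤ : ∀ {r s} → r ≤ s → β ^ r ≈ β ^ s → r ≡ s
        power-injective-≤ {r} {s} r≤s eq with ℕ.m≤n⇒m<n∨m≡n r≤s
        ... | inj₂ r≡s = r≡s
        ... | inj₁ r<s = ⊥-elim (non-torsion (s ℕ.∸ r) (ℕ.m<n⇒0<n∸m r<s) (*-cancelˡ (^-≉0 r β≉0)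
                (trans (sym (^-+ β r (s ℕ.∸ r))) (trans (reflexive (≡.cong (β ^_) (ℕ.m+[n∸m]≡n r≤s))) (trans (sym eq) (sym (*-identityʳ _)))))))

        power-injective : ∀ r s → β ^ r ≈ β ^ s → r ≡ s
        power-injective r s eq with ℕ.≤-total r s
        ... | inj₁ r≤s = power-injective-≤ r≤s eq
        ... | inj₂ s≤r = ≡.sym (power-injective-≤ s≤r (sym eq))

      degree-bound : ∃ λ B → ∀ {γ n d} → Subfield.Mem K γ → 1 ≤ n → 1 ≤ d → γ ^ n ≈ β ^ d → n ≤ B ℕ.* d
      degree-bound = length candidates , bound
        where
        bound : ∀ {γ n d} → Subfield.Mem K γ → 1 ≤ n → 1 ≤ d → γ ^ n ≈ β ^ d → n ≤ length candidates ℕ.* d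
        bound {γ} {n@(suc _)} {d} γ∈ 1≤n 1≤d eq = conclude (Fin.pigeonhole (ℕ.n<1+n _) (λ i → LAny.index (member (Fin.toℕ i))))
          where
          q r : ℕ → ℕ
          q j = (j ℕ.* d) / n
          r j = (j ℕ.* d) % n
          x : ℕ → Carrier
          x j = γ ^ j * inv β ^ q j
          inv-power : ∀ k → β ^ k * inv β ^ k ≈ 1#
          inv-power k = trans (sym (^-distrib-* β (inv β) k)) (trans (^-cong k (inverse β β≉0)) (1#-^ k))
          x^n : ∀ j → x j ^ n ≈ β ^ r j
          x^n j = trans (^-distrib-* (γ ^ j) (inv β ^ q j) n)
            (trans (*-cong
                (trans (sym (^-* γ j n)) (trans (reflexive (≡.cong (γ ^_) (ℕ.*-comm n j))) (trans (^-* γ n j) (trans (^-cong j eq) (trans (sym (^-* β d j))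
                  (trans (reflexive (≡.cong (β ^_) (m≡m%n+[m/n]*n (j ℕ.* d) n))) (^-+ β (r j) (q j ℕ.* n))))))))
                (trans (sym (^-* (inv β) (q j) n)) (reflexive (≡.cong (inv β ^_) (ℕ.*-comm n (q j))))))
              (trans (*-assoc _ _ _) (trans (*-congˡ (inv-power (q j ℕ.* n))) (*-identityʳ _))))
          member : ∀ j → nat A * x j ∈ᴸ candidates
          member j = candidate {n = n} {r j} (Subfield.*∈ K (Subfield.^∈ K j γ∈) (Subfield.^∈ K (q j) (Subfield.inv∈ K β∈ (inverse β β≉0)))) 1≤n
            (ℕ.<⇒≤ (m%n<n (j ℕ.* d) n)) (x^n j)
          same-x : ∀ i j → LAny.index (member i) ≡ LAny.index (member j) → x i ≈ x j
          same-x i j same = *-cancelˡ {nat A} {x i} {x j} (nat≥1-≉0 1≤A) (same-index⇒≈ {nat A * x i} {nat A * x j} {candidates} (member i) (member j) same)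
          same-r : ∀ i j → x i ≈ x j → r i ≡ r j
          same-r i j x≈x = power-injective (r i) (r j) (trans (sym (x^n i)) (trans (^-cong n x≈x) (x^n j)))
          conclude : (∃ λ i → ∃ λ j → i Fin.< j × LAny.index (member (Fin.toℕ i)) ≡ LAny.index (member (Fin.toℕ j))) → n ≤ length candidates ℕ.* d
          conclude (i , j , i<j , same) = ℕ.≤-trans
              (same-remainder⇒≤ {n} {Fin.toℕ i} {Fin.toℕ j} {d} 1≤d i<j (same-r (Fin.toℕ i) (Fin.toℕ j) (same-x (Fin.toℕ i) (Fin.toℕ j) same)))
              (ℕ.*-monoˡ-≤ d (ℕ.s≤s⁻¹ (Fin.toℕ<n j)))

-- Conjugacy classes of roots of z ^ n - β, and their number.

module Orbits {a ℓ} (Ω : ClosedField a ℓ) (K : Subfields.Subfield Ω) where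
  open ClosedField Ω
  open Roots Ω
  open Subfields Ω
  open Embeddings Ω
  open Bounded Ω
  open Heights Ω

  Conjugate : Carrier → Carrier → Set ℓ
  Conjugate x y = ev 1# (MinPoly.poly (minPoly K x)) y ≈ 0#

  conjugate? : ∀ x y → Dec (Conjugate x y)
  conjugate? x y = ev 1# (MinPoly.poly (minPoly K x)) y ≟ 0#

  conjugate⇒embedding : ∀ {x y} → Conjugate x y → ∃ λ (σ : Embedding K) → Embedding.τ σ x ≈ y
  conjugate⇒embedding {x} c = conjugation K (minPoly K x) c

  embedding⇒conjugate : ∀ {x y} (σ : Embedding K) → Embedding.τ σ x ≈ y → Conjugate x y
  embedding⇒conjugate {x} σ eq = trans (ev-cong₃ poly (sym eq)) (Embedding.preserves-roots σ poly poly∈ isRoot)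
    where open MinPoly (minPoly K x)

  -- An embedding with `x` sent to `y` takes the value at `x` of the minimal polynomial of `y` to
  -- its value at `y`, which is zero; and embeddings are injective.
  conjugate-sym : ∀ {x y} → Conjugate x y → Conjugate y x
  conjugate-sym {x} {y} c = injective (trans (homo-ev poly x (Subfield.1∈ K) poly∈)
    (trans (ev-cong₃ poly (proj₂ (conjugate⇒embedding c))) (trans isRoot (sym (fixes (Subfield.0∈ K))))))
    where
    open Embedding (proj₁ (conjugate⇒embedding c))
    open MinPoly (minPoly K y)

  conjugate-trans : ∀ {x y z} → Conjugate x y → Conjugate y z → Conjugate x z
  conjugate-trans {x} {y} c d = MinPoly.transfer (minPoly K y) (MinPoly.poly (minPoly K x)) (MinPoly.poly∈ (minPoly K x)) (Subfield.1∈ K) c d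

  Representative : List Carrier → Carrier → Set (a ⊔ ℓ)
  Representative rs x = LAny.Any (λ r → Conjugate r x) rs

  representative? : ∀ rs → Decidable (Representative rs)
  representative? rs x = LAny.any? (λ r → conjugate? r x) rs

  Inequivalent : List Carrier → Set (a ⊔ ℓ)
  Inequivalent = LAllPairs.AllPairs (λ x y → ¬ Conjugate y x)

  record Representatives (xs : List Carrier) : Set (a ⊔ ℓ) where
    field
      reps         : List Carrier
      reps∈        : LAll.All (_∈ᴸ xs) reps
      inequivalent : Inequivalent reps
      complete     : ∀ {x} → x ∈ᴸ xs → Representative reps x

    unique : ∀ i j → Conjugate (List.lookup reps i) (List.lookup reps j) → i ≡ j
    unique i j c with Fin.<-cmp i j
    ... | tri< i<j _ _ = ⊥-elim (AllPairs-lookup inequivalent i j i<j (conjugate-sym c))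
    ... | tri≈ _ i≡j _ = i≡j
    ... | tri> _ _ j<i = ⊥-elim (AllPairs-lookup inequivalent j i j<i c)

  representatives : ∀ xs → Representatives xs
  representatives []       = record { reps = [] ; reps∈ = [] ; inequivalent = [] ; complete = λ () }
  representatives (x ∷ xs) = add (representative? reps x)
    where
    open Representatives (representatives xs)
    weaken : LAll.All (_∈ᴸ x ∷ xs) reps
    weaken = LAll.map there reps∈
    conj-cong : ∀ {r y z} → y ≈ z → Conjugate r z → Conjugate r y
    conj-cong {r} y≈z c = trans (ev-cong₃ (MinPoly.poly (minPoly K r)) y≈z) c
    add : Dec (Representative reps x) → Representatives (x ∷ xs)
    add (yes any) = record
      { reps = reps ; reps∈ = weaken ; inequivalent = inequivalent
      ; complete = λ where (here y≈x)  → LAny.map (λ {r} → conj-cong {r} y≈x) any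
                           (there y∈) → complete y∈ }
    add (no none) = record
      { reps = x ∷ reps ; reps∈ = here refl ∷ weaken ; inequivalent = LAll.¬Any⇒All¬ reps none ∷ inequivalent
      ; complete = λ where (here y≈x)  → here (conj-cong {x} y≈x (MinPoly.isRoot (minPoly K x)))
                           (there y∈) → there (complete y∈) }

  class : Carrier → List Carrier
  class x = toList (roots (MinPoly.poly (minPoly K x)))

  class-distinct : ∀ x → LAllPairs.AllPairs _≉_ (class x)
  class-distinct x = toList-distinct (Adjoin.roots-distinct K (minPoly K x))

  class-sound : ∀ {x y} → y ∈ᴸ class x → Conjugate x y
  class-sound {x} = roots-sound (MinPoly.poly (minPoly K x))

  length-class : ∀ x → length (class x) ≡ suc (MinPoly.n (minPoly K x))
  length-class x = Vec.length-toList (roots (MinPoly.poly (minPoly K x)))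

  all∈ : ∀ xs {ys} → (∀ {x} → x ∈ᴸ xs → x ∈ᴸ ys) → LAll.All (_∈ᴸ ys) xs
  all∈ xs sub = LAll.tabulateₛ setoid sub

  classes-distinct : ∀ {rs} → Inequivalent rs → LAllPairs.AllPairs _≉_ (List.concatMap class rs)
  classes-distinct {rs} ineq = LAllPairs.concat⁺ (LAll.map⁺ (LAll.universal class-distinct rs))
    (LAllPairs.map⁺ (LAllPairs.map (λ {x} {y} ¬c → LAll.tabulateₛ setoid λ u∈ → LAll.tabulateₛ setoid λ v∈ u≈v → ¬c
      (conjugate-trans {y} {_} {x} (class-sound v∈) (conjugate-sym (trans (ev-cong₃ (MinPoly.poly (minPoly K x)) (sym u≈v)) (class-sound u∈))))) ineq))

  module _ {β} (β∈ : Subfield.Mem K β) {n : ℕ} where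

    binomial : Vec Carrier (suc n)
    binomial = - β ∷ replicate n 0#

    ev-binomial : ∀ x → ev 1# binomial x ≈ x ^ suc n - β
    ev-binomial x = trans (+-congˡ (*-congˡ (trans (ev-lead 1# (replicate n 0#) x) (+-congʳ (ev-zero x (zeros n))))))
      (solve 3 (λ b x u → :- b :+ x :* (con (+ 0) :+ con (+ 1) :* u) := x :* u :- b) refl β x _)

    binomial∈ : All (Subfield.Mem K) binomial
    binomial∈ = Subfield.-∈ K β∈ ∷ Subfield.zeros∈ K n

    binomialRoots : List Carrier
    binomialRoots = toList (roots binomial)

    -- The square of the constant coefficient, an element of K with no sign ambiguity.
    norm² : ∀ {d} (rs : Vec Carrier d) → (∀ {x} → x ∈ᴸ toList rs → x ^ suc n ≈ β) →
            (ev 1# (fromRoots rs) 0# * ev 1# (fromRoots rs) 0#) ^ suc n ≈ β ^ (d ℕ.+ d)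
    norm² [] _ = trans (^-cong (suc n) (*-identityˡ 1#)) (1#-^ (suc n))
    norm² {suc d} (r ∷ rs) powers = trans (^-cong (suc n) (trans (*-cong e≈ e≈)
        (solve 2 (λ r e → (con (+ 0) :- r) :* e :* ((con (+ 0) :- r) :* e) := r :* (r :* (e :* e))) refl r e)))
      (trans (^-distrib-* r (r * (e * e)) (suc n)) (trans (*-cong rⁿ (trans (^-distrib-* r (e * e) (suc n)) (*-cong rⁿ (norm² rs (λ x∈ → powers (there x∈))))))
        (reflexive (≡.cong (λ m → β * β ^ m) (≡.sym (ℕ.+-suc d d))))))
      where
      e = ev 1# (fromRoots rs) 0#
      e≈ = ev-mulLinear r (fromRoots rs) 0#
      rⁿ = powers (here refl)

    class⊆roots : ∀ {x} → x ∈ᴸ binomialRoots → ∀ {y} → y ∈ᴸ class x → y ∈ᴸ binomialRoots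
    class⊆roots {x} x∈ y∈ = roots-complete binomial
      (MinPoly.transfer (minPoly K x) binomial binomial∈ (Subfield.1∈ K) (roots-sound binomial x∈) (class-sound y∈))

    root-power : ∀ {x} → x ∈ᴸ binomialRoots → x ^ suc n ≈ β
    root-power {x} x∈ = x-y≈0⇒x≈y (trans (sym (ev-binomial x)) (roots-sound binomial x∈))

    module _ {B : ℕ} (bound : ∀ {γ n d} → Subfield.Mem K γ → 1 ≤ n → 1 ≤ d → γ ^ n ≈ β ^ d → n ≤ B ℕ.* d) where

      -- `bound` is applied to the square of the constant coefficient of the minimal polynomial,
      -- whose `suc n`-th power is β to twice the degree; hence `B ℕ.+ B`.
      class-large : ∀ {x} → x ∈ᴸ binomialRoots → suc n ≤ (B ℕ.+ B) ℕ.* length (class x)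
      class-large {x} x∈ = ℕ.≤-trans (bound γ∈ (s≤s z≤n) (s≤s z≤n) (trans (^-cong (suc n) (*-cong p≈ p≈)) (norm² (roots poly) (λ y∈ → root-power (class⊆roots x∈ y∈)))))
        (ℕ.≤-reflexive (≡.trans (lem B (suc e)) (≡.cong ((B ℕ.+ B) ℕ.*_) (≡.sym (length-class x)))))
        where
        open MinPoly (minPoly K x) renaming (n to e)
        γ∈ : Subfield.Mem K (ev 1# poly 0# * ev 1# poly 0#)
        γ∈ = Subfield.*∈ K (Subfield.ev∈ K (Subfield.1∈ K) poly∈ (Subfield.0∈ K)) (Subfield.ev∈ K (Subfield.1∈ K) poly∈ (Subfield.0∈ K))
        p≈ : ev 1# poly 0# ≈ ev 1# (fromRoots (roots poly)) 0#
        p≈ = ev-cong refl (proj₂ (split poly)) refl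
        lem : ∀ B d → B ℕ.* (d ℕ.+ d) ≡ (B ℕ.+ B) ℕ.* d
        lem = solve-∀

      classes-large : ∀ {rs} → LAll.All (_∈ᴸ binomialRoots) rs →
                      length rs ℕ.* suc n ≤ (B ℕ.+ B) ℕ.* length (List.concatMap class rs)
      classes-large []            = z≤n
      classes-large {r ∷ rs} (r∈ ∷ rs∈) = ℕ.≤-trans (ℕ.+-mono-≤ (class-large r∈) (classes-large rs∈))
        (ℕ.≤-reflexive (≡.trans (≡.sym (ℕ.*-distribˡ-+ (B ℕ.+ B) (length (class r)) (length (List.concatMap class rs))))
          (≡.cong ((B ℕ.+ B) ℕ.*_) (≡.sym (List.length-++ (class r))))))

      -- The classes are disjoint and consist of roots of a polynomial of degree `suc n`, so
      -- together they have at most `suc n` elements; cancel `suc n` in `classes-large`.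
      few-classes : (R : Representatives binomialRoots) → length (Representatives.reps R) ≤ B ℕ.+ B
      few-classes R = ℕ.*-cancelʳ-≤ (length reps) (B ℕ.+ B) (suc n) (ℕ.≤-trans (classes-large reps∈)
        (ℕ.*-monoʳ-≤ (B ℕ.+ B) (ℕ.≤-trans (pigeonhole (classes-distinct inequivalent) members) (ℕ.≤-reflexive (Vec.length-toList (roots binomial))))))
        where
        open Representatives R
        members : LAll.All (_∈ᴸ binomialRoots) (List.concatMap class reps)
        members = LAll.concat⁺ (LAll.map⁺ (LAll.map (λ {r} r∈ → all∈ (class r) (class⊆roots r∈)) reps∈))

-- Galois orbits as conjugacy classes over the image of K.

module Theorem {a ℓ₁ ℓ₂ b m₁ m₂} (K : NumberField a ℓ₁ ℓ₂)
  (K̄ : AlgebraicClosure (NumberField.heytingField K) b m₁ m₂) where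

  private
    Ω : ClosedField b m₁
    Ω = Closure.closedField K K̄

    module K where
      open NumberFieldProperties K public
      open NumberField K public using (Carrier; basis; degree; commutativeRing)
      open CommutativeRing commutativeRing public hiding (Carrier)

  open Closure K K̄ using (ι-injective)
  open AlgebraicClosure K̄ using (embedding; ι)
  private module ι = RingHomomorphism embedding
  open ClosedField Ω
  open Roots Ω
  open Subfields Ω
  open Embeddings Ω
  open Bounded Ω
  open Rationals Ω
  open Heights Ω
  open Galois K̄ using (Automorphism; Root; GaloisOrbits; NumberOfGaloisOrbits)

  InImage : Carrier → Set (a ⊔ m₁)
  InImage z = ∃ λ x → z ≈ ι x

  private
    image : ∃ λ k → (∀ {x} → Subfield.Mem ℚ-field x → Subfield.Mem k x) ×
                    LAll.All (Subfield.Mem k) (List.tabulate (λ i → ι (K.basis i))) × (∀ {x} → Subfield.Mem k x → InImage x)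
    image = generated InImage
      (λ x≈y (u , e) → u , trans (sym x≈y) e)
      (K.0# , sym ι.0#-homo)
      (λ (u , e) (v , e′) → u K.+ v , trans (+-cong e e′) (sym (ι.+-homo u v)))
      (λ (u , e) (v , e′) → u K.* v , trans (*-cong e e′) (sym (ι.*-homo u v)))
      ℚ-field (List.tabulate (λ i → ι (K.basis i)))
      (λ x∈ → let q , e = rational⁻ x∈ in K.rat q , e)
      (LAll.tabulate⁺ (λ i → K.basis i , refl))

  -- The whole image of K: `base⁻` and `base⁺` are the two inclusions, the second because the basis
  -- of K was adjoined.
  base : Subfield
  base = proj₁ image

  base⁻ : ∀ {z} → Subfield.Mem base z → InImage z
  base⁻ = proj₂ (proj₂ (proj₂ image))

  ι-span : ∀ {D} (f : Fin D → K.Carrier) {x} → K.Span (List.tabulate f) x → Span (List.tabulate (λ i → ι (f i))) (ι x)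
  ι-span {zero}  f s = trans (ι.⟦⟧-cong s) ι.0#-homo
  ι-span {suc D} f (q , s) = q , span-cong (List.tabulate (λ i → ι (f (Fin.suc i))))
    (trans (ι.+-homo _ _) (+-congˡ (trans (ι.-‿homo _) (-‿cong (ι.*-homo _ _)))))
    (ι-span (λ i → f (Fin.suc i)) s)

  span∈ : ∀ (k : Subfield) {vs z} → LAll.All (Subfield.Mem k) vs → Span vs z → Subfield.Mem k z
  span∈ k {[]}     []         z≈0     = Subfield.resp k (sym z≈0) (Subfield.0∈ k)
  span∈ k {v ∷ vs} {z} (v∈ ∷ vs∈) (q , s) = Subfield.resp k (solve 3 (λ z q v → z :- q :* v :+ q :* v := z) refl z (rat q) v)
    (Subfield.+∈ k (span∈ k vs∈ s) (Subfield.*∈ k (Subfield.rat∈ k q) v∈))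

  base-span : ∀ x → Span (List.tabulate (λ i → ι (K.basis i))) (ι x)
  base-span x = ι-span K.basis (K.span-basis x)

  base⁺ : ∀ x → Subfield.Mem base (ι x)
  base⁺ x = span∈ base (proj₁ (proj₂ (proj₂ image))) (base-span x)

  ι-ev : ∀ {n} (p : Vec ℚ n) x → ι (K.ev K.1# (map K.rat p) x) ≈ ev 1# (map rat p) (ι x)
  ι-ev []      x = ι.1#-homo
  ι-ev (q ∷ p) x = trans (ι.+-homo _ _) (+-congˡ (trans (ι.*-homo _ _) (*-congˡ (ι-ev p x))))

  ι-^ : ∀ x n → ι (x K.^ n) ≈ ι x ^ n
  ι-^ x zero    = ι.1#-homo
  ι-^ x (suc n) = trans (ι.*-homo _ _) (*-congˡ (ι-^ x n))

  base-degree : ∀ {z} → Subfield.Mem base z → ∃ λ n → n ≤ K.degree × ∃ λ (p : Vec ℚ n) → ev 1# (map rat p) z ≈ 0#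
  base-degree z∈ =
    let x , z≈ = base⁻ z∈
        n , n≤ , p , eq = K.algebraic≤ x
    in n , n≤ , p , trans (ev-cong₃ (map rat p) z≈) (trans (sym (ι-ev p x)) (trans (ι.⟦⟧-cong eq) ι.0#-homo))

  embedding⇒automorphism : Embedding base → Automorphism
  embedding⇒automorphism σ = record
    { ⟦_⟧ = τ
    ; isRingIsomorphism = record
      { isRingMonomorphism = record
        { isRingHomomorphism = record
          { isSemiringHomomorphism = record
            { isNearSemiringHomomorphism = record
              { +-isMonoidHomomorphism = record
                { isMagmaHomomorphism = record { isRelHomomorphism = record { cong = cong } ; homo = homo-+ }
                ; ε-homo = fixes (Subfield.0∈ base)
                }
              ; *-homo = homo-*
              }
            ; 1#-homo = fixes (Subfield.1∈ base)
            }
          ; -‿homo = homo-neg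
          }
        ; injective = injective
        }
      ; surjective = λ y → let x , eq = surjective y in x , λ z≈x → trans (cong z≈x) eq
      }
    ; fixes = λ x → fixes (base⁺ x)
    }
    where open Embedding σ

  automorphism⇒embedding : Automorphism → Embedding base
  automorphism⇒embedding σ = record
    { τ      = ⟦_⟧
    ; cong   = ⟦⟧-cong
    ; homo-+ = +-homo
    ; homo-* = *-homo
    ; fixes  = λ x∈ → let u , e = base⁻ x∈ in trans (⟦⟧-cong e) (trans (fixes u) (sym e))
    }
    where open Automorphism σ

  open Orbits Ω base

  module _ {β : K.Carrier} {B : ℕ} (bound : ∀ {γ n d} → Subfield.Mem base γ → 1 ≤ n → 1 ≤ d → γ ^ n ≈ ι β ^ d → n ≤ B ℕ.* d) where

    -- Embeddings over `base` are surjective, so they are the Galois automorphisms, and two roots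
    -- share an orbit exactly when they are conjugate. The positions in `reps` therefore number the
    -- orbits.
    orbits : ∀ n → ∃ λ k → NumberOfGaloisOrbits (suc n) β k × k ≤ B ℕ.+ B
    orbits n = length reps , record
      { to        = rootAt
      ; from      = λ (x , eq) → LAny.index (locate x eq)
      ; to-cong   = λ i≡j → reflexive-orbit i≡j
      ; from-cong = λ {(x , eq)} {(y , eq′)} (σ , σx≈y) → unique _ _
          (conjugate-trans (LAny.lookup-index (locate x eq))
            (conjugate-trans {x} {y} (embedding⇒conjugate (automorphism⇒embedding σ) σx≈y) (conjugate-sym (LAny.lookup-index (locate y eq′)))))
      ; inverse   =
          (λ {(x , eq)} {i} i≡ → orbit (≡.subst (λ j → Conjugate (List.lookup reps j) x) (≡.sym i≡) (LAny.lookup-index (locate x eq))))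
        , (λ {i} {(x , eq)} (σ , σx≈) → unique _ _ (conjugate-trans (LAny.lookup-index (locate x eq))
            (embedding⇒conjugate (automorphism⇒embedding σ) σx≈)))
      } , few-classes (base⁺ β) {n} {B} bound R
      where
      zs : List Carrier
      zs = binomialRoots (base⁺ β) {n}
      R : Representatives zs
      R = representatives zs
      open Representatives R
      locate : ∀ x → x ^ suc n - ι β ≈ 0# → Representative reps x
      locate x eq = complete (roots-complete (binomial (base⁺ β) {n}) (trans (ev-binomial (base⁺ β) {n} x) eq))
      rootAt : Fin (length reps) → Root (suc n) β
      rootAt i = List.lookup reps i , x≈y⇒x-y≈0 (root-power (base⁺ β) {n} (LAll.lookup reps∈ (Membership.∈-lookup i)))
      orbit : ∀ {x y} → Conjugate x y → ∃ λ (σ : Automorphism) → Automorphism.⟦_⟧ σ x ≈ y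
      orbit c = let σ , eq = conjugate⇒embedding c in embedding⇒automorphism σ , eq
      reflexive-orbit : ∀ {i j} → i ≡ j → ∃ λ (σ : Automorphism) → Automorphism.⟦_⟧ σ (List.lookup reps i) ≈ List.lookup reps j
      reflexive-orbit ≡.refl = Galois.identity K̄ , refl

theorem1p3 : ∀ {a ℓ₁ ℓ₂ b m₁ m₂} (K : NumberField a ℓ₁ ℓ₂)
    (K̄ : AlgebraicClosure (NumberField.heytingField K) b m₁ m₂)
    (β : NumberField.Carrier K) →
    ¬ NumberField._≈_ K β (NumberField.0# K) →
    ¬ NumberField.IsRootOfUnity K β →
    ∃ λ (B : ℕ) → ∀ (n : ℕ) → 1 ≤ n →
    ∃ λ (k : ℕ) → Galois.NumberOfGaloisOrbits K̄ n β k × k ≤ B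
theorem1p3 K K̄ β β≉0 non-torsion = B ℕ.+ B , λ where (suc n) _ → orbits {β} {B} bound n
  where
  open Theorem K K̄
  open ClosedField (Closure.closedField K K̄)
  open Closure K K̄ using (ι-injective)
  open AlgebraicClosure K̄ using (embedding; ι)
  module ι = RingHomomorphism embedding
  open Heights (Closure.closedField K K̄)
  height : ∃ λ B → ∀ {γ n d} → Subfields.Subfield.Mem base γ → 1 ≤ n → 1 ≤ d → γ ^ n ≈ ι β ^ d → n ≤ B ℕ.* d
  height = degree-bound base (List.tabulate (λ i → ι (NumberField.basis K i)))
    (λ z∈ → let x , z≈ = base⁻ z∈ in span-cong (List.tabulate (λ i → ι (NumberField.basis K i))) (sym z≈) (base-span x))
    (NumberField.degree K) base-degree (base⁺ β)
    (λ eq → β≉0 (ι-injective (trans eq (sym ι.0#-homo))))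
    (λ m 1≤m eq → non-torsion (m , 1≤m , ι-injective (trans (ι-^ β m) (trans eq (sym ι.1#-homo)))))
  B = proj₁ height
  bound = λ {γ} {n} {d} → proj₂ height {γ} {n} {d}
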